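{- For any class of treewidth-bounded graphs there is a polynomial-time $O\!\left(\frac{\log n}{\log\log n}\right)$-approximation algorithm for the minimum rooted broadcast time problem and the minimum broadcast time problem, where $n$ is the number of nodes.
   Context: Given an unweighted graph $G$ and a root $r$, a broadcast scheme is a method for communicating a message from $r$ to all the nodes of $G$. In the telephone model, messages are transmitted synchronously and at each time step any node can either transmit a message to or receive a message from at most one of its neighbors. $OPT_r(G)$ denotes the minimum number of time steps of a scheme that completes the broadcast from root $r$, and $OPT(G)=\max_{r\in G}OPT_r(G)$. The minimum rooted broadcast time problem is that of computing $OPT_r(G)$ (with a corresponding scheme), and the minimum broadcast time problem is that of computing $OPT(G)$. A $\rho$-approximation algorithm returns a solution whose value is within a factor $\rho$ of the optimal value on every instance. A class of treewidth-bounded graphs $\Gamma$ is inductively defined as follows. (1) The number of primitive graphs in $\Gamma$ is finite. (2) Each graph in $\Gamma$ has an ordered set of special nodes called terminals; the number of terminals in each graph is bounded by a constant, say $k$. (3) There is a finite collection of binary composition rules that operate only at terminals, either by identifying two terminals or adding an edge between terminals. A composition rule also determines the terminals of the resulting graph, which must be a subset of the terminals of the two graphs being composed. The given graph is assumed to be accompanied by a parse tree, of size linear in the number of nodes, specifying how it is constructed using the rules. -}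

module Defs where

open import Data.Fin.Base using (Fin; toℕ; punchOut; _↑ˡ_; _↑ʳ_)
open import Data.Fin.Properties using (_≟_)
open import Data.List.Base
  using (List; []; _∷_; _++_; map; foldr; length; concatMap; tabulate)
open import Data.List.Membership.Propositional using (_∈_)
open import Data.List.Relation.Unary.All using (All)
open import Data.List.Relation.Unary.Unique.Propositional using (Unique)
open import Data.Nat.Base using (ℕ; zero; suc; _+_; _*_; _^_; _≤_; _⊔_)
open import Data.Nat.Logarithm using (⌊log₂_⌋)
open import Data.Product.Base using (Σ; ∃; ∃₂; _×_; _,_; proj₁)
open import Data.Sum.Base using (_⊎_; inj₁; inj₂; [_,_])
open import Data.Vec.Base as Vec using (Vec; lookup)
open import Function.Base using (_∘_)
open import Function.Bundles using (_↔_; _⇔_; module Inverse)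
open import Function.Definitions using (Injective)
open import Relation.Binary.Construct.Closure.Equivalence using (EqClosure)
open import Relation.Binary.Construct.Closure.ReflexiveTransitive using (Star)
open import Relation.Binary.PropositionalEquality using (_≡_; _≢_)
open import Relation.Nullary.Decidable using (yes; no)

------------------------------------------------------------------------
-- Graphs

-- The edge list is a presentation: only `Adj` matters, so orientation,
-- repetitions and loops in the list are irrelevant.

record Graph : Set where
  constructor mkGraph
  field
    order : ℕ
    edges : List (Fin order × Fin order)

open Graph public

Node : Graph → Set
Node G = Fin (order G)

Adj : (G : Graph) → Node G → Node G → Set
Adj G u v = u ≢ v × ((u , v) ∈ edges G ⊎ (v , u) ∈ edges G)

Connected : Graph → Set
Connected G = ∀ u v → Star (Adj G) u v

record _≅_ (G H : Graph) : Set where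
  field
    bijection : Node G ↔ Node H
    adjacency : ∀ u v →
      Adj G u v ⇔ Adj H (Inverse.to bijection u) (Inverse.to bijection v)

------------------------------------------------------------------------
-- Broadcasting in the telephone model

-- A round is the list of the calls (sender , receiver) made in one time
-- step.

Round : Graph → Set
Round G = List (Node G × Node G)

IsRound : (G : Graph) → Round G → Set
IsRound G calls =
  All (λ (u , v) → Adj G u v) calls ×
  Unique (concatMap (λ (u , v) → u ∷ v ∷ []) calls)

-- `InformedAfter G I s v`: node v knows the message after the rounds s if
-- exactly the nodes in I knew it before.  A call whose sender does not
-- know the message has no effect.

InformedAfter : (G : Graph) → (Node G → Set) → List (Round G) → Node G → Set
InformedAfter G I []          v = I v
InformedAfter G I (calls ∷ s) v =
  InformedAfter G (λ w → I w ⊎ ∃ λ u → I u × (u , w) ∈ calls) s v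

record Scheme (G : Graph) (r : Node G) : Set where
  field
    rounds    : List (Round G)
    telephone : All (IsRound G) rounds
    complete  : ∀ v → InformedAfter G (_≡ r) rounds v

  time : ℕ
  time = length rounds

-- `IsOPTᵣ G r t` says OPT_r(G) = t, and `IsOPT G t` says OPT(G) = t.

IsOPTᵣ : (G : Graph) → Node G → ℕ → Set
IsOPTᵣ G r t =
  (Σ (Scheme G r) λ s → Scheme.time s ≡ t) ×
  (∀ (s : Scheme G r) → t ≤ Scheme.time s)

IsOPT : Graph → ℕ → Set
IsOPT G t =
  (∀ r → ∃ λ t′ → IsOPTᵣ G r t′ × t′ ≤ t) ×
  (∃ λ r → IsOPTᵣ G r t)

------------------------------------------------------------------------
-- Classes of treewidth-bounded graphs

record Labelled (X : Set) : Set where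
  constructor mkLabelled
  field
    graph : Graph
    label : X → Node graph

open Labelled public

-- Graphs with k terminals, in order.

TGraph : ℕ → Set
TGraph k = Labelled (Fin k)

mapEdges : ∀ {m n} → (Fin m → Fin n) →
           List (Fin m × Fin m) → List (Fin n × Fin n)
mapEdges f = map (λ (u , v) → f u , f v)

-- The terminals of the two graphs being composed.

Terminal : ℕ → ℕ → Set
Terminal k₁ k₂ = Fin k₁ ⊎ Fin k₂

data Operation (X : Set) : Set where
  identify : X → X → Operation X
  addEdge  : X → X → Operation X

-- The node a is merged into the node b.

merge : ∀ {n} {a b : Fin n} → a ≢ b → ∃ λ m → Fin n → Fin m
merge {suc m} {a} {b} a≢b = m , collapse
  where
  collapse : Fin (suc m) → Fin m
  collapse c with a ≟ c
  ... | yes _  = punchOut a≢b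
  ... | no a≢c = punchOut a≢c

apply : ∀ {X} → Operation X → Labelled X → Labelled X
apply (addEdge x y) (mkLabelled (mkGraph n es) ℓ) =
  mkLabelled (mkGraph n ((ℓ x , ℓ y) ∷ es)) ℓ
apply (identify x y) S@(mkLabelled (mkGraph n es) ℓ) with ℓ x ≟ ℓ y
... | yes _ = S
... | no ≢  = let (m , f) = merge ≢ in
  mkLabelled (mkGraph m (mapEdges f es)) (f ∘ ℓ)

disjointUnion : ∀ {k₁ k₂} → TGraph k₁ → TGraph k₂ → Labelled (Terminal k₁ k₂)
disjointUnion (mkLabelled (mkGraph m es) ℓ) (mkLabelled (mkGraph n fs) ℓ′) =
  mkLabelled
    (mkGraph (m + n) (mapEdges (_↑ˡ n) es ++ mapEdges (m ↑ʳ_) fs))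
    [ (λ i → ℓ i ↑ˡ n) , (λ j → m ↑ʳ ℓ′ j) ]

-- A rule applies to operands with `left` and `right` terminals.  (The
-- number of terminals being bounded, a rule meant for several arities is
-- a finite family of these.)  Up to isomorphism the order of the
-- operations is immaterial.  The condition `distinct` says that the
-- chosen terminals of the result are pairwise different nodes.

record Rule (k : ℕ) : Set where
  field
    left right   : ℕ
    operations   : List (Operation (Terminal left right))
    arity        : ℕ
    arity-bound  : arity ≤ k
    keep         : Fin arity → Terminal left right
    distinct     : ∀ i j →
      EqClosure (λ x y → identify x y ∈ operations) (keep i) (keep j) → i ≡ j

compose : ∀ {k} (ρ : Rule k) →
          TGraph (Rule.left ρ) → TGraph (Rule.right ρ) → TGraph (Rule.arity ρ)
compose ρ A B = mkLabelled (graph S) (label S ∘ keep)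
  where
  open Rule ρ
  S : Labelled (Terminal left right)
  S = foldr apply (disjointUnion A B) operations

record Primitive (k : ℕ) : Set where
  field
    arity       : ℕ
    arity-bound : arity ≤ k
    tgraph      : TGraph arity
    distinct    : Injective _≡_ _≡_ (label tgraph)

record TreewidthBoundedClass : Set where
  field
    k           : ℕ
    #prims : ℕ
    prim   : Fin #prims → Primitive k
    #rules      : ℕ
    rule        : Fin #rules → Rule k

module _ (Γ : TreewidthBoundedClass) where
  open TreewidthBoundedClass Γ

  data ParseTree : ℕ → Set where
    leaf : ∀ i → ParseTree (Primitive.arity (prim i))
    node : ∀ j → ParseTree (Rule.left (rule j)) →
           ParseTree (Rule.right (rule j)) → ParseTree (Rule.arity (rule j))

module _ {Γ : TreewidthBoundedClass} where
  open TreewidthBoundedClass Γ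

  ⟦_⟧ : ∀ {a} → ParseTree Γ a → TGraph a
  ⟦ leaf i ⟧     = Primitive.tgraph (prim i)
  ⟦ node j l r ⟧ = compose (rule j) ⟦ l ⟧ ⟦ r ⟧

  parseSize : ∀ {a} → ParseTree Γ a → ℕ
  parseSize (leaf _)     = 1
  parseSize (node _ l r) = suc (parseSize l + parseSize r)

-- A connected graph of the class (connectedness makes OPT finite) with a
-- parse tree of at most c · n nodes.  The graph may have any node names;
-- `names` tells which node of the graph each node of the parsed graph is.

record Network (Γ : TreewidthBoundedClass) (c : ℕ) : Set where
  field
    network   : Graph
    connected : Connected network
    {arity}   : ℕ
    parse     : ParseTree Γ arity
    linear    : parseSize parse ≤ c * order network
    names     : graph ⟦ parse ⟧ ≅ network

------------------------------------------------------------------------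
-- Model of computation

-- Programs are systems of mutually recursive first-order unary functions
-- over binary trees, evaluated by value.  A step takes constant time on a
-- pointer machine with shared subtrees (environments have a length fixed
-- by the program, and trees are only inspected one constructor at a
-- time), so polynomial time here is polynomial time on Turing machines
-- for outputs of polynomial size.

infixr 5 _∙_

data Tree : Set where
  nil : Tree
  _∙_ : Tree → Tree → Tree

∣_∣ : Tree → ℕ
∣ nil ∣   = 1
∣ x ∙ y ∣ = suc (∣ x ∣ + ∣ y ∣)

-- `Exp f n`: expressions over f function names and n variables.  The
-- second branch of `case` binds the left subtree as variable 0 and the
-- right subtree as variable 1.

data Exp (f n : ℕ) : Set where
  var  : Fin n → Exp f n
  nil  : Exp f n
  cons : Exp f n → Exp f n → Exp f n
  case : Exp f n → Exp f n → Exp f (2 + n) → Exp f n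
  let′ : Exp f n → Exp f (1 + n) → Exp f n
  call : Fin f → Exp f n → Exp f n

record Program : Set where
  field
    #functions : ℕ
    body       : Vec (Exp #functions 1) #functions
    main       : Exp #functions 1

module _ (P : Program) where
  open Program P

  -- `Eval env e y t`: e evaluates to y in t steps.

  data Eval {n : ℕ} (env : Vec Tree n) : Exp #functions n → Tree → ℕ → Set where
    var  : ∀ i → Eval env (var i) (lookup env i) 1
    nil  : Eval env nil nil 1
    cons : ∀ {d e x y s t} → Eval env d x s → Eval env e y t →
           Eval env (cons d e) (x ∙ y) (suc (s + t))
    case-nil  : ∀ {d e₀ e₁ y s t} → Eval env d nil s → Eval env e₀ y t →
                Eval env (case d e₀ e₁) y (suc (s + t))
    case-cons : ∀ {d e₀ e₁ x₁ x₂ y s t} → Eval env d (x₁ ∙ x₂) s →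
                Eval (x₁ Vec.∷ x₂ Vec.∷ env) e₁ y t →
                Eval env (case d e₀ e₁) y (suc (s + t))
    let′ : ∀ {d e x y s t} → Eval env d x s → Eval (x Vec.∷ env) e y t →
           Eval env (let′ d e) y (suc (s + t))
    call : ∀ {g e x y s t} → Eval env e x s →
           Eval (x Vec.∷ Vec.[]) (lookup body g) y t →
           Eval env (call g e) y (suc (s + t))

  Computes : Tree → Tree → ℕ → Set
  Computes x y t = Eval (x Vec.∷ Vec.[]) main y t

------------------------------------------------------------------------
-- Encodings

-- Numbers are unary; every number below is at most polynomial in the
-- number of nodes, so this does not affect polynomial time.

encℕ : ℕ → Tree
encℕ zero    = nil
encℕ (suc n) = nil ∙ encℕ n

encFin : ∀ {n} → Fin n → Tree
encFin = encℕ ∘ toℕ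

encList : ∀ {A : Set} → (A → Tree) → List A → Tree
encList enc = foldr (λ x t → enc x ∙ t) nil

encPair : ∀ {n} → Fin n × Fin n → Tree
encPair (u , v) = encFin u ∙ encFin v

encGraph : Graph → Tree
encGraph G = encℕ (order G) ∙ encList encPair (edges G)

encParse : ∀ {Γ a} → ParseTree Γ a → Tree
encParse (leaf i)     = nil ∙ encFin i
encParse (node j l r) = (nil ∙ nil) ∙ encFin j ∙ encParse l ∙ encParse r

encNetwork : ∀ {Γ c} → Network Γ c → Tree
encNetwork N =
  encGraph network ∙ encParse parse ∙
  encList encFin (tabulate (Inverse.to (_≅_.bijection names)))
  where open Network N

encScheme : ∀ {G r} → Scheme G r → Tree
encScheme s = encList (encList encPair) (Scheme.rounds s)

------------------------------------------------------------------------
-- Approximation algorithms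

record MinProblem : Set₁ where
  field
    Instance  : Set
    encI      : Instance → Tree
    nodes     : Instance → ℕ
    Solution  : Instance → Set
    encS      : ∀ {I} → Solution I → Tree
    value     : ∀ {I} → Solution I → ℕ
    IsOptimum : Instance → ℕ → Set

-- A ρ-approximation algorithm, with ρ a function of the number of nodes,
-- returning a solution together with its value in time at most
-- a · (input size) ^ d.

PolyTimeApproximation : MinProblem → (ℕ → ℕ) → Set
PolyTimeApproximation Π ρ =
  Σ Program λ P → ∃₂ λ a d → (I : Instance) →
  Σ (Solution I) λ s → ∃ λ t →
    Computes P (encI I) (encℕ (value s) ∙ encS s) t ×
    t ≤ a * ∣ encI I ∣ ^ d ×
    (∀ opt → IsOptimum I opt → value s ≤ ρ (nodes I) * opt)
  where open MinProblem Π

-- ρ(n) = O(log n / log log n).  The denominator is positive for n ≥ 4, and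
-- rounding the logarithms or ρ only changes the constant.

IsO[log/loglog] : (ℕ → ℕ) → Set
IsO[log/loglog] ρ = ∃₂ λ C n₀ → ∀ n → n₀ ≤ n →
  ρ n * ⌊log₂ ⌊log₂ n ⌋ ⌋ ≤ C * ⌊log₂ n ⌋

module _ (Γ : TreewidthBoundedClass) (c : ℕ) where
  open Network

  MinimumRootedBroadcastTime : MinProblem
  MinimumRootedBroadcastTime = record
    { Instance  = Σ (Network Γ c) λ N → Node (network N)
    ; encI      = λ (N , r) → encNetwork N ∙ encFin r
    ; nodes     = λ (N , _) → order (network N)
    ; Solution  = λ (N , r) → Scheme (network N) r
    ; encS      = encScheme
    ; value     = Scheme.time
    ; IsOptimum = λ (N , r) → IsOPTᵣ (network N) r
    }

  -- A solution has a scheme for each root; its value is the longest time.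

  MinimumBroadcastTime : MinProblem
  MinimumBroadcastTime = record
    { Instance  = Network Γ c
    ; encI      = encNetwork
    ; nodes     = λ N → order (network N)
    ; Solution  = λ N → ∀ r → Scheme (network N) r
    ; encS      = λ s → encList (λ x → x) (tabulate (λ r → encScheme (s r)))
    ; value     = λ s → foldr _⊔_ 0 (tabulate (λ r → Scheme.time (s r)))
    ; IsOptimum = λ N → IsOPT (network N)
    }

{-# OPTIONS --safe #-}
module Submission where

-- Let T be a guess of OPT, and suppose that the message has to reach a set of
-- tokens.  Choose disjoint trees of shortest paths of length at most 2 T around
-- hubs, each reaching T + 1 tokens, until there are no more in the graph of the
-- remaining nodes.  Among the tokens left over choose a maximal set of leaders
-- more than 2 T apart there; the Voronoi cells of the leaders have at most T
-- tokens.  If T = OPT, then in an optimal scheme the calls leading from the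
-- root to a leader leave the removed nodes at some point and stay within the
-- ball of radius T around the leader from then on.  These balls are disjoint,
-- hence the leaders can be matched to removed nodes nearby, at most T to each;
-- augmenting paths find such a matching.  So the hubs inform the removed nodes,
-- these the leaders, and the leaders their cells, in 15 T rounds, and the hubs,
-- at most #tokens / (T + 1) in number, are the new tokens.  The least T that
-- does not fail is at most OPT and needs O(log n / log T) phases.  As
-- log n ≤ OPT, the total is O(log n / log log n) times the optimum.
--
-- Polynomial time: all loops run over the nodes, the edges or a counter up to
-- n, so the text of the program determines a polynomial bound.

-- The main obstacle is congestion, since the paths of one forest merge near their root.
-- Breadth-first search makes a packet wait one round for each level by which it is closer to the
-- root than the radius, so packets going to one root descend level by level when time is read
-- backwards. A delay of two rounds per rank then keeps packets of one root an even, positive number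
-- of levels apart. A call spans two adjacent levels, hence their calls never touch. Path and delay
-- take at most 4 T + 1 ≤ 5 T rounds, and the 15 T of a phase are three such routings. The guess T
-- is passed around as a node `t` with `T t = toℕ t + 1`: the length of a loop has to come from the
-- input, and T then ranges over 1, ..., n. A scheme has to be produced for every instance, so
-- success at T = n is derived from connectedness. For this the argument about optimal schemes is
-- stated for `Feasible`, which keeps of a broadcast only who calls whom in which round and chains
-- of at most T calls. Correctness is proved for the functions of `Algorithm`; terms with the same
-- values supply the program and its time bound.

open import Defs
open import Data.Bool.Base using (Bool; true; false; if_then_else_)
open import Data.Empty using (⊥-elim)
open import Data.Fin.Base as Fin using (Fin; zero; suc; toℕ; fromℕ<; splitAt; _↑ˡ_; _↑ʳ_)
open import Data.Fin.Properties as Fin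
  using (injective⇒≤; splitAt-↑ˡ; splitAt-↑ʳ; suc-injective; toℕ-fromℕ<; toℕ-injective; toℕ<n; ↑ˡ-injective; ↑ʳ-injective)
open import Data.List.Base as List
  using (List; []; _∷_; concatMap; foldl; foldr; length; map; replicate; tabulate)
open import Data.List.Membership.DecPropositional using (_∈?_)
open import Data.List.Membership.Propositional using (_∈_)
open import Data.List.Membership.Propositional.Properties using (∈-lookup; ∈-tabulate⁺)
open import Data.List.Properties
  using (foldr-map; length-replicate; length-tabulate; map-tabulate; tabulate-cong; ∷-injective)
open import Data.List.Relation.Unary.All as All using (All; []; _∷_)
open import Data.List.Relation.Unary.All.Properties using (¬Any⇒All¬)
open import Data.List.Relation.Unary.AllPairs as AllPairs using (AllPairs; []; _∷_)
open import Data.List.Relation.Unary.AllPairs.Properties using (tabulate⁺-<)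
open import Data.List.Relation.Unary.Any using (here; there)
open import Data.List.Relation.Unary.Linked as Linked using (Linked; []; [-]; _∷_)
open import Data.List.Relation.Unary.Unique.Propositional using (Unique)
open import Data.List.Relation.Unary.Unique.Propositional.Properties using (tabulate⁺)
open import Data.Maybe.Base using (Maybe; just; nothing)
open import Data.Maybe.Properties using (just-injective)
open import Data.Nat.Base
open import Data.Nat.DivMod using (_/_; m*n/n≡m; m/n*n≤m; /-monoˡ-≤)
open import Data.Nat.Logarithm
open import Data.Nat.Properties hiding (suc-injective; ≡-irrelevant)
open import Data.Nat.Tactic.RingSolver using (solve-∀)
open import Data.Product.Base using (Σ; ∃; ∃₂; _×_; _,_; proj₁; proj₂)
open import Data.Sum.Base using (_⊎_; inj₁; inj₂; [_,_])
open import Data.Unit.Base using (⊤; tt)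
open import Data.Vec.Base as Vec using (Vec)
open import Data.Vec.Properties using (lookup∘tabulate)
open import Function.Base using (_∘_; id)
open import Function.Bundles using (module Inverse)
open import Relation.Binary.Construct.Closure.ReflexiveTransitive using (Star; ε; _◅_)
open import Relation.Binary.PropositionalEquality hiding ([_])
open import Relation.Binary.PropositionalEquality.WithK using (≡-irrelevant)
open import Relation.Nullary.Decidable using (yes; no)
open import Relation.Nullary.Negation using (¬_; contradiction)

-- A typed language whose loops are bounded by the input

module Language where

  infixr 6 _⊗_

  data Ty : Set where
    unit node bool nat edgeList : Ty
    maybe list arr : Ty → Ty
    _⊗_ : Ty → Ty → Ty

  Ctx : Set
  Ctx = List Ty

  private variable
    a b d s : Ty
    Γ Δ : Ctx

  -- `View d a b`: values of type d are empty or made of an a and a b.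

  data View : Ty → Ty → Ty → Set where
    natV   : View nat unit nat
    maybeV : View (maybe a) a unit
    listV  : View (list a) a (list a)

  -- The types one can loop over.  A node is a bound: a loop over the node i
  -- runs toℕ i + 1 times.  Thus no loop is longer than the input, whatever
  -- the values involved.

  data Seq : Ty → Ty → Set where
    arrS  : Seq (arr a) a
    nodeS : Seq node unit
    edgeS : Seq edgeList (node ⊗ node)

  mutual
    data Tm (Γ : Ctx) : Ty → Set where
      get   : (i : Fin (length Γ)) → Tm Γ (List.lookup Γ i)
      bind  : Tm Γ a → Tm (a ∷ Γ) b → Tm Γ b
      -- A macro: `app` compiles its term anew at each use and lets it see the arguments only. There
      -- is no recursion, so all repetition comes from the bounded loops.
      app   : Tm Δ a → Tms Γ Δ → Tm Γ a
      unit  : Tm Γ unit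
      bit   : Bool → Tm Γ bool
      ite   : Tm Γ bool → Tm Γ a → Tm Γ a → Tm Γ a
      null  : View d a b → Tm Γ d
      con   : View d a b → Tm Γ a → Tm Γ b → Tm Γ d
      elim  : View d a b → Tm Γ d → Tm Γ s → Tm (a ∷ b ∷ Γ) s → Tm Γ s
      pair  : Tm Γ a → Tm Γ b → Tm Γ (a ⊗ b)
      fst   : Tm Γ (a ⊗ b) → Tm Γ a
      snd   : Tm Γ (a ⊗ b) → Tm Γ b
      allEdges : Tm Γ edgeList
      fold  : Seq s a → Tm Γ s → Tm Γ b → Tm (a ∷ b ∷ Γ) b → Tm Γ b
      tab   : Tm (node ∷ Γ) a → Tm Γ (arr a)
      at    : Tm Γ (arr a) → Tm Γ node → Tm Γ a

    data Tms (Γ : Ctx) : Ctx → Set where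
      []  : Tms Γ []
      _∷_ : Tm Γ a → Tms Γ Δ → Tms Γ (a ∷ Δ)

  caseL : {A C : Set} → List A → C → (A → List A → C) → C
  caseL []       z c = z
  caseL (x ∷ xs) z c = c x xs

  caseM : {A C : Set} → Maybe A → C → (A → C) → C
  caseM nothing  z c = z
  caseM (just x) z c = c x

  caseN : {C : Set} → ℕ → C → (ℕ → C) → C
  caseN zero    z c = z
  caseN (suc k) z c = c k

  times : {A : Set} → ℕ → (A → A) → A → A
  times k f x = foldl (λ y _ → f y) x (replicate k tt)

  module Semantics (n : ℕ) (E : List (Fin n × Fin n)) where

    ⟪_⟫ : Ty → Set
    ⟪ unit ⟫    = ⊤
    ⟪ node ⟫    = Fin n
    ⟪ bool ⟫    = Bool
    ⟪ nat ⟫     = ℕ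
    -- The input's edge list is the only value: it can be passed on but not built, so a loop over it
    -- has `length E` rounds.
    ⟪ edgeList ⟫ = ⊤
    ⟪ maybe a ⟫ = Maybe ⟪ a ⟫
    ⟪ list a ⟫  = List ⟪ a ⟫
    ⟪ arr a ⟫   = Fin n → ⟪ a ⟫
    ⟪ a ⊗ b ⟫   = ⟪ a ⟫ × ⟪ b ⟫

    Env : Ctx → Set
    Env []      = ⊤
    Env (a ∷ Γ) = ⟪ a ⟫ × Env Γ

    lookupEnv : Env Γ → (i : Fin (length Γ)) → ⟪ List.lookup Γ i ⟫
    lookupEnv {_ ∷ _} (x , ρ) zero    = x
    lookupEnv {_ ∷ _} (x , ρ) (suc i) = lookupEnv ρ i

    empty : View d a b → ⟪ d ⟫
    empty natV   = zero
    empty maybeV = nothing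
    empty listV  = []

    make : View d a b → ⟪ a ⟫ → ⟪ b ⟫ → ⟪ d ⟫
    make natV   _ k  = suc k
    make maybeV x _  = just x
    make listV  x xs = x ∷ xs

    match : {C : Set} → View d a b → ⟪ d ⟫ → C → (⟪ a ⟫ → ⟪ b ⟫ → C) → C
    match natV   x z c = caseN x z (c tt)
    match maybeV x z c = caseM x z (λ y → c y tt)
    match listV  x z c = caseL x z c

    items : Seq s a → ⟪ s ⟫ → List ⟪ a ⟫
    items arrS  f = tabulate f
    items nodeS i = replicate (suc (toℕ i)) tt
    items edgeS _ = E

    mutual
      eval : Tm Γ a → Env Γ → ⟪ a ⟫
      eval (get i)        ρ = lookupEnv ρ i
      eval (bind e e′)    ρ = eval e′ (eval e ρ , ρ)
      eval (app f es)     ρ = eval f (evals es ρ)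
      eval unit           ρ = tt
      eval (bit b)        ρ = b
      eval (ite e y z)    ρ = if eval e ρ then eval y ρ else eval z ρ
      eval (null v)       ρ = empty v
      eval (con v e e′)   ρ = make v (eval e ρ) (eval e′ ρ)
      eval (elim v e z c) ρ =
        match v (eval e ρ) (eval z ρ) (λ x y → eval c (x , y , ρ))
      eval (pair e e′)    ρ = eval e ρ , eval e′ ρ
      eval (fst e)        ρ = proj₁ (eval e ρ)
      eval (snd e)        ρ = proj₂ (eval e ρ)
      eval allEdges       ρ = tt
      eval (fold q e z c) ρ =
        foldl (λ y x → eval c (x , y , ρ)) (eval z ρ) (items q (eval e ρ))
      eval (tab e)        ρ = λ v → eval e (v , ρ)
      eval (at e i)       ρ = eval e ρ (eval i ρ)

      evals : Tms Γ Δ → Env Γ → Env Δ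
      evals []       ρ = tt
      evals (e ∷ es) ρ = eval e ρ , evals es ρ

    enc : ∀ a → ⟪ a ⟫ → Tree
    enc unit      _        = nil
    enc node      i        = encFin i
    enc bool      false    = nil
    enc bool      true     = nil ∙ nil
    enc nat       k        = encℕ k
    enc edgeList  _        = encList encPair E
    enc (maybe a) nothing  = nil
    enc (maybe a) (just x) = enc a x ∙ nil
    enc (list a)  xs       = encList (enc a) xs
    enc (arr a)   f        = encList (enc a) (tabulate f)
    enc (a ⊗ b)   (x , y)  = enc a x ∙ enc b y

    nodes : Tree
    nodes = encList encFin (tabulate {n = n} (λ v → v))

    -- Even the empty context carries the lists of nodes and edges. They sit at the end of every
    -- environment, where `tab` and `allEdges` find them after skipping the variables.
    encEnv : ∀ Γ → Env Γ → Tree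
    encEnv []      _       = nodes ∙ encList encPair E
    encEnv (a ∷ Γ) (x , ρ) = enc a x ∙ encEnv Γ ρ

    items-length : ∀ {N} → n ≤ N → length E ≤ N →
                   (q : Seq s a) (x : ⟪ s ⟫) → length (items q x) ≤ N
    items-length n≤ m≤ arrS  f = ≤-trans (≤-reflexive (length-tabulate f)) n≤
    items-length n≤ m≤ nodeS i =
      ≤-trans (≤-reflexive (length-replicate (suc (toℕ i)))) (≤-trans (toℕ<n i) n≤)
    items-length n≤ m≤ edgeS _ = m≤

  -- Polynomial time bounds

  infixl 6 _⊕_
  infixl 7 _⊛_

  data Poly : Set where
    κ       : ℕ → Poly
    𝐗       : Poly
    _⊕_ _⊛_ : Poly → Poly → Poly

  ⟦_⟧ₚ : Poly → ℕ → ℕ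
  ⟦ κ c ⟧ₚ   N = c
  ⟦ 𝐗 ⟧ₚ     N = N
  ⟦ p ⊕ q ⟧ₚ N = ⟦ p ⟧ₚ N + ⟦ q ⟧ₚ N
  ⟦ p ⊛ q ⟧ₚ N = ⟦ p ⟧ₚ N * ⟦ q ⟧ₚ N

  -- `PolyTimeApproximation` wants the form a N^d. For a sum the exponents are added, which
  -- dominates both summands because N is positive.
  monomial-bound : ∀ p → ∃₂ λ a d → ∀ N → 1 ≤ N → ⟦ p ⟧ₚ N ≤ a * N ^ d
  monomial-bound (κ c) = c , 0 , λ N _ → ≤-reflexive (sym (*-identityʳ c))
  monomial-bound 𝐗 = 1 , 1 , λ N _ →
    ≤-reflexive (sym (trans (*-identityˡ _) (*-identityʳ N)))
  monomial-bound (p ⊕ q) with monomial-bound p | monomial-bound q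
  ... | a , d , bp | a′ , d′ , bq = a + a′ , d + d′ , λ where
    N@(suc _) 1≤N → let open ≤-Reasoning in begin
      ⟦ p ⟧ₚ N + ⟦ q ⟧ₚ N                       ≤⟨ +-mono-≤ (bp N 1≤N) (bq N 1≤N) ⟩
      a * N ^ d + a′ * N ^ d′                   ≤⟨ +-mono-≤
        (*-monoʳ-≤ a (^-monoʳ-≤ N (m≤m+n d d′))) (*-monoʳ-≤ a′ (^-monoʳ-≤ N (m≤n+m d′ d))) ⟩
      a * N ^ (d + d′) + a′ * N ^ (d + d′)      ≡⟨ *-distribʳ-+ (N ^ (d + d′)) a a′ ⟨
      (a + a′) * N ^ (d + d′)                   ∎
  monomial-bound (p ⊛ q) with monomial-bound p | monomial-bound q
  ... | a , d , bp | a′ , d′ , bq = a * a′ , d + d′ , λ N 1≤N →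
    let open ≤-Reasoning in begin
      ⟦ p ⟧ₚ N * ⟦ q ⟧ₚ N             ≤⟨ *-mono-≤ (bp N 1≤N) (bq N 1≤N) ⟩
      a * N ^ d * (a′ * N ^ d′)       ≡⟨ [m*n]*[o*p]≡[m*o]*[n*p] a (N ^ d) a′ (N ^ d′) ⟩
      a * a′ * (N ^ d * N ^ d′)       ≡⟨ cong (a * a′ *_) (^-distribˡ-+-* N d d′) ⟨
      a * a′ * N ^ (d + d′)           ∎

  mutual
    -- The number of recursive functions that the compiled term needs: one for each `fold`, `tab`
    -- and `at`.
    size : Tm Γ a → ℕ
    size (get i)        = 0
    size (bind e e′)    = size e + size e′
    size (app f es)     = size f + sizes es
    size unit           = 0
    size (bit b)        = 0
    size (ite e y z)    = size e + (size y + size z)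
    size (null v)       = 0
    size (con v e e′)   = size e + size e′
    size (elim v e z c) = size e + (size z + size c)
    size (pair e e′)    = size e + size e′
    size (fst e)        = size e
    size (snd e)        = size e
    size allEdges       = 0
    size (fold q e z c) = suc (size e + (size z + size c))
    size (tab e)        = suc (size e)
    size (at e i)       = suc (size e + size i)

    sizes : Tms Γ Δ → ℕ
    sizes []       = 0
    sizes (e ∷ es) = size e + sizes es

  -- Compilation of terms

  join : ∀ {A : Set} k {l} → (Fin k → A) → (Fin l → A) → Fin (k + l) → A
  join k f g = [ f , g ] ∘ splitAt k

  consF : ∀ {A : Set} {k} → A → (Fin k → A) → Fin (suc k) → A
  consF x f zero    = x
  consF x f (suc i) = f i

  module Compilation {F : ℕ} where

    Code : ℕ → Set
    Code m = Exp F (suc m)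

    v₀ : ∀ {m} → Exp F (1 + m)
    v₀ = var zero
    v₁ : ∀ {m} → Exp F (2 + m)
    v₁ = var (suc zero)
    v₂ : ∀ {m} → Exp F (3 + m)
    v₂ = var (suc (suc zero))
    v₃ : ∀ {m} → Exp F (4 + m)
    v₃ = var (suc (suc (suc zero)))

    left right : ∀ {m} → Exp F m → Exp F m
    left  e = case e nil v₀
    right e = case e nil v₁

    drop : ℕ → ∀ {m} → Exp F m → Exp F m
    drop zero    e = e
    drop (suc k) e = drop k (right e)

    seqCode : ∀ {m} → Seq s a → Exp F m → Exp F m
    seqCode arrS  e = e
    -- The unary code of the node i has toℕ i cells, the loop one more round.
    seqCode nodeS e = cons nil e
    seqCode edgeS e = e

    -- The argument is list ∙ accumulator ∙ environment. Its right subtree with the current element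
    -- in front is exactly the environment that the body `c` expects.
    foldBody : Fin F → Code 3 → Exp F 1
    foldBody g c = case (left v₀) (left (right v₀))
      (let′ (cons v₀ (right v₂))
        (call g (cons v₂ (cons c (right (right v₃))))))

    tabBody : Fin F → Code 3 → Exp F 1
    tabBody g c = case (left v₀) nil
      (let′ (cons v₀ (right v₂)) (cons c (call g (cons v₂ (right v₃)))))

    atBody : Fin F → Exp F 1
    atBody g = case (left v₀) (left (right v₀))
      (call g (cons v₁ (right (right v₂))))

    nodesBody : Fin F → Exp F 1
    nodesBody g = case (left v₀) (right v₀)
      (call g (cons v₁ (cons v₁ (right v₂))))

    -- Every compiled term finds its environment in variable 0.  A loop of a
    -- term becomes a function; ι places the functions of the term in the
    -- table of the whole program.

    mutual
      compile : (e : Tm Γ a) → (Fin (size e) → Fin F) → ∀ {m} → Code m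
      compile (get i)        ι = left (drop (toℕ i) v₀)
      compile (bind e e′)    ι = let′
        (cons (compile e (ι ∘ (_↑ˡ size e′))) v₀) (compile e′ (ι ∘ (size e ↑ʳ_)))
      compile (app f es)     ι = let′
        (compiles es (ι ∘ (size f ↑ʳ_))) (compile f (ι ∘ (_↑ˡ sizes es)))
      compile unit           ι = nil
      compile (bit b)        ι = if b then cons nil nil else nil
      compile (ite e y z)    ι =
        case (compile e (ι ∘ (_↑ˡ _)))
             (compile z (ι ∘ (size e ↑ʳ_) ∘ (size y ↑ʳ_)))
             -- `case` has bound two variables; this brings the environment back to variable 0.
             (let′ v₂ (compile y (ι ∘ (size e ↑ʳ_) ∘ (_↑ˡ _))))
      compile (null v)       ι = nil
      compile (con v e e′)   ι =
        cons (compile e (ι ∘ (_↑ˡ size e′))) (compile e′ (ι ∘ (size e ↑ʳ_)))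
      compile (elim v e z c) ι =
        case (compile e (ι ∘ (_↑ˡ _)))
             (compile z (ι ∘ (size e ↑ʳ_) ∘ (_↑ˡ _)))
             (let′ (cons v₀ (cons v₁ v₂))
                   (compile c (ι ∘ (size e ↑ʳ_) ∘ (size z ↑ʳ_))))
      compile (pair e e′)    ι =
        cons (compile e (ι ∘ (_↑ˡ size e′))) (compile e′ (ι ∘ (size e ↑ʳ_)))
      compile (fst e)        ι = left (compile e ι)
      compile (snd e)        ι = right (compile e ι)
      compile {Γ} allEdges   ι = right (drop (length Γ) v₀)
      compile (fold q e z c) ι = call (ι zero)
        (cons (seqCode q (compile e (ι ∘ suc ∘ (_↑ˡ _))))
              (cons (compile z (ι ∘ suc ∘ (size e ↑ʳ_) ∘ (_↑ˡ _))) v₀))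
      compile {Γ} (tab e)    ι = call (ι zero) (cons (left (drop (length Γ) v₀)) v₀)
      compile (at e i)       ι = call (ι zero)
        (cons (compile i (ι ∘ suc ∘ (size e ↑ʳ_))) (compile e (ι ∘ suc ∘ (_↑ˡ _))))

      compiles : (es : Tms Γ Δ) → (Fin (sizes es) → Fin F) → ∀ {m} → Code m
      compiles {Γ} [] ι = drop (length Γ) v₀
      compiles (e ∷ es) ι =
        cons (compile e (ι ∘ (_↑ˡ sizes es))) (compiles es (ι ∘ (size e ↑ʳ_)))

    mutual
      table : (e : Tm Γ a) → (Fin (size e) → Fin F) → Fin (size e) → Exp F 1
      table (get i)        ι = λ ()
      table (bind e e′)    ι = join (size e)
        (table e (ι ∘ (_↑ˡ size e′))) (table e′ (ι ∘ (size e ↑ʳ_)))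
      table (app f es)     ι = join (size f)
        (table f (ι ∘ (_↑ˡ sizes es))) (tables es (ι ∘ (size f ↑ʳ_)))
      table unit           ι = λ ()
      table (bit b)        ι = λ ()
      table (ite e y z)    ι = join (size e)
        (table e (ι ∘ (_↑ˡ _)))
        (join (size y) (table y (ι ∘ (size e ↑ʳ_) ∘ (_↑ˡ _)))
                       (table z (ι ∘ (size e ↑ʳ_) ∘ (size y ↑ʳ_))))
      table (null v)       ι = λ ()
      table (con v e e′)   ι = join (size e)
        (table e (ι ∘ (_↑ˡ size e′))) (table e′ (ι ∘ (size e ↑ʳ_)))
      table (elim v e z c) ι = join (size e)
        (table e (ι ∘ (_↑ˡ _)))
        (join (size z) (table z (ι ∘ (size e ↑ʳ_) ∘ (_↑ˡ _)))
                       (table c (ι ∘ (size e ↑ʳ_) ∘ (size z ↑ʳ_))))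
      table (pair e e′)    ι = join (size e)
        (table e (ι ∘ (_↑ˡ size e′))) (table e′ (ι ∘ (size e ↑ʳ_)))
      table (fst e)        ι = table e ι
      table (snd e)        ι = table e ι
      table allEdges       ι = λ ()
      table (fold q e z c) ι = consF
        (foldBody (ι zero) (compile c (ι ∘ suc ∘ (size e ↑ʳ_) ∘ (size z ↑ʳ_))))
        (join (size e) (table e (ι ∘ suc ∘ (_↑ˡ _)))
          (join (size z) (table z (ι ∘ suc ∘ (size e ↑ʳ_) ∘ (_↑ˡ _)))
                         (table c (ι ∘ suc ∘ (size e ↑ʳ_) ∘ (size z ↑ʳ_)))))
      table (tab e)        ι = consF
        (tabBody (ι zero) (compile e (ι ∘ suc))) (table e (ι ∘ suc))
      table (at e i)       ι = consF (atBody (ι zero))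
        (join (size e) (table e (ι ∘ suc ∘ (_↑ˡ _))) (table i (ι ∘ suc ∘ (size e ↑ʳ_))))

      tables : (es : Tms Γ Δ) → (Fin (sizes es) → Fin F) → Fin (sizes es) → Exp F 1
      tables []       ι = λ ()
      tables (e ∷ es) ι = join (size e)
        (table e (ι ∘ (_↑ˡ sizes es))) (tables es (ι ∘ (size e ↑ʳ_)))

  mutual
    cost : Tm Γ a → Poly
    cost (get i)        = κ (3 + toℕ i * 2)
    cost (bind e e′)    = cost e ⊕ cost e′ ⊕ κ 3
    cost (app f es)     = costs es ⊕ cost f ⊕ κ 1
    cost unit           = κ 1
    cost (bit b)        = κ 3
    cost (ite e y z)    = cost e ⊕ cost y ⊕ cost z ⊕ κ 3
    cost (null v)       = κ 1
    cost (con v e e′)   = cost e ⊕ cost e′ ⊕ κ 1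
    cost (elim v e z c) = cost e ⊕ cost z ⊕ cost c ⊕ κ 7
    cost (pair e e′)    = cost e ⊕ cost e′ ⊕ κ 1
    cost (fst e)        = cost e ⊕ κ 2
    cost (snd e)        = cost e ⊕ κ 2
    cost {Γ} allEdges   = κ (3 + length Γ * 2)
    cost (fold q e z c) = cost e ⊕ cost z ⊕ κ 15 ⊕ 𝐗 ⊛ (cost c ⊕ κ 19)
    cost {Γ} (tab e)    = κ (11 + length Γ * 2) ⊕ 𝐗 ⊛ (cost e ⊕ κ 17)
    cost (at e i)       = cost i ⊕ cost e ⊕ κ 11 ⊕ 𝐗 ⊛ κ 12

    costs : Tms Γ Δ → Poly
    costs {Γ} []   = κ (1 + length Γ * 2)
    costs (e ∷ es) = cost e ⊕ costs es ⊕ κ 1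

  -- What `nodesBody` computes: counting down while putting numbers in front leaves the list in
  -- increasing order.
  prepend : ℕ → Tree → Tree
  prepend zero    t = t
  prepend (suc k) t = prepend k (encℕ k ∙ t)

  prepend-nodes : ∀ n → prepend n nil ≡ encList encFin (tabulate {n = n} (λ v → v))
  prepend-nodes n = begin
    prepend n nil                                                ≡⟨ prepend-range n 0 ⟩
    range 0 (n + 0)                                              ≡⟨ cong (range 0) (+-identityʳ n) ⟩
    range 0 n                                                    ≡⟨ cong (encList encℕ) (map-tabulate {n = n} (λ v → v) toℕ) ⟨
    encList encℕ (List.map toℕ (tabulate {n = n} (λ v → v)))     ≡⟨ foldr-map (λ x t → encℕ x ∙ t) toℕ nil (tabulate {n = n} (λ v → v)) ⟩
    encList encFin (tabulate {n = n} (λ v → v))                  ∎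
    where
    open ≡-Reasoning
    range : ℕ → ℕ → Tree
    range s j = encList encℕ (tabulate {n = j} (λ v → s + toℕ v))
    range-suc : ∀ s j → range s (suc j) ≡ encℕ s ∙ range (suc s) j
    range-suc s j = cong₂ (λ x xs → encℕ x ∙ encList encℕ xs) (+-identityʳ s)
      (tabulate-cong {n = j} (λ v → +-suc s (toℕ v)))
    prepend-range : ∀ k j → prepend k (range k j) ≡ range 0 (k + j)
    prepend-range zero    j = refl
    prepend-range (suc k) j = trans (cong (prepend k) (sym (range-suc k j)))
      (trans (prepend-range k (suc j)) (cong (range 0) (+-suc k j)))

  -- Soundness and running time of compiled terms

  module Correctness (P : Program) (n : ℕ) (E : List (Fin n × Fin n))
                     (N : ℕ) (n≤N : n ≤ N) (E≤N : length E ≤ N) where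
    open Program P using (body) renaming (#functions to F)
    open Semantics n E
    open Compilation {F}

    infix 4 _⊢_⇓_≲_

    _⊢_⇓_≲_ : ∀ {m} → Vec Tree m → Exp F m → Tree → ℕ → Set
    σ ⊢ e ⇓ y ≲ b = ∃ λ t → Eval P σ e y t × t ≤ b

    private variable
      m i j k : ℕ
      σ : Vec Tree m
      x y z : Tree
      e e′ e″ : Exp F m

    ⇓weaken : j ≤ k → σ ⊢ e ⇓ x ≲ j → σ ⊢ e ⇓ x ≲ k
    ⇓weaken j≤k (t , ev , t≤) = t , ev , ≤-trans t≤ j≤k

    ⇓exact : j ≡ k → σ ⊢ e ⇓ x ≲ j → σ ⊢ e ⇓ x ≲ k
    ⇓exact eq = ⇓weaken (≤-reflexive eq)

    ⇓var : ∀ i → σ ⊢ var i ⇓ Vec.lookup σ i ≲ 1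
    ⇓var i = 1 , var i , ≤-refl

    ⇓nil : σ ⊢ nil ⇓ nil ≲ 1
    ⇓nil = 1 , nil , ≤-refl

    ⇓cons : σ ⊢ e ⇓ x ≲ j → σ ⊢ e′ ⇓ y ≲ k → σ ⊢ cons e e′ ⇓ x ∙ y ≲ suc (j + k)
    ⇓cons (_ , p , p≤) (_ , q , q≤) = _ , cons p q , s≤s (+-mono-≤ p≤ q≤)

    ⇓case-nil : σ ⊢ e ⇓ nil ≲ j → σ ⊢ e′ ⇓ y ≲ k → σ ⊢ case e e′ e″ ⇓ y ≲ suc (j + k)
    ⇓case-nil (_ , p , p≤) (_ , q , q≤) = _ , case-nil p q , s≤s (+-mono-≤ p≤ q≤)

    ⇓case-cons : σ ⊢ e ⇓ x ∙ y ≲ j → (x Vec.∷ y Vec.∷ σ) ⊢ e″ ⇓ z ≲ k →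
                 σ ⊢ case e e′ e″ ⇓ z ≲ suc (j + k)
    ⇓case-cons (_ , p , p≤) (_ , q , q≤) = _ , case-cons p q , s≤s (+-mono-≤ p≤ q≤)

    ⇓let : σ ⊢ e ⇓ x ≲ j → (x Vec.∷ σ) ⊢ e′ ⇓ y ≲ k → σ ⊢ let′ e e′ ⇓ y ≲ suc (j + k)
    ⇓let (_ , p , p≤) (_ , q , q≤) = _ , let′ p q , s≤s (+-mono-≤ p≤ q≤)

    ⇓call : ∀ {g c} → Vec.lookup body g ≡ c → σ ⊢ e ⇓ x ≲ j →
            (x Vec.∷ Vec.[]) ⊢ c ⇓ y ≲ k → σ ⊢ call g e ⇓ y ≲ suc (j + k)
    ⇓call refl (_ , p , p≤) (_ , q , q≤) = _ , call p q , s≤s (+-mono-≤ p≤ q≤)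

    ⇓left : σ ⊢ e ⇓ x ∙ y ≲ j → σ ⊢ left e ⇓ x ≲ 2 + j
    ⇓left {j = j} p = ⇓exact (cong suc (+-comm j 1)) (⇓case-cons p (⇓var zero))

    ⇓right : σ ⊢ e ⇓ x ∙ y ≲ j → σ ⊢ right e ⇓ y ≲ 2 + j
    ⇓right {j = j} p = ⇓exact (cong suc (+-comm j 1)) (⇓case-cons p (⇓var (suc zero)))

    ⇓drop : ∀ Γ ρ → σ ⊢ e ⇓ encEnv Γ ρ ≲ j →
            σ ⊢ drop (length Γ) e ⇓ encEnv [] tt ≲ j + length Γ * 2
    ⇓drop []      ρ       p = ⇓exact (sym (+-identityʳ _)) p
    ⇓drop {j = j} (a ∷ Γ) (_ , ρ) p =
      ⇓exact (trans (sym (+-suc (suc j) _)) (sym (+-suc j _))) (⇓drop Γ ρ (⇓right p))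

    ⇓get : ∀ Γ ρ (i : Fin (length Γ)) → σ ⊢ e ⇓ encEnv Γ ρ ≲ j →
           σ ⊢ left (drop (toℕ i) e) ⇓ enc (List.lookup Γ i) (lookupEnv ρ i)
             ≲ 2 + j + toℕ i * 2
    ⇓get {j = j} (a ∷ Γ) (x , ρ) zero    p = ⇓exact (sym (+-identityʳ (2 + j))) (⇓left p)
    ⇓get {j = j} (a ∷ Γ) (x , ρ) (suc i) p =
      ⇓exact (trans (sym (+-suc (3 + j) _)) (sym (+-suc (2 + j) _))) (⇓get Γ ρ i (⇓right p))

    ⇓seq : ∀ (q : Seq s a) x → σ ⊢ e ⇓ enc s x ≲ j →
           σ ⊢ seqCode q e ⇓ encList (enc a) (items q x) ≲ 2 + j
    ⇓seq arrS  f p = ⇓weaken (m≤n+m _ 2) p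
    ⇓seq edgeS _ p = ⇓weaken (m≤n+m _ 2) p
    ⇓seq nodeS i p = subst (λ y → _ ⊢ _ ⇓ nil ∙ y ≲ _) (unary (toℕ i)) (⇓cons ⇓nil p)
      where
      unary : ∀ k → encℕ k ≡ encList (λ (_ : ⊤) → nil) (replicate k tt)
      unary zero    = refl
      unary (suc k) = cong (nil ∙_) (unary k)

    -- Both branches are charged, so that the bound does not depend on the value `w` and can be read
    -- off the term.
    ⇓match : ∀ (v : View d a b) w {C : Set} {z : C} {c : ⟪ a ⟫ → ⟪ b ⟫ → C} {f : C → Tree} →
             σ ⊢ e ⇓ enc d w ≲ i → σ ⊢ e′ ⇓ f z ≲ j →
             (∀ x y → (enc a x Vec.∷ enc b y Vec.∷ σ) ⊢ e″ ⇓ f (c x y) ≲ k) →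
             σ ⊢ case e e′ e″ ⇓ f (match v w z c) ≲ suc (i + (j + k))
    ⇓match {j = j} {k = k} natV   zero     p q r = ⇓weaken (s≤s (+-monoʳ-≤ _ (m≤m+n j k))) (⇓case-nil p q)
    ⇓match {j = j} {k = k} maybeV nothing  p q r = ⇓weaken (s≤s (+-monoʳ-≤ _ (m≤m+n j k))) (⇓case-nil p q)
    ⇓match {j = j} {k = k} listV  []       p q r = ⇓weaken (s≤s (+-monoʳ-≤ _ (m≤m+n j k))) (⇓case-nil p q)
    ⇓match {j = j} {k = k} natV   (suc l)  p q r = ⇓weaken (s≤s (+-monoʳ-≤ _ (m≤n+m k j))) (⇓case-cons p (r tt l))
    ⇓match {j = j} {k = k} maybeV (just x) p q r = ⇓weaken (s≤s (+-monoʳ-≤ _ (m≤n+m k j))) (⇓case-cons p (r x tt))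
    ⇓match {j = j} {k = k} listV  (x ∷ xs) p q r = ⇓weaken (s≤s (+-monoʳ-≤ _ (m≤n+m k j))) (⇓case-cons p (r x xs))

    ⇓ite : ∀ w {C : Set} {z c : C} {f : C → Tree} →
           σ ⊢ e ⇓ enc bool w ≲ i → σ ⊢ e′ ⇓ f z ≲ j →
           (nil Vec.∷ nil Vec.∷ σ) ⊢ e″ ⇓ f c ≲ k →
           σ ⊢ case e e′ e″ ⇓ f (if w then c else z) ≲ suc (i + (j + k))
    ⇓ite {j = j} {k = k} false p q r = ⇓weaken (s≤s (+-monoʳ-≤ _ (m≤m+n j k))) (⇓case-nil p q)
    ⇓ite {j = j} {k = k} true  p q r = ⇓weaken (s≤s (+-monoʳ-≤ _ (m≤n+m k j))) (⇓case-cons p r)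

    ⇓make : ∀ (v : View d a b) x y → enc d (make v x y) ≡ enc a x ∙ enc b y
    ⇓make natV   _ _ = refl
    ⇓make maybeV _ _ = refl
    ⇓make listV  _ _ = refl

    enc-empty : ∀ (v : View d a b) → enc d (empty v) ≡ nil
    enc-empty natV   = refl
    enc-empty maybeV = refl
    enc-empty listV  = refl

    -- The bound `k` for one round holds whatever the size of the accumulator: trees are passed on
    -- in constant time and inner loops are bounded by the input. Hence the time is linear in the
    -- number of rounds.
    foldLoop : ∀ {g c} (f : ⟪ b ⟫ → ⟪ a ⟫ → ⟪ b ⟫) (u : Tree) →
      Vec.lookup body g ≡ foldBody g c →
      (∀ {σ : Vec Tree 3} y x → (enc a x ∙ enc b y ∙ u) Vec.∷ σ ⊢ c ⇓ enc b (f y x) ≲ k) →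
      ∀ xs y → (encList (enc a) xs ∙ enc b y ∙ u) Vec.∷ Vec.[] ⊢ foldBody g c
               ⇓ enc b (foldl f y xs) ≲ 9 + length xs * (k + 19)
    foldLoop f u H C []       y =
      ⇓case-nil (⇓left (⇓var zero)) (⇓left (⇓right (⇓var zero)))
    foldLoop {k = k} f u H C (x ∷ xs) y = ⇓exact (eq k (length xs * (k + 19)))
      (⇓case-cons (⇓left (⇓var zero))
        (⇓let (⇓cons (⇓var zero) (⇓right (⇓var (suc (suc zero)))))
          (⇓call H (⇓cons (⇓var (suc (suc zero))) (⇓cons (C y x)
                     (⇓right (⇓right (⇓var (suc (suc (suc zero))))))))
            (foldLoop f u H C xs (f y x)))))
      where
      eq : ∀ k l → suc (3 + suc (5 + suc (suc (1 + suc (k + 5)) + (9 + l)))) ≡ 9 + (k + 19 + l)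
      eq = solve-∀

    tabLoop : ∀ {A : Set} {g c} (f : A → Tree) (h : A → Tree) (u : Tree) →
      Vec.lookup body g ≡ tabBody g c →
      (∀ {σ : Vec Tree 3} x → (h x ∙ u) Vec.∷ σ ⊢ c ⇓ f x ≲ k) →
      ∀ xs → (encList h xs ∙ u) Vec.∷ Vec.[] ⊢ tabBody g c
             ⇓ encList f xs ≲ 5 + length xs * (k + 17)
    tabLoop f h u H C []       = ⇓case-nil (⇓left (⇓var zero)) ⇓nil
    tabLoop {k = k} f h u H C (x ∷ xs) = ⇓exact (eq k (length xs * (k + 17)))
      (⇓case-cons (⇓left (⇓var zero))
        (⇓let (⇓cons (⇓var zero) (⇓right (⇓var (suc (suc zero)))))
          (⇓cons (C x)
            (⇓call H (⇓cons (⇓var (suc (suc zero))) (⇓right (⇓var (suc (suc (suc zero))))))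
              (tabLoop f h u H C xs)))))
      where
      eq : ∀ k l → suc (3 + suc (5 + suc (k + suc (5 + (5 + l))))) ≡ 5 + (k + 17 + l)
      eq = solve-∀

    atLoop : ∀ {A : Set} {g} (h : A → Tree) → Vec.lookup body g ≡ atBody g →
      ∀ {n} (f : Fin n → A) i → (encFin i ∙ encList h (tabulate f)) Vec.∷ Vec.[]
        ⊢ atBody g ⇓ h (f i) ≲ 9 + toℕ i * 12
    atLoop h H f zero    = ⇓case-nil (⇓left (⇓var zero)) (⇓left (⇓right (⇓var zero)))
    atLoop h H f (suc i) = ⇓exact (eq (toℕ i * 12))
      (⇓case-cons (⇓left (⇓var zero))
        (⇓call H (⇓cons (⇓var (suc zero)) (⇓right (⇓right (⇓var (suc (suc zero))))))
          (atLoop h H (f ∘ suc) i)))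
      where
      eq : ∀ l → suc (3 + suc (suc (1 + 5) + (9 + l))) ≡ 9 + (12 + l)
      eq = solve-∀

    encList-tabulate : ∀ {k} {A : Set} (h : A → Tree) (f : Fin k → A) →
                       encList (h ∘ f) (tabulate (λ v → v)) ≡ encList h (tabulate f)
    encList-tabulate h f = 
      trans (sym (foldr-map (λ x t → h x ∙ t) f nil (tabulate (λ v → v)))) (cong (encList h) (map-tabulate (λ v → v) f))

    Placed : ∀ {k} → (Fin k → Fin F) → (Fin k → Exp F 1) → Set
    Placed ι T = ∀ i → Vec.lookup body (ι i) ≡ T i

    placedˡ : ∀ k {l} {ι : Fin (k + l) → Fin F} {T U} →
              Placed ι (join k T U) → Placed (ι ∘ (_↑ˡ l)) T
    placedˡ k {l} {T = T} {U} H i = trans (H (i ↑ˡ l)) (cong [ T , U ] (splitAt-↑ˡ k i l))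

    placedʳ : ∀ k {l} {ι : Fin (k + l) → Fin F} {T U} →
              Placed ι (join k T U) → Placed (ι ∘ (k ↑ʳ_)) U
    placedʳ k {l} {T = T} {U} H i = trans (H (k ↑ʳ i)) (cong [ T , U ] (splitAt-↑ʳ k l i))

    mutual
      sound : (e : Tm Γ a) {ι : Fin (size e) → Fin F} → Placed ι (table e ι) →
              ∀ ρ → encEnv Γ ρ Vec.∷ σ ⊢ compile e ι ⇓ enc a (eval e ρ) ≲ ⟦ cost e ⟧ₚ N
      sound (get i) H ρ = ⇓get _ ρ i (⇓var zero)
      sound (bind e e′) H ρ = ⇓exact (eq (⟦ cost e ⟧ₚ N) (⟦ cost e′ ⟧ₚ N))
        (⇓let (⇓cons (sound e (placedˡ (size e) H) ρ) (⇓var zero))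
              (sound e′ (placedʳ (size e) H) (eval e ρ , ρ)))
        where
        eq : ∀ k l → suc (suc (k + 1) + l) ≡ k + l + 3
        eq = solve-∀
      sound (app f es) H ρ = ⇓exact (+-comm 1 _)
        (⇓let (sounds es (placedʳ (size f) H) ρ) (sound f (placedˡ (size f) H) (evals es ρ)))
      sound unit H ρ = ⇓nil
      sound (bit false) H ρ = ⇓weaken (m≤n+m 1 2) ⇓nil
      sound (bit true) H ρ = ⇓cons ⇓nil ⇓nil
      sound {a = a} (ite e y z) H ρ =
        ⇓exact (eq (⟦ cost e ⟧ₚ N) (⟦ cost y ⟧ₚ N) (⟦ cost z ⟧ₚ N))
          (⇓ite (eval e ρ) {f = enc a}
            (sound e (placedˡ (size e) H) ρ)
            (sound z (placedʳ (size y) (placedʳ (size e) H)) ρ)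
            (⇓let (⇓var (suc (suc zero))) (sound y (placedˡ (size y) (placedʳ (size e) H)) ρ)))
        where
        eq : ∀ k l m → suc (k + (m + suc (1 + l))) ≡ k + l + m + 3
        eq = solve-∀
      sound (null v) H ρ = subst (λ y → _ ⊢ _ ⇓ y ≲ _) (sym (enc-empty v)) ⇓nil
      sound (con v e e′) H ρ = subst (λ y → _ ⊢ _ ⇓ y ≲ _)
        (sym (⇓make v (eval e ρ) (eval e′ ρ)))
        (⇓exact (+-comm 1 _)
          (⇓cons (sound e (placedˡ (size e) H) ρ) (sound e′ (placedʳ (size e) H) ρ)))
      sound {a = a} (elim v e z c) H ρ =
        ⇓exact (eq (⟦ cost e ⟧ₚ N) (⟦ cost z ⟧ₚ N) (⟦ cost c ⟧ₚ N))
          (⇓match v (eval e ρ) {f = enc a}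
            (sound e (placedˡ (size e) H) ρ)
            (sound z (placedˡ (size z) (placedʳ (size e) H)) ρ)
            (λ x y → ⇓let (⇓cons (⇓var zero) (⇓cons (⇓var (suc zero)) (⇓var (suc (suc zero)))))
              (sound c (placedʳ (size z) (placedʳ (size e) H)) (x , y , ρ))))
        where
        eq : ∀ k l m → suc (k + (l + suc (5 + m))) ≡ k + l + m + 7
        eq = solve-∀
      sound (pair e e′) H ρ = ⇓exact (+-comm 1 _)
        (⇓cons (sound e (placedˡ (size e) H) ρ) (sound e′ (placedʳ (size e) H) ρ))
      sound (fst e) H ρ = ⇓exact (+-comm 2 _) (⇓left (sound e H ρ))
      sound (snd e) H ρ = ⇓exact (+-comm 2 _) (⇓right (sound e H ρ))
      sound allEdges H ρ = ⇓right (⇓drop _ ρ (⇓var zero))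
      sound {Γ} {a = b} (fold {s} {a} q e z c) {ι} H ρ = ⇓weaken bound
        (⇓call (H zero)
          (⇓cons (⇓seq q (eval e ρ) (sound e (placedˡ (size e) (H ∘ suc)) ρ))
                 (⇓cons (sound z (placedˡ (size z) (placedʳ (size e) (H ∘ suc))) ρ) (⇓var zero)))
          (foldLoop {b = b} {a = a} (λ y x → eval c (x , y , ρ)) (encEnv Γ ρ) (H zero)
            (λ y x → sound c (placedʳ (size z) (placedʳ (size e) (H ∘ suc))) (x , y , ρ))
            (items q (eval e ρ)) (eval z ρ)))
        where
        eq : ∀ k l m → suc (suc (2 + k + suc (l + 1)) + (9 + m)) ≡ k + l + 15 + m
        eq = solve-∀
        bound = ≤-trans (≤-reflexive (eq (⟦ cost e ⟧ₚ N) (⟦ cost z ⟧ₚ N) _))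
          (+-monoʳ-≤ (⟦ cost e ⟧ₚ N + ⟦ cost z ⟧ₚ N + 15)
            (*-monoˡ-≤ (⟦ cost c ⟧ₚ N + 19) (items-length n≤N E≤N q (eval e ρ))))
      sound {Γ} (tab {a} e) {ι} H ρ = ⇓weaken bound
        (subst (λ y → _ ⊢ _ ⇓ y ≲ _) (encList-tabulate (enc a) (λ v → eval e (v , ρ)))
        (⇓call (H zero)
          (⇓cons (⇓left (⇓drop Γ ρ (⇓var zero))) (⇓var zero))
          (tabLoop (λ v → enc a (eval e (v , ρ))) encFin (encEnv Γ ρ) (H zero)
            (λ v → sound e (H ∘ suc) (v , ρ)) (tabulate (λ v → v)))))
        where
        eq : ∀ k l → suc (suc (2 + (1 + k) + 1) + (5 + l)) ≡ 11 + k + l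
        eq = solve-∀
        bound = ≤-trans (≤-reflexive (eq (length Γ * 2) _))
          (+-monoʳ-≤ (11 + length Γ * 2)
            (*-monoˡ-≤ (⟦ cost e ⟧ₚ N + 17)
              (≤-trans (≤-reflexive (length-tabulate {n = n} (λ v → v))) n≤N)))
      sound (at {a} e i) H ρ = ⇓weaken bound
        (⇓call (H zero)
          (⇓cons (sound i (placedʳ (size e) (H ∘ suc)) ρ) (sound e (placedˡ (size e) (H ∘ suc)) ρ))
          (atLoop (enc a) (H zero) (eval e ρ) (eval i ρ)))
        where
        eq : ∀ k l m → suc (suc (k + l) + (9 + m)) ≡ k + l + 11 + m
        eq = solve-∀
        bound = ≤-trans (≤-reflexive (eq (⟦ cost i ⟧ₚ N) (⟦ cost e ⟧ₚ N) _))
          (+-monoʳ-≤ (⟦ cost i ⟧ₚ N + ⟦ cost e ⟧ₚ N + 11)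
            (*-monoˡ-≤ 12 (≤-trans (<⇒≤ (toℕ<n (eval i ρ))) n≤N)))

      sounds : (es : Tms Γ Δ) {ι : Fin (sizes es) → Fin F} → Placed ι (tables es ι) →
               ∀ ρ → encEnv Γ ρ Vec.∷ σ ⊢ compiles es ι ⇓ encEnv Δ (evals es ρ) ≲ ⟦ costs es ⟧ₚ N
      sounds {Γ} [] H ρ = ⇓drop Γ ρ (⇓var zero)
      sounds (e ∷ es) H ρ = ⇓exact (+-comm 1 _)
        (⇓cons (sound e (placedˡ (size e) H) ρ) (sounds es (placedʳ (size e) H) ρ))

    nodesLoop : ∀ {g} → Vec.lookup body g ≡ nodesBody g →
      ∀ k t → (encℕ k ∙ t) Vec.∷ Vec.[] ⊢ nodesBody g ⇓ prepend k t ≲ 9 + k * 12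
    nodesLoop H zero    t = ⇓weaken (n≤1+n _) (⇓weaken (n≤1+n _) (⇓case-nil (⇓left (⇓var zero)) (⇓right (⇓var zero))))
    nodesLoop H (suc k) t = ⇓weaken (≤-reflexive (eq (k * 12)))
      (⇓case-cons (⇓left (⇓var zero))
        (⇓call H (⇓cons (⇓var (suc zero)) (⇓cons (⇓var (suc zero)) (⇓right (⇓var (suc (suc zero))))))
          (nodesLoop H k (encℕ k ∙ t))))
      where
      eq : ∀ l → suc (3 + suc (suc (1 + suc (1 + 3)) + (9 + l))) ≡ 9 + (12 + l)
      eq = solve-∀

  -- `setup` turns the input into an environment; function 0 lists the nodes.

  program : (e : Tm Γ a) → Exp (suc (size e)) 1 → Program
  program e setup = record
    { #functions = suc (size e)
    ; body       = Vec.tabulate (consF (nodesBody zero) (table e suc))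
    ; main       = let′ setup (compile e suc)
    }
    where open Compilation

  program-computes : (e : Tm Γ a) (setup : Exp (suc (size e)) 1) →
    let module C = Correctness (program e setup) in
    ∀ n E N (n≤N : n ≤ N) (E≤N : length E ≤ N) → let open Semantics n E in
    ∀ ρ x k → (let open C n E N n≤N E≤N in x Vec.∷ Vec.[] ⊢ setup ⇓ encEnv Γ ρ ≲ k) →
    ∃ λ t → Computes (program e setup) x (enc a (eval e ρ)) t × t ≤ suc (k + ⟦ cost e ⟧ₚ N)
  program-computes e setup n E N n≤N E≤N ρ x k s =
    ⇓let s (sound e (λ i → lookup∘tabulate (consF (nodesBody zero) (table e suc)) (suc i)) ρ)
    where
    open Correctness (program e setup) n E N n≤N E≤N
    open Compilation

open Language

-- The algorithm

infixr 6 _&&_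
infixr 5 _||_

_&&_ _||_ : Bool → Bool → Bool
a && b = if a then b else false
a || b = if a then true else b

neg : Bool → Bool
neg a = if a then false else true

repeat : {A : Set} → ℕ → (A → A) → A → A
repeat zero    f x = x
repeat (suc k) f x = f (repeat k f x)

-- Counts `o` up while `j` or `k` is still positive and both are counted down; iterated, `o` grows
-- by their maximum.
peel : ℕ × ℕ × ℕ → ℕ × ℕ × ℕ
peel (o , j , k) =
  caseN j (caseN k o (λ _ → suc o)) (λ _ → suc o) , caseN j zero (λ i → i) , caseN k zero (λ i → i)

module Algorithm (n : ℕ) where

  V Subset Packet Forest Output State : Set
  V      = Fin n
  Subset = V → Bool
  -- Source of a path, rounds to wait, and the path from its far end to the
  -- source; the path is empty if there is no packet.
  Packet = V × ℕ × List V
  Forest = V → Packet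
  Output = ℕ × List (List (V × V))
  State  = Bool × Subset × Output

  Matrix : Set
  Matrix = V → V → Bool

  foldV : {B : Set} → (B → V → B) → B → B
  foldV f z = foldl f z (tabulate (λ v → v))

  T : V → ℕ
  T t = suc (toℕ t)

  pred′ : ℕ → ℕ
  pred′ k = caseN k zero (λ j → j)

  opaque
    -- The only test on numbers is that for zero, so T is subtracted first. A number is compared
    -- with a node, not with a number, because a node can bound the loop.
    exceeds : ℕ → V → Bool
    exceeds k t = caseN (times (T t) pred′ k) false (λ _ → true)

    lt eq : V → V → Bool
    lt v u = exceeds (times (T u) suc zero) v
    eq v u = neg (lt v u) && neg (lt u v)

    find : Subset → Maybe V
    find P = foldV (λ r v → caseM r (if P v then just v else nothing) just) nothing

    exists : Subset → Bool
    exists P = caseM (find P) false (λ _ → true)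

    count : Subset → ℕ
    count P = foldV (λ k v → if P v then suc k else k) zero

  rank : Subset → V → ℕ
  rank P t = count (λ u → lt u t && P u)

  root : Packet → V
  root p = proj₁ p
  wait : Packet → ℕ
  wait p = proj₁ (proj₂ p)
  path : Packet → List V
  path p = proj₂ (proj₂ p)

  busy : Packet → Bool
  busy p = caseL (path p) false (λ _ _ → true)

  none : Forest
  none v = v , zero , []

  start : Subset → Forest
  start S v = v , zero , (if S v then v ∷ [] else [])

  -- A node reached at step j gets a path of j + 1 nodes and waits one more round at each further
  -- step. So `wait` plus the length of the path is the same for all reached nodes, which
  -- synchronises the packets by level.
  grow : Matrix → Subset → Forest → Forest
  grow A ok F v =
    if busy (F v) then root (F v) , suc (wait (F v)) , path (F v) else
    if ok v then
      caseM (find (λ u → A u v && busy (F u))) (F v)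
            (λ u → root (F u) , zero , v ∷ path (F u))
    else F v

  bfs : Matrix → Subset → V → Forest → Forest
  bfs A ok t F = times (T t) (grow A ok) F

  opaque
    bfs₁ bfs₂ : Matrix → Subset → V → Subset → Forest
    bfs₁ A ok t S = bfs A ok t (start S)
    bfs₂ A ok t S = bfs A ok t (bfs A ok t (start S))

    -- `foldV` serves as a counter up to n; simple paths are shorter than that, so everything
    -- reachable is found.
    closure : Matrix → Subset → Forest
    closure A S = foldV (λ F _ → grow A (λ _ → true) F) (start S)

  popEq : V → Bool × List V → Bool × List V
  popEq y s = caseL (proj₂ s) s (λ x xs → proj₁ s || eq x y , xs)

  opaque
    -- Loops cannot run over lists, so the path is popped three times in each of T rounds. That is
    -- enough for paths of at most 2 T + 1 ≤ 3 T nodes.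
    onPath : V → V → List V → Bool
    onPath t y p = proj₁ (times (T t) (λ s → popEq y (popEq y (popEq y s))) (false , p))

  Packing : Set
  Packing = Subset × Forest × Subset

  -- Rank at most T selects the first T + 1 members: as many as a hub must replace, and no more than
  -- the delays allow.
  chosen : V → Subset → Subset
  chosen t sel u = sel u && neg (exceeds (rank sel u) t)

  free : Subset → Subset
  free rem u = neg (rem u)

  opaque
    -- The centre has to be free as well, so the ball around a removed node is empty and such a node
    -- never becomes a hub.
    ball : Matrix → V → Subset → V → Forest
    ball A t rem v = bfs₂ A (free rem) t (λ u → eq u v && free rem u)

  claim : V → Subset → Forest → V → Packing → Packing
  claim t sel F v (rem , S , hubs) =
    if exceeds (count sel) t then
      (λ y → rem y || exists (λ u → chosen t sel u && onPath t y (path (F u)))) ,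
      (λ u → if chosen t sel u then F u else S u) ,
      (λ u → hubs u || eq u v)
    else (rem , S , hubs)

  pack₁ : Matrix → V → Subset → Packing → V → Packing
  pack₁ A t act s v =
    claim t (λ u → act u && busy (ball A t (proj₁ s) v u)) (ball A t (proj₁ s) v) v s

  opaque
    -- One sweep over the nodes suffices: removing nodes only shrinks the balls of those inspected
    -- before.
    pack : Matrix → V → V → Subset → Packing
    pack A r t act =
      foldV (pack₁ A t act) ((λ v → eq v r) , none , (λ _ → false))

  lead₁ : Matrix → V → Subset → Subset → Subset → V → Subset
  lead₁ A t act rem L u =
    if act u && free rem u && neg (busy (bfs₂ A (free rem) t L u))
    then (λ x → L x || eq x u) else L

  opaque
    leaders : Matrix → V → Subset → Subset → Subset
    leaders A t act rem = foldV (lead₁ A t act rem) (λ _ → false)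

  cells : Matrix → V → Subset → Subset → Subset → Forest
  cells A t act rem L u = if act u then bfs₂ A (free rem) t L u else none u

  opaque
    -- Meant for a removed node `w`: a source need not be free, only the nodes after it on a path.
    reach : Matrix → V → Subset → V → Forest
    reach A t rem w = bfs₁ A (free rem) t (λ u → eq u w)

  Assignment : Set
  Assignment = V → Maybe V

  isAt : Maybe V → V → Bool
  isAt m w = caseM m false (λ u → eq u w)

  load : Assignment → V → ℕ
  load g w = count (λ x → isAt (g x) w)

  room : V → Assignment → V → Bool
  room t g w = neg (exceeds (suc (load g w)) t)

  movable : Matrix → Assignment → V → V → Subset
  movable cand g w w′ x = isAt (g x) w && cand x w′

  -- Alternating paths of the matching, seen as walks on the removed nodes: w leads to w′ if a
  -- leader assigned to w could be moved to w′.
  exchange : Matrix → Assignment → Matrix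
  exchange cand g w w′ = exists (movable cand g w w′)

  update : Assignment → V → V → Assignment
  update g x w y = if eq y x then just w else g y

  -- The path runs from a node with room back to a candidate of `x₀`. Moving a leader from its
  -- second node to its first hands the room on, until `x₀` itself can be placed.
  shift : Matrix → V → List V × Assignment → List V × Assignment
  shift cand x₀ s =
    caseL (proj₁ s) s λ w′ p →
    caseL p ([] , update (proj₂ s) x₀ w′) λ w ws →
    (w ∷ ws) , caseM (find (movable cand (proj₂ s) w w′)) (proj₂ s)
                     (λ x → update (proj₂ s) x w′)

  augmenting : Matrix → Assignment → V → Forest
  augmenting cand g x₀ = closure (exchange cand g) (cand x₀)

  augment : Matrix → V → V → Bool × Assignment → Bool × Assignment
  augment cand t x₀ s =
    caseM (find (λ w → busy (augmenting cand (proj₂ s) x₀ w) && room t (proj₂ s) w))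
      (false , proj₂ s)
      (λ w → proj₁ s ,
             proj₂ (foldV (λ q _ → shift cand x₀ q)
                          (path (augmenting cand (proj₂ s) x₀ w) , proj₂ s)))

  match₁ : Matrix → V → Subset → Bool × Assignment → V → Bool × Assignment
  match₁ cand t L s x =
    if L x && caseM (proj₂ s x) true (λ _ → false) then augment cand t x s else s

  opaque
    matching : Matrix → V → Subset → Bool × Assignment
    matching cand t L = foldV (match₁ cand t L) (true , (λ _ → nothing))

  candidates : (V → Forest) → Subset → Subset → Matrix
  candidates C rem L x w = L x && rem w && busy (C w x)

  spokes : (V → Forest) → Assignment → Forest
  spokes C g x = caseM (g x) (none x) (λ w → C w x)

  -- Packets of the same source start two rounds apart and never meet.
  delay : Forest → Forest
  delay S t =
    root (S t) ,
    foldV (λ c u → if lt u t && busy (S u) && eq (root (S u)) (root (S t))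
                   then suc (suc c) else c) (wait (S t)) ,
    path (S t)

  advance : Packet → Packet
  advance p =
    root p , pred′ (wait p) ,
    caseN (wait p) (caseL (path p) [] (λ _ xs → xs)) (λ _ → path p)

  calls : Forest → List (V × V)
  calls S = foldV (λ cs t →
    caseN (wait (S t))
      (caseL (path (S t)) cs λ x xs → caseL xs cs λ y _ → (y , x) ∷ cs)
      (λ _ → cs)) []

  step : Forest × Output → Forest × Output
  step s =
    (λ t → advance (proj₁ s t)) ,
    suc (proj₁ (proj₂ s)) , calls (proj₁ s) ∷ proj₂ (proj₂ s)

  opaque
    -- Paths and delays are at most 2 T long, so 5 T rounds suffice.  The
    -- packets run towards their sources, in reverse time: the calls are
    -- made by their next nodes, and the last round comes first.
    route : V → Forest → Output → Output
    route t S out =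
      proj₂ (times (T t) (λ s → step (step (step (step (step s))))) (delay S , out))

  module Phase (A : Matrix) (t : V) (act rem : Subset) where
    L : Subset
    L = leaders A t act rem
    C : V → Forest
    C = reach A t rem
    M : Bool × Assignment
    M = matching (candidates C rem L) t L

  phase : Matrix → V → V → State → State
  phase A r t (ok , act , out) =
    let (rem , S , hubs) = pack A r t act
        open Phase A t act rem
    in (if proj₁ M then ok else false) , hubs ,
       route t S (route t (spokes C (proj₂ M)) (route t (cells A t act rem L) out))

  run : Matrix → V → V → State
  run A r t =
    -- A loop of n rounds, since every phase loses at least one token.
    foldV (λ s _ → if proj₁ s && exists (proj₁ (proj₂ s)) then phase A r t s else s)
      (true , (λ v → neg (eq v r)) , zero , [])

  attempt : Matrix → V → Maybe Output → V → Maybe Output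
  attempt A r best t = caseM best
    (if proj₁ (run A r t) then just (proj₂ (proj₂ (run A r t))) else nothing) just

  broadcast : Matrix → V → Output
  broadcast A r = caseM (foldV (attempt A r) nothing) (zero , []) (λ o → o)

  adjacency : List (V × V) → Matrix
  adjacency E u v = foldl (λ b e → b || neg (eq u v) &&
    (eq (proj₁ e) u && eq (proj₂ e) v || eq (proj₁ e) v && eq (proj₂ e) u)) false E

  opaque
    -- The maximum of j and k if these are at most c n².
    maximum : ℕ → ℕ → ℕ → ℕ
    maximum c j k = proj₁ (foldV (λ s _ → foldV (λ s′ _ → repeat c peel s′) s) (zero , j , k))

-- Booleans, loops and counting

dichotomy : ∀ b → b ≡ true ⊎ b ≡ false
dichotomy true  = inj₁ refl
dichotomy false = inj₂ refl

true≢false : ∀ {b} {A : Set} → b ≡ true → b ≡ false → A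
true≢false refl ()

&&⁻ : ∀ {a b} → a && b ≡ true → a ≡ true × b ≡ true
&&⁻ {true} eq = refl , eq

&&⁺ : ∀ {a b} → a ≡ true → b ≡ true → a && b ≡ true
&&⁺ refl refl = refl

||⁻ : ∀ {a b} → a || b ≡ true → a ≡ true ⊎ b ≡ true
||⁻ {true}  _  = inj₁ refl
||⁻ {false} eq = inj₂ eq

||⁺ˡ : ∀ {a b} → a ≡ true → a || b ≡ true
||⁺ˡ refl = refl

||⁺ʳ : ∀ {a b} → b ≡ true → a || b ≡ true
||⁺ʳ {true}  _    = refl
||⁺ʳ {false} refl = refl

neg⁻ : ∀ {a} → neg a ≡ true → a ≡ false
neg⁻ {false} _ = refl

neg⁺ : ∀ {a} → a ≡ false → neg a ≡ true
neg⁺ refl = refl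

neg-false : ∀ {a} → neg a ≡ false → a ≡ true
neg-false {true} _ = refl

refute : ∀ {a} → ¬ (a ≡ true) → a ≡ false
refute {true}  f = ⊥-elim (f refl)
refute {false} f = refl

if-elim : ∀ {ℓ} {C : Set} (Pr : C → Set ℓ) b {x y} →
  (b ≡ true → Pr x) → (b ≡ false → Pr y) → Pr (if b then x else y)
if-elim Pr true  f g = f refl
if-elim Pr false f g = g refl

iteration : ∀ {ℓ} {A B : Set} (P : ℕ → A → Set ℓ) {f : A → A} →
  (∀ k x → P k x → P (suc k) (f x)) → ∀ (xs : List B) {j x} → P j x →
  P (length xs + j) (foldl (λ y _ → f y) x xs)
iteration P s []       p = p
iteration P {f} s (y ∷ xs) {j} {x} p =
  subst (λ i → P i (foldl (λ y _ → f y) x (y ∷ xs))) (+-suc (length xs) j) (iteration P s xs (s _ _ p))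

times-induction : ∀ {ℓ} {A : Set} (P : ℕ → A → Set ℓ) {f : A → A} →
  (∀ k x → P k x → P (suc k) (f x)) → ∀ k {j x} → P j x → P (k + j) (times k f x)
times-induction P {f} s k {j} {x} p = subst (λ i → P (i + j) (times k f x)) (length-replicate k)
  (iteration P s (replicate k tt) p)

foldl-invariant : ∀ {ℓ} {A B : Set} (I : B → Set ℓ) {f : B → A → B} →
  (∀ s x → I s → I (f s x)) → ∀ xs {z} → I z → I (foldl f z xs)
foldl-invariant I s []       i = i
foldl-invariant I s (x ∷ xs) i = foldl-invariant I s xs (s _ _ i)

-- The pattern behind the greedy loops: the round of x establishes `Q x`, and the later rounds
-- preserve it.
foldl-reaches : ∀ {ℓ ℓ′} {A B : Set} (I : B → Set ℓ) (Q : A → B → Set ℓ′) {f : B → A → B} →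
  (∀ s x → I s → I (f s x)) → (∀ s x → I s → Q x (f s x)) →
  (∀ s x y → I s → Q x s → Q x (f s y)) →
  ∀ xs {z} → I z → ∀ {x} → x ∈ xs → Q x (foldl f z xs)
foldl-reaches I Q {f} p e k (x ∷ xs) {z} i (here refl) =
  proj₂ (foldl-invariant (λ s → I s × Q x s) (λ s y (i , q) → p s y i , k s x y i q)
    xs (p _ _ i , e _ _ i))
foldl-reaches I Q p e k (y ∷ xs) i (there m) = foldl-reaches I Q p e k xs (p _ _ i) m

b2n : Bool → ℕ
b2n b = if b then 1 else 0

cnt : ∀ {n} → (Fin n → Bool) → ℕ
cnt {zero}  P = 0
cnt {suc n} P = b2n (P zero) + cnt (P ∘ suc)

b2n≤1 : ∀ b → b2n b ≤ 1
b2n≤1 true  = ≤-refl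
b2n≤1 false = z≤n

b2n-mono : ∀ {a b} → (a ≡ true → b ≡ true) → b2n a ≤ b2n b
b2n-mono {false} f = z≤n
b2n-mono {true}  f rewrite f refl = ≤-refl

cnt-mono : ∀ {n} {P Q : Fin n → Bool} → (∀ v → P v ≡ true → Q v ≡ true) → cnt P ≤ cnt Q
cnt-mono {zero}  f = z≤n
cnt-mono {suc n} f = +-mono-≤ (b2n-mono (f zero)) (cnt-mono (f ∘ suc))

cnt-cong : ∀ {n} {P Q : Fin n → Bool} → (∀ v → P v ≡ Q v) → cnt P ≡ cnt Q
cnt-cong {zero}  f = refl
cnt-cong {suc n} f = cong₂ _+_ (cong b2n (f zero)) (cnt-cong (f ∘ suc))

cnt-none : ∀ {n} {P : Fin n → Bool} → (∀ v → P v ≡ false) → cnt P ≡ 0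
cnt-none {zero}  f = refl
cnt-none {suc n} f = cong₂ _+_ (cong b2n (f zero)) (cnt-none (f ∘ suc))

cnt-all : ∀ n → cnt {n} (λ _ → true) ≡ n
cnt-all zero    = refl
cnt-all (suc n) = cong suc (cnt-all n)

cnt-positive : ∀ {n} {P : Fin n → Bool} v → P v ≡ true → 1 ≤ cnt P
cnt-positive zero    p rewrite p = s≤s z≤n
cnt-positive {P = P} (suc v) p = ≤-trans (cnt-positive v p) (m≤n+m _ (b2n (P zero)))

cnt-split : ∀ {n} (P Q : Fin n → Bool) →
  cnt P ≡ cnt (λ v → P v && Q v) + cnt (λ v → P v && neg (Q v))
cnt-split {zero}  P Q = refl
cnt-split {suc n} P Q = trans
  (cong₂ _+_ (go (P zero) (Q zero)) (cnt-split (P ∘ suc) (Q ∘ suc))) 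
  (interchange (b2n (P zero && Q zero)) (b2n (P zero && neg (Q zero)))
    (cnt (λ v → P (suc v) && Q (suc v))) (cnt (λ v → P (suc v) && neg (Q (suc v)))))
  where
  go : ∀ p q → b2n p ≡ b2n (p && q) + b2n (p && neg q)
  go true  true  = refl
  go true  false = refl
  go false _     = refl
  interchange : ∀ a b c d → (a + b) + (c + d) ≡ (a + c) + (b + d)
  interchange = solve-∀

cnt-update : ∀ {n} {P Q : Fin n → Bool} x → (∀ v → v ≢ x → P v ≡ Q v) →
  cnt P + b2n (Q x) ≡ cnt Q + b2n (P x)
cnt-update {suc n} {P} {Q} zero f
  rewrite cnt-cong {P = P ∘ suc} {Q ∘ suc} (λ v → f (suc v) (λ ())) = begin
  b2n (P zero) + c + b2n (Q zero)    ≡⟨ +-comm (b2n (P zero) + c) _ ⟩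
  b2n (Q zero) + (b2n (P zero) + c)  ≡⟨ cong (b2n (Q zero) +_) (+-comm (b2n (P zero)) c) ⟩
  b2n (Q zero) + (c + b2n (P zero))  ≡⟨ +-assoc (b2n (Q zero)) c _ ⟨
  b2n (Q zero) + c + b2n (P zero)    ∎
  where
  open ≡-Reasoning
  c = cnt (Q ∘ suc)
cnt-update {suc n} {P} {Q} (suc x) f rewrite f zero (λ ()) = begin
  b2n (Q zero) + cnt (P ∘ suc) + b2n (Q (suc x))    ≡⟨ +-assoc (b2n (Q zero)) _ _ ⟩
  b2n (Q zero) + (cnt (P ∘ suc) + b2n (Q (suc x)))  ≡⟨ cong (b2n (Q zero) +_)
    (cnt-update x (λ v v≢x → f (suc v) (v≢x ∘ suc-injective))) ⟩
  b2n (Q zero) + (cnt (Q ∘ suc) + b2n (P (suc x)))  ≡⟨ +-assoc (b2n (Q zero)) _ _ ⟨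
  b2n (Q zero) + cnt (Q ∘ suc) + b2n (P (suc x))    ∎
  where open ≡-Reasoning

rk : ∀ {n} → (Fin n → Bool) → Fin n → ℕ
rk P zero    = 0
rk P (suc t) = b2n (P zero) + rk (P ∘ suc) t

rk-cnt : ∀ {n} {P Q : Fin n → Bool} t → (∀ u → u Fin.< t → Q u ≡ P u) →
  (∀ u → t Fin.≤ u → Q u ≡ false) → cnt Q ≡ rk P t
rk-cnt zero    f g = cnt-none (λ v → g v z≤n)
rk-cnt (suc t) f g = cong₂ _+_ (cong b2n (f zero (s≤s z≤n)))
  (rk-cnt t (λ u u<t → f (suc u) (s≤s u<t)) (λ u t≤u → g (suc u) (s≤s t≤u)))

rk-< : ∀ {n} {P : Fin n → Bool} t → P t ≡ true → rk P t < cnt P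
rk-< zero p rewrite p = s≤s z≤n
rk-< {P = P} (suc t) p =
  ≤-trans (≤-reflexive (sym (+-suc (b2n (P zero)) _))) (+-monoʳ-≤ (b2n (P zero)) (rk-< t p))

rk-injective : ∀ {n} {P : Fin n → Bool} t u → P t ≡ true → P u ≡ true →
  rk P t ≡ rk P u → t ≡ u
rk-injective zero    zero    p q e = refl
rk-injective zero    (suc u) p q e rewrite p = contradiction e λ ()
rk-injective (suc t) zero    p q e rewrite q = contradiction e λ ()
rk-injective {P = P} (suc t) (suc u) p q e =
  cong suc (rk-injective t u p q (+-cancelˡ-≡ (b2n (P zero)) _ _ e))

-- By induction along the order: a member of `P` at the front takes one of the s places and
-- contributes one to every later rank.
cnt-first : ∀ {n} {P Q : Fin n → Bool} s →
  (∀ t → Q t ≡ true → P t ≡ true × rk P t < s) →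
  (∀ t → P t ≡ true → rk P t < s → Q t ≡ true) → cnt Q ≡ s ⊓ cnt P
cnt-first {zero} s f g = sym (⊓-zeroʳ s)
cnt-first {suc n} {P} {Q} s f g with P zero in p
... | false rewrite refute {Q zero} (λ q → true≢false (proj₁ (f zero q)) p) =
  cnt-first s (λ t q → let (a , b) = f (suc t) q in a , subst (λ b → b2n b + rk (P ∘ suc) t < s) p b)
              (λ t a b → g (suc t) a (subst (λ b → b2n b + rk (P ∘ suc) t < s) (sym p) b))
cnt-first {suc n} {P} {Q} zero f g | true
  rewrite refute {Q zero} (λ q → contradiction (proj₂ (f zero q)) λ ()) =
  cnt-none (λ t → refute (λ q → contradiction (proj₂ (f (suc t) q)) λ ()))
cnt-first {suc n} {P} {Q} (suc s) f g | true rewrite g zero p (s≤s z≤n) =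
  cong suc (cnt-first s
    (λ t q → let (a , b) = f (suc t) q in a , s≤s⁻¹ (subst (λ b → b2n b + rk (P ∘ suc) t < suc s) p b))
    (λ t a b → g (suc t) a (subst (λ b → b2n b + rk (P ∘ suc) t < suc s) (sym p) (s≤s b))))

-- The fibres of `M` over `R` cover `P` and may overlap; an element is charged to the first fibre
-- that contains it.
cnt-fibres-≤ : ∀ {m n} {P : Fin n → Bool} {R : Fin m → Bool} B (M : Fin n → Fin m → Bool) →
  (∀ x → P x ≡ true → ∃ λ w → R w ≡ true × M x w ≡ true) →
  (∀ w → R w ≡ true → cnt (λ x → M x w) ≤ B) → cnt P ≤ cnt R * B
cnt-fibres-≤ {zero} B M f g =
  ≤-reflexive (cnt-none λ x → refute λ p → contradiction (proj₁ (f x p)) λ ())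
cnt-fibres-≤ {suc m} {P = P} {R} B M f g = begin
  cnt P                                      ≡⟨ cnt-split P Q ⟩
  cnt (λ x → P x && Q x) + cnt P₁            ≤⟨ +-mono-≤ small
    (cnt-fibres-≤ {P = P₁} {R ∘ suc} B (λ x w → M x (suc w)) f′ (λ w r → g (suc w) r)) ⟩
  b2n (R zero) * B + cnt (R ∘ suc) * B       ≡⟨ *-distribʳ-+ B (b2n (R zero)) _ ⟨
  (b2n (R zero) + cnt (R ∘ suc)) * B         ∎
  where
  open ≤-Reasoning
  Q : Fin _ → Bool
  Q x = R zero && M x zero
  P₁ : Fin _ → Bool
  P₁ x = P x && neg (Q x)
  small : cnt (λ x → P x && Q x) ≤ b2n (R zero) * B
  small with R zero in r
  ... | true  = ≤-trans (cnt-mono (λ v e → proj₂ (&&⁻ {P v} e)))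
                  (≤-trans (g zero r) (≤-reflexive (sym (+-identityʳ B))))
  ... | false = ≤-reflexive (cnt-none (λ v → refute λ e → contradiction (proj₂ (&&⁻ {P v} e)) λ ()))
  f′ : ∀ x → P₁ x ≡ true → ∃ λ w → R (suc w) ≡ true × M x (suc w) ≡ true
  f′ x e with &&⁻ {P x} e
  ... | p , q with f x p
  ... | zero , r , e′ = true≢false (&&⁺ r e′) (neg⁻ q)
  ... | suc w , r , e′ = w , r , e′

-- Here the fibres lie in `P` and are disjoint, so taking the first one out of `P` leaves the others
-- intact.
cnt-fibres-≥ : ∀ {m n} {P : Fin n → Bool} {R : Fin m → Bool} B (M : Fin n → Fin m → Bool) →
  (∀ w → R w ≡ true → B ≤ cnt (λ x → M x w)) →
  (∀ x w → R w ≡ true → M x w ≡ true → P x ≡ true) →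
  (∀ x w w′ → M x w ≡ true → M x w′ ≡ true → w ≡ w′) → cnt R * B ≤ cnt P
cnt-fibres-≥ {zero} B M f g h = z≤n
cnt-fibres-≥ {suc m} {P = P} {R} B M f g h = begin
  (b2n (R zero) + cnt (R ∘ suc)) * B         ≡⟨ *-distribʳ-+ B (b2n (R zero)) _ ⟩
  b2n (R zero) * B + cnt (R ∘ suc) * B       ≤⟨ +-mono-≤ large
    (cnt-fibres-≥ {P = P₁} {R ∘ suc} B (λ x w → M x (suc w)) (λ w r → f (suc w) r) g′
      (λ x w w′ e e′ → suc-injective (h x _ _ e e′))) ⟩
  cnt (λ x → P x && M x zero) + cnt P₁       ≡⟨ cnt-split P (λ x → M x zero) ⟨
  cnt P                                      ∎
  where
  open ≤-Reasoning
  P₁ : Fin _ → Bool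
  P₁ x = P x && neg (M x zero)
  large : b2n (R zero) * B ≤ cnt (λ x → P x && M x zero)
  large with R zero in r
  ... | true  = ≤-trans (≤-reflexive (+-identityʳ B)) (≤-trans (f zero r)
                  (cnt-mono (λ v e → &&⁺ (g v zero r e) e)))
  ... | false = z≤n
  g′ : ∀ x w → R (suc w) ≡ true → M x (suc w) ≡ true → P₁ x ≡ true
  g′ x w r e = &&⁺ (g x _ r e) (neg⁺ (refute λ e₀ → contradiction (h x _ _ e₀ e) λ ()))

elements : ∀ {n} (P : Fin n → Bool) →
  Σ (Fin (cnt P) → Fin n) λ f → (∀ i → P (f i) ≡ true) × (∀ i j → f i ≡ f j → i ≡ j)
elements {zero}  P = (λ ()) , (λ ()) , λ ()
elements {suc n} P with P zero in p | elements (P ∘ suc)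
... | false | f , sat , inj = suc ∘ f , sat , λ i j e → inj i j (suc-injective e)
... | true  | f , sat , inj = g , sat′ , inj′
  where
  g : Fin (suc (cnt (P ∘ suc))) → Fin (suc n)
  g zero    = zero
  g (suc i) = suc (f i)
  sat′ : ∀ i → P (g i) ≡ true
  sat′ zero    = p
  sat′ (suc i) = sat i
  inj′ : ∀ i j → g i ≡ g j → i ≡ j
  inj′ zero    zero    e = refl
  inj′ (suc i) (suc j) e = cong suc (inj i j (suc-injective e))

cnt-injection : ∀ {m n} {P : Fin n → Bool} (g : ∀ x → P x ≡ true → Fin m) →
  (∀ x y p q → g x p ≡ g y q → x ≡ y) → cnt P ≤ m
cnt-injection {P = P} g inj with elements P
... | f , sat , f-inj = injective⇒≤ {f = λ i → g (f i) (sat i)}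
  (λ {i} {j} e → f-inj i j (inj _ _ _ _ e))

-- Specifications of comparison, search and counting

module Search (n : ℕ) where
  open Algorithm n

  foldV-invariant : ∀ {ℓ} {B : Set} (I : B → Set ℓ) {f : B → V → B} →
    (∀ s v → I s → I (f s v)) → ∀ {z} → I z → I (foldV f z)
  foldV-invariant I p i = foldl-invariant I p (tabulate id) i

  foldV-reaches : ∀ {ℓ ℓ′} {B : Set} (I : B → Set ℓ) (Q : V → B → Set ℓ′) {f : B → V → B} →
    (∀ s v → I s → I (f s v)) → (∀ s v → I s → Q v (f s v)) →
    (∀ s v u → I s → Q v s → Q v (f s u)) → ∀ {z} → I z → ∀ v → Q v (foldV f z)
  foldV-reaches I Q p e k i v = foldl-reaches I Q p e k (tabulate id) i (∈-tabulate⁺ v)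

  times-pred : ∀ k x → times k pred′ x ≡ x ∸ k
  times-pred zero    x       = refl
  times-pred (suc k) zero    = trans (times-pred k zero) (0∸n≡0 k)
  times-pred (suc k) (suc x) = times-pred k x

  times-suc : ∀ k x → times k suc x ≡ k + x
  times-suc zero    x = refl
  times-suc (suc k) x = trans (times-suc k (suc x)) (+-suc k x)

  opaque
    unfolding exceeds

    exceeds⇒ : ∀ {k} t → exceeds k t ≡ true → T t < k
    exceeds⇒ {k} t e rewrite times-pred (T t) k with k ∸ T t in d
    ... | suc _ = m∸n≢0⇒n<m λ z → contradiction (trans (sym d) z) λ ()

    exceeds-false⇒ : ∀ {k} t → exceeds k t ≡ false → k ≤ T t
    exceeds-false⇒ {k} t e rewrite times-pred (T t) k with k ∸ T t in d
    ... | zero = m∸n≡0⇒m≤n d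

  ⇒exceeds : ∀ {k} t → T t < k → exceeds k t ≡ true
  ⇒exceeds {k} t l with exceeds k t in e
  ... | true  = refl
  ... | false = contradiction (exceeds-false⇒ t e) (<⇒≱ l)

  ⇒exceeds-false : ∀ {k} t → k ≤ T t → exceeds k t ≡ false
  ⇒exceeds-false t l = refute λ e → <⇒≱ (exceeds⇒ t e) l

  opaque
    unfolding lt

    lt⇒ : ∀ {v u} → lt v u ≡ true → v Fin.< u
    lt⇒ {v} {u} e = s≤s⁻¹ (subst (T v <_) (trans (times-suc (T u) 0) (+-identityʳ (T u)))
      (exceeds⇒ {times (T u) suc 0} v e))

    ⇒lt : ∀ {v u} → v Fin.< u → lt v u ≡ true
    ⇒lt {v} {u} l = ⇒exceeds v
      (subst (T v <_) (sym (trans (times-suc (T u) 0) (+-identityʳ (T u)))) (s≤s l))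

  lt-false : ∀ {v u} → u Fin.≤ v → lt v u ≡ false
  lt-false l = refute λ e → <⇒≱ (lt⇒ e) l

  opaque
    unfolding eq

    eq⇒ : ∀ {u v} → eq u v ≡ true → u ≡ v
    eq⇒ {u} {v} e with &&⁻ {neg (lt u v)} e
    ... | p , q = toℕ-injective (≤-antisym
      (≮⇒≥ λ l → true≢false (⇒lt l) (neg⁻ q)) (≮⇒≥ λ l → true≢false (⇒lt l) (neg⁻ p)))

    eq-refl : ∀ u → eq u u ≡ true
    eq-refl u = &&⁺ (neg⁺ (lt-false {u} {u} ≤-refl)) (neg⁺ (lt-false {u} {u} ≤-refl))

  ≢⇒eq-false : ∀ {u v} → u ≢ v → eq u v ≡ false
  ≢⇒eq-false u≢v = refute (u≢v ∘ eq⇒)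

  opaque
    unfolding find exists

    find-sound : ∀ P {v} → find P ≡ just v → P v ≡ true
    find-sound P = foldV-invariant (λ r → ∀ {v} → r ≡ just v → P v ≡ true) body λ ()
      where
      body : ∀ r v → (∀ {u} → r ≡ just u → P u ≡ true) →
             ∀ {u} → caseM r (if P v then just v else nothing) just ≡ just u → P u ≡ true
      body (just x) v i e = i e
      body nothing  v i e with P v in p
      body nothing v i refl | true = p

    find-complete : ∀ P → find P ≡ nothing → ∀ v → P v ≡ false
    find-complete P e v =
      foldV-reaches (λ _ → ⊤) (λ v r → r ≡ nothing → P v ≡ false)
        (λ _ _ _ → tt) (λ r v _ → body r v) (λ r v u _ → keep r v u) tt v e
      where
      body : ∀ r v → caseM r (if P v then just v else nothing) just ≡ nothing → P v ≡ false
      body nothing v e with P v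
      ... | false = refl
      keep : ∀ r v u → (r ≡ nothing → P v ≡ false) →
             caseM r (if P u then just u else nothing) just ≡ nothing → P v ≡ false
      keep nothing v u i e = i refl

    find-some : ∀ P v → P v ≡ true → ∃ λ u → find P ≡ just u × P u ≡ true
    find-some P v p with find P in e
    ... | just u  = u , refl , find-sound P e
    ... | nothing = true≢false p (find-complete P e v)

    exists⁻ : ∀ P → exists P ≡ true → ∃ λ v → P v ≡ true
    exists⁻ P e with find P in f
    ... | just v = v , find-sound P f

    exists⁺ : ∀ P v → P v ≡ true → exists P ≡ true
    exists⁺ P v p with find P in f
    ... | just u  = refl
    ... | nothing = true≢false p (find-complete P f v)

  exists-false : ∀ P → exists P ≡ false → ∀ v → P v ≡ false
  exists-false P e v = refute λ p → true≢false (exists⁺ P v p) e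

  -- The step s is 1 for `count` and 2 for the delays of packets.
  foldl-count : ∀ {m} (P : V → Bool) (h : Fin m → V) s c →
    foldl (λ k v → if P v then s + k else k) c (tabulate h) ≡ cnt (P ∘ h) * s + c
  foldl-count {zero}  P h s c = refl
  foldl-count {suc m} P h s c with P (h zero)
  ... | false = foldl-count P (h ∘ suc) s c
  ... | true  = trans (foldl-count P (h ∘ suc) s (s + c))
    (trans (sym (+-assoc (cnt (P ∘ h ∘ suc) * s) s c)) (cong (_+ c) (+-comm (cnt (P ∘ h ∘ suc) * s) s)))

  opaque
    unfolding count

    count≡ : ∀ P → count P ≡ cnt P
    count≡ P = trans (foldl-count P id 1 0)
      (trans (+-identityʳ _) (*-identityʳ (cnt P)))

  rank≡ : ∀ P t → rank P t ≡ rk P t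
  rank≡ P t = trans (count≡ _) (rk-cnt t
    (λ u l → cong (_&& P u) (⇒lt l)) (λ u l → cong (_&& P u) (lt-false l)))

-- Breadth-first search

-- The index counts the entries after y. On a path this is the distance to the source, and it does
-- not change when a packet advances and the head is dropped.
data At {A : Set} (y : A) : ℕ → List A → Set where
  here  : ∀ {xs} → At y (length xs) (y ∷ xs)
  there : ∀ {k x xs} → At y k xs → At y k (x ∷ xs)

At-< : ∀ {A : Set} {y : A} {k xs} → At y k xs → k < length xs
At-< here      = ≤-refl
At-< (there a) = m≤n⇒m≤1+n (At-< a)

∈⇒At : ∀ {A : Set} {y : A} {xs} → y ∈ xs → ∃ λ k → At y k xs
∈⇒At (here refl) = _ , here
∈⇒At (there m)   = let (k , a) = ∈⇒At m in k , there a

At⇒∈ : ∀ {A : Set} {y : A} {k xs} → At y k xs → y ∈ xs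
At⇒∈ here      = here refl
At⇒∈ (there a) = there (At⇒∈ a)

unique-lookup : ∀ {A : Set} {xs : List A} → Unique xs →
  ∀ i j → List.lookup xs i ≡ List.lookup xs j → i ≡ j
unique-lookup (_ ∷ _)  zero    zero    _ = refl
unique-lookup (ne ∷ _) zero    (suc j) e = contradiction e (All.lookup ne (∈-lookup j))
unique-lookup (ne ∷ _) (suc i) zero    e = contradiction (sym e) (All.lookup ne (∈-lookup i))
unique-lookup (_ ∷ u)  (suc i) (suc j) e = cong suc (unique-lookup u i j e)

unique-length : ∀ {n} {xs : List (Fin n)} → Unique xs → length xs ≤ n
unique-length u = injective⇒≤ (λ {i} {j} → unique-lookup u i j)

module Search-trees (n : ℕ) where
  open Algorithm n
  open Search n

  busy⁻ : ∀ p → busy p ≡ true → ∃₂ λ x xs → path p ≡ x ∷ xs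
  busy⁻ (_ , _ , x ∷ xs) _ = x , xs , refl

  busy⁺ : ∀ p {x xs} → path p ≡ x ∷ xs → busy p ≡ true
  busy⁺ (_ , _ , _) refl = refl

  module _ (A : Matrix) (ok : Subset) where

    data Walk : ℕ → V → V → Set where
      nil  : ∀ {x} → Walk 0 x x
      snoc : ∀ {k x u v} → Walk k x u → A u v ≡ true → ok v ≡ true → Walk (suc k) x v

  module _ {A : Matrix} {ok : Subset} where

    infixr 5 _++ʷ_

    _++ʷ_ : ∀ {i j x y z} → Walk A ok i x y → Walk A ok j y z → Walk A ok (j + i) x z
    p ++ʷ nil          = p
    p ++ʷ snoc q e o   = snoc (p ++ʷ q) e o

    walk-end : ∀ {i x y} → ok x ≡ true → Walk A ok i x y → ok y ≡ true
    walk-end o nil          = o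
    walk-end o (snoc _ _ o′) = o′

    reverseʷ : (∀ u v → A u v ≡ true → A v u ≡ true) →
               ∀ {i x y} → ok x ≡ true → Walk A ok i x y → Walk A ok i y x
    reverseʷ sy o nil = nil
    reverseʷ sy {x = x} {y} o (snoc {k} p e o′) =
      subst (λ i → Walk A ok i y x) (+-comm k 1)
        (snoc nil (sy _ _ e) (walk-end o p) ++ʷ reverseʷ sy o p)

    data Trail (x : V) : V → List V → Set where
      stop : Trail x x (x ∷ [])
      link : ∀ {u v ps} → Trail x u ps → A u v ≡ true → ok v ≡ true → Trail x v (v ∷ ps)

    trail-cut : ∀ {x u v ps} → Trail x u ps → Unique ps → v ∈ ps →
                ∃ λ qs → Trail x v qs × Unique qs
    trail-cut t@stop         u       (here refl) = _ , t , u
    trail-cut t@(link _ _ _) u       (here refl) = _ , t , u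
    trail-cut (link t _ _)   (_ ∷ u) (there m)   = trail-cut t u m

    trail : ∀ {k x v} → Walk A ok k x v → ∃ λ ps → Trail x v ps × Unique ps
    trail nil = _ , stop , [] ∷ []
    trail (snoc {v = v} w e o) with trail w
    ... | ps , t , u with _∈?_ Fin._≟_ v ps
    ... | yes m = trail-cut t u m
    ... | no  m = v ∷ ps , link t e o , ¬Any⇒All¬ ps m ∷ u

    trail-walk : ∀ {x v ps} → Trail x v ps → ∃ λ k → suc k ≡ length ps × Walk A ok k x v
    trail-walk stop = 0 , refl , nil
    trail-walk (link t e o) with trail-walk t
    ... | k , l , w = suc k , cong suc l , snoc w e o

    -- Cutting out closed parts leaves a walk without repeated nodes.
    shorten : ∀ {k x v} → Walk A ok k x v → ∃ λ j → j < n × Walk A ok j x v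
    shorten w with trail w
    ... | ps , t , u with trail-walk t
    ... | j , l , w′ = j , subst (_≤ n) (sym l) (unique-length u) , w′

  walk-mono : ∀ {A ok ok′} → (∀ v → ok v ≡ true → ok′ v ≡ true) →
              ∀ {i x y} → Walk A ok i x y → Walk A ok′ i x y
  walk-mono f nil          = nil
  walk-mono f (snoc p e o) = snoc (walk-mono f p) e (f _ o)

  module Growth (A : Matrix) (ok src : Subset) where

    -- More than a walk to ρ: every suffix is the path stored at its own head. Therefore a node
    -- determines the root of any path through it and its distance to that root (`up-at`).
    data Up (F : Forest) (ρ : V) : List V → Set where
      source : src ρ ≡ true → root (F ρ) ≡ ρ → path (F ρ) ≡ ρ ∷ [] → Up F ρ (ρ ∷ [])
      link   : ∀ {v u xs} → A u v ≡ true → ok v ≡ true →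
               root (F v) ≡ ρ → path (F v) ≡ v ∷ u ∷ xs → Up F ρ (u ∷ xs) → Up F ρ (v ∷ u ∷ xs)

    up-src : ∀ {F ρ xs} → Up F ρ xs → src ρ ≡ true
    up-src (source s _ _)   = s
    up-src (link _ _ _ _ p) = up-src p

    up-walk : ∀ {F ρ v xs} → Up F ρ (v ∷ xs) → Walk A ok (length xs) ρ v
    up-walk (source _ _ _)   = nil
    up-walk (link e o _ _ p) = snoc (up-walk p) e o

    up-at : ∀ {F ρ xs y k} → Up F ρ xs → At y k xs →
            root (F y) ≡ ρ × length (path (F y)) ≡ suc k × Up F ρ (path (F y))
    up-at p@(source _ r q) here =
      r , cong length q , subst (Up _ _) (sym q) p
    up-at p@(link _ _ r q _) here =
      r , cong length q , subst (Up _ _) (sym q) p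
    up-at (source _ _ _) (there ())
    up-at (link _ _ _ _ p) (there a) = up-at p a

    up-ok : ∀ {F ρ xs y} → Up F ρ xs → y ∈ xs → y ≡ ρ ⊎ ok y ≡ true
    up-ok (source _ _ _)   (here refl) = inj₁ refl
    up-ok (link _ o _ _ _) (here refl) = inj₂ o
    up-ok (link _ _ _ _ p) (there m)   = up-ok p m

    up-walk-from : ∀ {F ρ xs y} → Up F ρ xs → y ∈ xs → ∀ {v ys} → xs ≡ v ∷ ys →
                   ∃ λ k → k ≤ length ys × Walk A ok k y v
    up-walk-from p (here refl) refl = 0 , z≤n , nil
    up-walk-from (link e o _ _ p) (there m) refl with up-walk-from p m refl
    ... | k , k≤ , w = suc k , s≤s k≤ , snoc w e o

    up-source : ∀ {F ρ xs} → Up F ρ xs → ρ ∈ xs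
    up-source (source _ _ _)   = here refl
    up-source (link _ _ _ _ p) = there (up-source p)

    up-cong : ∀ F {F′ ρ xs} →
      (∀ v → busy (F v) ≡ true → root (F′ v) ≡ root (F v) × path (F′ v) ≡ path (F v)) →
      Up F ρ xs → Up F′ ρ xs
    up-cong F f (source s r q) with f _ (busy⁺ (F _) q)
    ... | r′ , q′ = source s (trans r′ r) (trans q′ q)
    up-cong F f (link e o r q p) with f _ (busy⁺ (F _) q)
    ... | r′ , q′ = link e o (trans r′ r) (trans q′ q) (up-cong F f p)

    record Grown (k : ℕ) (F : Forest) : Set where
      field
        up       : ∀ v {x xs} → path (F v) ≡ x ∷ xs →
                   x ≡ v × Up F (root (F v)) (x ∷ xs) × wait (F v) + length (x ∷ xs) ≡ suc k
        complete : ∀ j {x v} → j ≤ k → src x ≡ true → Walk A ok j x v → busy (F v) ≡ true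

    open Grown

    path-∈ : ∀ {k F} → Grown k F → ∀ v {y} → y ∈ path (F v) →
             Up F (root (F v)) (path (F v)) × wait (F v) + length (path (F v)) ≡ suc k ×
             ∃ λ xs → path (F v) ≡ v ∷ xs
    path-∈ {F = F} g v m with path (F v) in q
    ... | x ∷ xs with g .up v q
    ... | refl , p , l = p , l , xs , refl

    -- From y on, both paths are the path stored at y.
    grown-share : ∀ {k F} → Grown k F → ∀ {v v′ y i j} → At y i (path (F v)) → At y j (path (F v′)) →
                  root (F v) ≡ root (F v′) × i ≡ j
    grown-share g {v} {v′} a b
      with up-at (proj₁ (path-∈ g v (At⇒∈ a))) a | up-at (proj₁ (path-∈ g v′ (At⇒∈ b))) b
    ... | r , l , _ | r′ , l′ , _ = trans (sym r) r′ , cong pred (trans (sym l) l′)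

    grown-walk : ∀ {k F} → Grown k F → ∀ v → busy (F v) ≡ true →
                 src (root (F v)) ≡ true × ∃ λ j → j ≤ k × Walk A ok j (root (F v)) v
    grown-walk {F = F} g v b with busy⁻ (F v) b
    ... | x , xs , q with g .up v q
    ... | refl , p , l = up-src p , length xs ,
      s≤s⁻¹ (≤-trans (m≤n+m _ (wait (F v))) (≤-reflexive l)) , up-walk p

    grown-start : Grown 0 (start src)
    grown-start .up v q with src v in s
    grown-start .up v refl | true = refl , source s refl (cong (λ b → if b then v ∷ [] else []) s) , refl
    grown-start .complete .0 {v = v} z≤n s nil rewrite s = refl

    grow-keeps : ∀ F v → busy (F v) ≡ true →
      root (grow A ok F v) ≡ root (F v) × path (grow A ok F v) ≡ path (F v)
    grow-keeps F v b rewrite b = refl , refl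

    grow-keeps-busy : ∀ F v → busy (F v) ≡ true → busy (grow A ok F v) ≡ true
    grow-keeps-busy F v b rewrite b = b

    grown-step : ∀ k F → Grown k F → Grown (suc k) (grow A ok F)
    grown-step k F g .complete j j≤ s nil = grow-keeps-busy F _ (g .complete 0 z≤n s nil)
    grown-step k F g .complete (suc j) (s≤s j≤) s (snoc {u = u} {v} w e o) with busy (F v) in b
    ... | true = b
    ... | false rewrite o with find-some (λ u → A u v && busy (F u)) u (&&⁺ e (g .complete j j≤ s w))
    ... | u′ , eq , _ rewrite eq = refl
    grown-step k F g .up v {x} {xs} q with busy (F v) in b
    ... | true = let (h , p , l) = g .up v q in
      h , up-cong F (grow-keeps F) p , cong suc l
    ... | false with ok v in o
    ... | false = true≢false (busy⁺ (F v) q) b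
    ... | true with find (λ u → A u v && busy (F u)) in f
    ... | nothing = true≢false (busy⁺ (F v) q) b
    ... | just u with busy⁻ (F u) (proj₂ (&&⁻ {A u v} (find-sound _ f)))
    ... | y , ys , qu with g .up u qu
    ... | refl , p , l with ∷-injective q
    ... | refl , refl = refl , subst (λ zs → Up F′ (root (F u)) (v ∷ zs)) (sym qu) linked , level
      where
      F′ : Forest
      F′ = grow A ok F
      edge : A u v ≡ true
      edge = proj₁ (&&⁻ (find-sound (λ u → A u v && busy (F u)) f))
      new : F′ v ≡ (root (F u) , zero , v ∷ path (F u))
      new rewrite b | o | f = refl
      linked : Up F′ (root (F u)) (v ∷ u ∷ ys)
      linked = link edge o (cong root new) (trans (cong path new) (cong (v ∷_) qu))
        (up-cong F (grow-keeps F) p)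
      -- Had u been reached before the last step, v would be reached now.
      fresh : ∀ w → w + suc (length ys) ≡ suc k → w ≡ 0
      fresh zero    _  = refl
      fresh (suc w) l′ = true≢false (g .complete (suc (length ys)) (subst (suc (length ys) ≤_)
        (cong pred l′) (m≤n+m (suc (length ys)) w)) (up-src p) (snoc (up-walk p) edge o)) b
      level : suc (length (path (F u))) ≡ suc (suc k)
      level = cong suc (trans (cong length qu) (trans (cong (_+ suc (length ys)) (sym (fresh (wait (F u)) l))) l))

    grown-times : ∀ t {k F} → Grown k F → Grown (T t + k) (bfs A ok t F)
    grown-times t g = times-induction Grown grown-step (T t) g

    opaque
      unfolding bfs₁ bfs₂

      bfs₁-grown : ∀ t → Grown (T t) (bfs₁ A ok t src)
      bfs₁-grown t = subst (λ k → Grown k (bfs₁ A ok t src)) (+-identityʳ (T t))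
        (grown-times t grown-start)

      bfs₂-grown : ∀ t → Grown (T t + T t) (bfs₂ A ok t src)
      bfs₂-grown t = grown-times t (bfs₁-grown t)

  opaque
    unfolding closure

    closure-grown : ∀ A src → Growth.Grown A (λ _ → true) src n (closure A src)
    closure-grown A src =
      subst (λ k → Grown k (closure A src))
        (trans (+-identityʳ _) (length-tabulate {n = n} id))
        (iteration Grown grown-step (tabulate {n = n} id) grown-start)
      where open Growth A (λ _ → true) src

-- Routing packets along paths

-- For a node that is the receiver of one call and the sender of another: the two packets would be
-- one round apart, but packets of one root are an even number of rounds apart.
odd≢even : ∀ a b → suc (a * 2) ≢ b * 2
odd≢even zero    (suc zero)    ()
odd≢even (suc a) (suc b) e = odd≢even a b (cong (λ k → pred (pred k)) e)

module Routing (G : Graph)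
               (A : Fin (order G) → Fin (order G) → Bool) (A-adj : ∀ u v → A u v ≡ true → Adj G u v) where
  private
    n = order G
  open Algorithm n
  open Search n
  open Search-trees n

  -- Quantifying over all sets `I` that contain `Z` lets rounds be put in front: what is informed
  -- after them is again such a set.
  record Covers (rs : List (Round G)) (Z : V → Set) : Set₁ where
    constructor covering
    field inform : ∀ (I : V → Set) → (∀ z → Z z → I z) → ∀ v → InformedAfter G I rs v

  open Covers

  record Plan (out : Output) (Z : V → Set) : Set₁ where
    field
      covers : Covers (proj₂ out) Z
      rounds : All (IsRound G) (proj₂ out)
      length≡ : proj₁ out ≡ length (proj₂ out)

  sameRoot : Forest → V → Subset
  sameRoot S h v = busy (S v) && eq (root (S v)) h

  -- `level` synchronises the packets before delays, `share` allows paths to cross only at equal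
  -- distance from a common root, and `few` bounds the ranks by T and so the delays by 2 T.
  record Routable (t : V) (S : Forest) (X : V → Set) : Set where
    field
      d       : ℕ
      d≤      : d ≤ T t + T t
      linked  : ∀ v → Linked (λ x y → A y x ≡ true) (path (S v))
      level   : ∀ v → busy (S v) ≡ true → wait (S v) + length (path (S v)) ≡ suc d
      share   : ∀ {v v′ y k k′} → At y k (path (S v)) → At y k′ (path (S v′)) →
                root (S v) ≡ root (S v′) × k ≡ k′
      last    : ∀ {v y} → At y 0 (path (S v)) → X y
      few     : ∀ h → cnt (sameRoot S h) ≤ suc (T t)

  record Calling (p : Packet) (x y : V) : Set where
    constructor calling
    field
      {rest} : List V
      now    : wait p ≡ 0
      ahead  : path p ≡ x ∷ y ∷ rest

  add : Packet → List (V × V) → List (V × V)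
  add p cs = caseN (wait p)
    (caseL (path p) cs λ x xs → caseL xs cs λ y _ → (y , x) ∷ cs) (λ _ → cs)

  add-view : ∀ p cs → add p cs ≡ cs ⊎ ∃₂ λ x y → Calling p x y × add p cs ≡ (y , x) ∷ cs
  add-view (_ , suc _ , _)           cs = inj₁ refl
  add-view (_ , zero , [])           cs = inj₁ refl
  add-view (_ , zero , _ ∷ [])       cs = inj₁ refl
  add-view (_ , zero , x ∷ y ∷ _)    cs = inj₂ (x , y , calling refl refl , refl)

  add-calling : ∀ p {x y} cs → Calling p x y → add p cs ≡ (y , x) ∷ cs
  add-calling (_ , _ , _) cs (calling refl refl) = refl

  add-keeps : ∀ p {c cs} → c ∈ cs → c ∈ add p cs
  add-keeps p {cs = cs} m with add-view p cs
  ... | inj₁ e               = subst (_ ∈_) (sym e) m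
  ... | inj₂ (_ , _ , _ , e) = subst (_ ∈_) (sym e) (there m)

  calls-complete : ∀ S {v x y} → Calling (S v) x y → (y , x) ∈ calls S
  calls-complete S {v} c = foldV-reaches (λ _ → ⊤)
    (λ v cs → ∀ {x y} → Calling (S v) x y → (y , x) ∈ cs)
    (λ _ _ _ → tt)
    (λ cs v _ c → subst (_ ∈_) (sym (add-calling (S v) cs c)) (here refl))
    (λ cs v u _ i c → add-keeps (S u) (i c)) tt v c

  ends : List (V × V) → List V
  ends = concatMap (λ (u , v) → u ∷ v ∷ [])

  End : V → V → V → Set
  End z x y = z ≡ x ⊎ z ≡ y

  calls-round : ∀ S →
    (∀ {v x y} → Calling (S v) x y → A y x ≡ true) →
    (∀ {v v′ x y x′ y′ z} → Calling (S v) x y → Calling (S v′) x′ y′ →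
      End z x y → End z x′ y′ → v ≡ v′) →
    IsRound G (calls S)
  calls-round S edge disjoint = go (tabulate id) (tabulate⁺ id) ([] , []) (λ ())
    where
    -- Invariant of the loop: no endpoint of a call collected so far is an endpoint of a call still
    -- to come.
    go : ∀ ts → Unique ts → ∀ {cs} → IsRound G cs →
         (∀ {z} → z ∈ ends cs → ∀ {v} → v ∈ ts → ∀ {x y} → Calling (S v) x y → ¬ End z x y) →
         IsRound G (foldl (λ cs v → add (S v) cs) cs ts)
    go [] _ r _ = r
    go (t ∷ ts) (ne ∷ u) {cs} r a with add-view (S t) cs
    ... | inj₁ e rewrite e = go ts u r (λ z∈ v∈ → a z∈ (there v∈))
    ... | inj₂ (x , y , c , e) rewrite e = go ts u
      ((A-adj y x (edge c) ∷ proj₁ r) ,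
       ((λ y≡x → proj₁ (A-adj y x (edge c)) y≡x) ∷ outside (inj₂ refl)) ∷ outside (inj₁ refl) ∷ proj₂ r) a′
      where
      outside : ∀ {z} → End z x y → All (z ≢_) (ends cs)
      outside en = All.tabulate λ { z∈ refl → a z∈ (here refl) c en }
      a′ : ∀ {z} → z ∈ y ∷ x ∷ ends cs → ∀ {v} → v ∈ ts → ∀ {x′ y′} → Calling (S v) x′ y′ → ¬ End z x′ y′
      a′ (here refl)         v∈ c′ en = All.lookup ne v∈ (disjoint c c′ (inj₂ refl) en)
      a′ (there (here refl)) v∈ c′ en = All.lookup ne v∈ (disjoint c c′ (inj₁ refl) en)
      a′ (there (there z∈))  v∈ = a z∈ (there v∈)

  module Simulation {t S₀ X} (R : Routable t S₀ X) where
    open Routable R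

    rnk : V → ℕ
    rnk v = rk (sameRoot S₀ (root (S₀ v))) v

    OnPath : Forest → V → Set
    OnPath S y = ∃ λ v → y ∈ path (S v)

    record Moving (σ : ℕ) (S : Forest) : Set where
      field
        within : ∀ v {y k} → At y k (path (S v)) → At y k (path (S₀ v))
        chain  : ∀ v → Linked (λ x y → A y x ≡ true) (path (S v))
        clock  : ∀ v → busy (S v) ≡ true → wait (S v) + length (path (S v)) + σ ≡ suc d + rnk v * 2

    open Moving

    delay-wait : ∀ v → wait (delay S₀ v) ≡ rnk v * 2 + wait (S₀ v)
    delay-wait v = trans (foldl-count (λ u → lt u v && sameRoot S₀ (root (S₀ v)) u) id 2 (wait (S₀ v)))
      (cong (λ k → k * 2 + wait (S₀ v)) (rk-cnt v
        (λ u l → cong (_&& sameRoot S₀ (root (S₀ v)) u) (⇒lt l))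
        (λ u l → cong (_&& sameRoot S₀ (root (S₀ v)) u) (lt-false l))))

    moving-start : Moving 0 (delay S₀)
    moving-start .within v a = a
    moving-start .chain = linked
    moving-start .clock v b rewrite delay-wait v =
      trans (eq′ (rnk v * 2) (wait (S₀ v)) (length (path (S₀ v)))) (cong (_+ rnk v * 2) (level v b))
      where
      eq′ : ∀ r w l → r + w + l + 0 ≡ w + l + r
      eq′ = solve-∀

    moving-step : ∀ σ S → Moving σ S → Moving (suc σ) (λ v → advance (S v))
    moving-step σ S m = record
      { within = λ v → w v (S v) (m .within v)
      ; chain  = λ v → c (S v) (m .chain v)
      ; clock  = λ v → k v (S v) (m .clock v) }
      where
      w : ∀ v p → (∀ {y k} → At y k (path p) → At y k (path (S₀ v))) →
          ∀ {y k} → At y k (path (advance p)) → At y k (path (S₀ v))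
      w v (_ , suc _ , xs)    f a = f a
      w v (_ , zero , x ∷ xs) f a = f (there a)
      c : ∀ p → Linked _ (path p) → Linked _ (path (advance p))
      c (_ , suc _ , xs)    l = l
      c (_ , zero , [])     l = l
      c (_ , zero , x ∷ xs) l = Linked.tail l
      k : ∀ v p → (busy p ≡ true → wait p + length (path p) + σ ≡ suc d + rnk v * 2) →
          busy (advance p) ≡ true →
          wait (advance p) + length (path (advance p)) + suc σ ≡ suc d + rnk v * 2
      k v (_ , suc w , x ∷ xs)    f b = trans (+-suc (w + _) σ) (f refl)
      k v (_ , zero , x ∷ y ∷ ys) f b = trans (+-suc (suc (length ys)) σ) (f refl)

    -- At time σ a packet of rank j sits d + 2j − σ steps from its source.
    disjoint : ∀ {σ S} → Moving σ S → ∀ {v v′ x y x′ y′ z} → Calling (S v) x y →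
      Calling (S v′) x′ y′ → End z x y → End z x′ y′ → v ≡ v′
    disjoint {σ} {S} m {v} {v′} c c′ e e′
      with position (S v) c e | position (S v′) c′ e′
      where
      position : ∀ p {x y z} → Calling p x y → End z x y →
                 ∃ λ k → At z k (path p) × (length (path p) ≡ 1 + k ⊎ length (path p) ≡ 2 + k)
      position _ (calling {rest} refl refl) (inj₁ refl) = suc (length rest) , here , inj₁ refl
      position _ (calling {rest} refl refl) (inj₂ refl) = length rest , there here , inj₂ refl
    ... | k , a , l | k′ , a′ , l′ with share (m .within v a) (m .within v′ a′)
    ... | r , refl = rk-injective v v′ (&&⁺ (on v a) (eq-refl (root (S₀ v))))
          (&&⁺ (on v′ a′) (subst (λ h → eq (root (S₀ v′)) h ≡ true) (sym r) (eq-refl (root (S₀ v′)))))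
          (trans ranks (cong (λ h → rk (sameRoot S₀ h) v′) (sym r)))
      where
      on : ∀ u {z k} → At z k (path (S u)) → busy (S₀ u) ≡ true
      on u a with path (S₀ u) | m .within u a
      ... | _ ∷ _ | _ = refl
      time : ∀ u {x y} → Calling (S u) x y → length (path (S u)) + σ ≡ suc d + rnk u * 2
      time u (calling now ahead) = trans (cong (λ w → w + length (path (S u)) + σ) (sym now))
        (m .clock u (busy⁺ (S u) ahead))
      sameRank : ∀ {l l′ r r′} → (l ≡ 1 + k ⊎ l ≡ 2 + k) → (l′ ≡ 1 + k ⊎ l′ ≡ 2 + k) →
                l + σ ≡ suc d + r * 2 → l′ + σ ≡ suc d + r′ * 2 → r ≡ r′
      sameRank {r = r} {r′} (inj₁ refl) (inj₁ refl) p q = *-cancelʳ-≡ r r′ 2 (+-cancelˡ-≡ (suc d) _ _ (trans (sym p) q))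
      sameRank {r = r} {r′} (inj₂ refl) (inj₂ refl) p q = *-cancelʳ-≡ r r′ 2 (+-cancelˡ-≡ (suc d) _ _ (trans (sym p) q))
      sameRank {r = r} {r′} (inj₁ refl) (inj₂ refl) p q = contradiction
        (+-cancelˡ-≡ (suc d) _ _ (trans (+-suc (suc d) _) (trans (cong suc (sym p)) q))) (odd≢even r r′)
      sameRank {r = r} {r′} (inj₂ refl) (inj₁ refl) p q = contradiction
        (+-cancelˡ-≡ (suc d) _ _ (trans (+-suc (suc d) _) (trans (cong suc (sym q)) p))) (odd≢even r′ r)
      ranks : rnk v ≡ rnk v′
      ranks = sameRank l l′ (time v c) (time v′ c′)

    -- By `clock` a packet is gone after d + 1 + 2 · rank rounds, which is at most 4 T + 1 and so at
    -- most 5 T.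
    finished : ∀ {S} → Moving (T t * 5) S → ∀ v → path (S v) ≡ []
    finished {S} m v with path (S v) in q | m .clock v | m .within v
    ... | []     | _  | _ = refl
    ... | x ∷ xs | ck | w = ⊥-elim (<-irrefl refl (begin-strict
      T t * 4                                   <⟨ *-monoʳ-< (T t) (n<1+n 4) ⟩
      T t * 5                                   ≤⟨ m≤n+m (T t * 5) (wait (S v) + length xs) ⟩
      wait (S v) + length xs + T t * 5          ≡⟨ cong pred (trans (eq₁ (wait (S v)) (length xs) (T t * 5))
                                                     (ck refl)) ⟩
      d + rnk v * 2                             ≤⟨ +-mono-≤ d≤ (*-monoˡ-≤ 2 (s≤s⁻¹ (≤-trans (rk-< v (&&⁺ on (eq-refl (root (S₀ v))))) (few (root (S₀ v)))))) ⟩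
      T t + T t + T t * 2                       ≡⟨ eq₂ (T t) ⟩
      T t * 4                                   ∎))
      where
      open ≤-Reasoning
      on : busy (S₀ v) ≡ true
      on with path (S₀ v) | w here
      ... | _ ∷ _ | _ = refl
      eq₁ : ∀ a b c → suc (a + b + c) ≡ a + suc b + c
      eq₁ = solve-∀
      eq₂ : ∀ a → a + a + a * 2 ≡ a * 4
      eq₂ = solve-∀

    -- In real time `calls S` precedes `rs`. A node that a packet is just leaving is informed by the
    -- next node of the path, which is still on the path after the packet has advanced.
    covers-step : ∀ {σ S rs} → Moving σ S → Covers rs (λ y → X y ⊎ OnPath S y) →
      Covers (calls S ∷ rs) (λ y → X y ⊎ OnPath (λ v → advance (S v)) y)
    covers-step {S = S} m c .inform I f = c .inform _ λ where
        z (inj₁ x)       → inj₁ (f z (inj₁ x))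
        z (inj₂ (v , z∈)) → informed v (S v) (λ a → last (m .within v a)) (λ c → calls-complete S c) (λ y∈ → f _ (inj₂ (v , y∈))) z∈
      where
      informed : ∀ v p → (∀ {y} → At y 0 (path p) → X y) → (∀ {x y} → Calling p x y → (y , x) ∈ calls S) →
            (∀ {y} → y ∈ path (advance p) → I y) → ∀ {z} → z ∈ path p →
            I z ⊎ ∃ λ u → I u × (u , z) ∈ calls S
      informed v (_ , suc _ , xs)        e c g z∈           = inj₁ (g z∈)
      -- A packet that vanishes now has arrived at its source, which belongs to X.
      informed v (_ , zero , x ∷ [])     e c g (here refl)  = inj₁ (f x (inj₁ (e here)))
      informed v (_ , zero , x ∷ y ∷ ys) e c g (here refl)  = inj₂ (y , g (here refl) , c (calling refl refl))
      informed v (_ , zero , x ∷ y ∷ ys) e c g (there z∈)   = inj₁ (g z∈)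

  opaque
    unfolding route

    route-plan : ∀ {t S X out} {Z : V → Set} → Routable t S X → Plan out Z →
      (∀ z → Z z → X z ⊎ ∃ λ v → z ∈ path (S v)) →
      Plan (route t S out) X × proj₁ (route t S out) ≡ T t * 5 + proj₁ out
    route-plan {t} {S₀} {X} {out} {Z} R plan f =
      conclude (times (T t) (λ s → step (step (step (step (step s))))) (delay S₀ , out))
        (subst (λ j → At-round (j * 5) (times (T t) (λ s → step (step (step (step (step s))))) (delay S₀ , out)))
          (+-identityʳ (T t)) (times-induction (λ j → At-round (j * 5))
          (λ j s r → advances _ _ (advances _ _ (advances _ _ (advances _ _ (advances _ _ r))))) (T t) initial))
      where
      open Simulation R
      open Plan
      At-round : ℕ → Forest × Output → Set₁
      At-round σ (S , out′) =
        Moving σ S × Plan out′ (λ y → X y ⊎ OnPath S y) × proj₁ out′ ≡ σ + proj₁ out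

      initial : At-round 0 (delay S₀ , out)
      initial = moving-start , record
        { covers = covering λ I g → plan .covers .inform I λ z Zz → g z (f z Zz)
        ; rounds = plan .rounds ; length≡ = plan .length≡ } , refl

      advances : ∀ σ s → At-round σ s → At-round (suc σ) (step s)
      advances σ (S , k , rs) (m , p , e) = moving-step σ S m , record
        { covers  = covers-step m (p .covers)
        ; rounds  = calls-round S
            (λ {v} c → head-edge (S v) c (Moving.chain m v)) (disjoint m) ∷ p .rounds
        ; length≡ = cong suc (p .length≡) } , cong suc e
        where
        head-edge : ∀ p {x y} → Calling p x y → Linked (λ x y → A y x ≡ true) (path p) → A y x ≡ true
        head-edge _ (calling refl refl) (a ∷ _) = a

      conclude : ∀ s → At-round (T t * 5) s →
                 Plan (proj₂ s) X × proj₁ (proj₂ s) ≡ T t * 5 + proj₁ out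
      conclude (S , out′) (m , p , e) = record
        { covers = covering λ I g → p .covers .inform I λ where
            z (inj₁ x)        → g z x
            z (inj₂ (v , z∈)) → contradiction (subst (z ∈_) (finished m v) z∈) λ ()
        ; rounds = p .rounds ; length≡ = p .length≡ } , e

-- Packing disjoint hubs

module Packs (G : Graph)
             (A : Fin (order G) → Fin (order G) → Bool) (A-adj : ∀ u v → A u v ≡ true → Adj G u v) where
  private
    n = order G
  open Algorithm n
  open Search n
  open Search-trees n
  open Routing G A A-adj

  opaque
    unfolding onPath

    onPath-sound : ∀ t y p → onPath t y p ≡ true → y ∈ p
    onPath-sound t y p = proj₁ (times-induction (λ _ s → Sound s)
      (λ _ s i → pop _ (pop _ (pop s i))) (T t) {0} {false , p} ((λ ()) , λ m → m))
      where
      Sound : Bool × List V → Set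
      Sound s = (proj₁ s ≡ true → y ∈ p) × (∀ {x} → x ∈ proj₂ s → x ∈ p)
      pop : ∀ s → Sound s → Sound (popEq y s)
      pop (b , [])     i       = i
      pop (b , x ∷ xs) (f , g) = (λ e → go (||⁻ {b} e)) , g ∘ there
        where
        go : b ≡ true ⊎ eq x y ≡ true → y ∈ p
        go (inj₁ e) = f e
        go (inj₂ e) = g (here (sym (eq⇒ e)))

    onPath-complete : ∀ t {y p} → length p ≤ T t * 3 → y ∈ p → onPath t y p ≡ true
    onPath-complete t {y} {p} l m = conclude _
      (times-induction (λ j → Complete (j * 3))
        (λ _ s i → pop (pop (pop i))) (T t) {0} {false , p} (inj₂ (m , ≤-reflexive (+-identityʳ _))))
      where
      Complete : ℕ → Bool × List V → Set
      Complete j s = proj₁ s ≡ true ⊎ (y ∈ proj₂ s × length (proj₂ s) + j ≤ length p)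
      pop : ∀ {j s} → Complete j s → Complete (suc j) (popEq y s)
      pop {s = b , []}     (inj₁ e) = inj₁ e
      pop {s = b , x ∷ xs} (inj₁ e) = inj₁ (||⁺ˡ e)
      pop {s = b , x ∷ xs} (inj₂ (here refl , _)) = inj₁ (||⁺ʳ {b} (eq-refl x))
      pop {j} {s = b , x ∷ xs} (inj₂ (there m , l)) =
        inj₂ (m , ≤-trans (≤-reflexive (+-suc (length xs) j)) l)
      conclude : ∀ s → Complete ((T t + 0) * 3) s → proj₁ s ≡ true
      conclude (b , _)      (inj₁ e)       = e
      conclude (b , x ∷ xs) (inj₂ (_ , l′)) = contradiction
        (≤-trans (s≤s (m≤n+m _ (length xs))) (≤-trans l′ (≤-trans l
          (≤-reflexive (cong (_* 3) (sym (+-identityʳ (T t)))))))) (<-irrefl refl)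

  open Growth using (Grown)
  open Grown

  opaque
    unfolding ball

    ball-grown : ∀ t rem v → Grown A (free rem) (λ u → eq u v && free rem u) (T t + T t) (ball A t rem v)
    ball-grown t rem v = Growth.bfs₂-grown A (free rem) _ t

  record BallPath (t : V) (rem : Subset) (v : V) (u : V) : Set where
    field
      tokenless : rem v ≡ false
      root≡     : root (ball A t rem v u) ≡ v
      up        : Growth.Up A (free rem) (λ u → eq u v && free rem u)
                    (ball A t rem v) v (path (ball A t rem v u))
      starts    : u ∈ path (ball A t rem v u)
      total     : wait (ball A t rem v u) + length (path (ball A t rem v u)) ≡ suc (T t + T t)
      clear     : ∀ {y} → y ∈ path (ball A t rem v u) → rem y ≡ false

  tree : ∀ t rem v u → busy (ball A t rem v u) ≡ true → BallPath t rem v u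
  tree t rem v u b with busy⁻ (ball A t rem v u) b
  ... | x , xs , q with ball-grown t rem v .up u q
  ... | refl , p , l = record
    { tokenless = neg⁻ free-v
    ; root≡     = root≡v
    ; up        = up′
    ; starts    = subst (u ∈_) (sym q) (here refl)
    ; total     = trans (cong (wait (ball A t rem v u) +_) (cong length q)) l
    ; clear     = λ m → clear′ (up-ok up′ m) }
    where
    open Growth A (free rem) (λ u → eq u v && free rem u) using (up-src; up-ok; Up)
    root≡v : root (ball A t rem v u) ≡ v
    root≡v = eq⇒ (proj₁ (&&⁻ (up-src p)))
    free-v : free rem v ≡ true
    free-v = subst (λ w → free rem w ≡ true) root≡v (proj₂ (&&⁻ {eq (root (ball A t rem v u)) v} (up-src p)))
    up′ : Up (ball A t rem v) v (path (ball A t rem v u))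
    up′ = subst₂ (Up (ball A t rem v)) root≡v (sym q) p
    clear′ : ∀ {y} → y ≡ v ⊎ free rem y ≡ true → rem y ≡ false
    clear′ (inj₁ refl) = neg⁻ free-v
    clear′ (inj₂ o)    = neg⁻ o

  up-linked : ∀ {ok src F ρ xs} → Growth.Up A ok src F ρ xs → Linked (λ x y → A y x ≡ true) xs
  up-linked (Growth.source _ _ _)   = [-]
  up-linked (Growth.link e _ _ _ p) = e ∷ up-linked p

  up-last : ∀ {ok src F ρ xs y} → Growth.Up A ok src F ρ xs → At y 0 xs → y ≡ ρ
  up-last (Growth.source _ _ _)   here      = refl
  up-last (Growth.link _ _ _ _ p) (there a) = up-last p a

  -- A walk through nodes that are still free was available before, too.
  ball-shrinks : ∀ t {rem rem′} v → (∀ y → rem y ≡ true → rem′ y ≡ true) →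
    ∀ u → busy (ball A t rem′ v u) ≡ true → busy (ball A t rem v u) ≡ true
  ball-shrinks t {rem} {rem′} v sub u b with busy⁻ (ball A t rem′ v u) b
  ... | x , xs , q with ball-grown t rem′ v .up u q
  ... | refl , p , l = ball-grown t rem v .complete (length xs)
    (s≤s⁻¹ (≤-trans (m≤n+m _ _) (≤-reflexive l)))
    (let (e , f) = &&⁻ {eq (root (ball A t rem′ v u)) v} (Growth.up-src A _ _ p) in &&⁺ e (shrink _ f))
    (walk-mono shrink (Growth.up-walk A _ _ p))
    where
    shrink : ∀ y → free rem′ y ≡ true → free rem y ≡ true
    shrink y f = neg⁺ (refute λ e → true≢false (sub y e) (neg⁻ f))

  module Packing-invariant (r t : V) (act : Subset) where

    -- By `self` and `inside` a token that has been served is itself removed, so no later hub can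
    -- claim it again.
    record Packed (s : Packing) : Set where
      rem = proj₁ s
      S = proj₁ (proj₂ s)
      hubs = proj₂ (proj₂ s)
      field
        origin   : rem r ≡ true
        inside   : ∀ v {y} → y ∈ path (S v) → rem y ≡ true
        covered  : ∀ y → rem y ≡ true → y ≡ r ⊎ ∃ λ v → y ∈ path (S v)
        tokens   : ∀ v → busy (S v) ≡ true → act v ≡ true
        self     : ∀ v → busy (S v) ≡ true → v ∈ path (S v)
        hub      : ∀ v → busy (S v) ≡ true → root (S v) ∈ path (S v)
        linked   : ∀ v → Linked (λ x y → A y x ≡ true) (path (S v))
        level    : ∀ v → busy (S v) ≡ true → wait (S v) + length (path (S v)) ≡ suc (T t + T t)
        share    : ∀ {v v′ y k k′} → At y k (path (S v)) → At y k′ (path (S v′)) →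
                   root (S v) ≡ root (S v′) × k ≡ k′
        last     : ∀ {v y} → At y 0 (path (S v)) → hubs y ≡ true
        hub-rem  : ∀ h → hubs h ≡ true → rem h ≡ true
        few      : ∀ h → cnt (sameRoot S h) ≤ suc (T t)
        many     : ∀ h → hubs h ≡ true → suc (T t) ≤ cnt (sameRoot S h)

    open Packed

    initially : Packed ((λ v → eq v r) , none , (λ _ → false))
    initially = record
      { origin = eq-refl r ; inside = λ _ () ; covered = λ y e → inj₁ (eq⇒ e)
      ; tokens = λ _ () ; self = λ _ () ; hub = λ _ () ; linked = λ _ → [] ; level = λ _ ()
      ; share = λ () ; last = λ () ; hub-rem = λ _ ()
      ; few = λ h → ≤-trans (≤-reflexive (cnt-none {P = sameRoot none h} λ _ → refl)) z≤n ; many = λ _ () }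

    module Claim (s : Packing) (p : Packed s) (v : V) where
      private
        rem₀ = rem p
        F = ball A t rem₀ v

      sel : Subset
      sel u = act u && busy (F u)

      D : Subset
      D = chosen t sel

      D⇒sel : ∀ {u} → D u ≡ true → sel u ≡ true
      D⇒sel {u} e = proj₁ (&&⁻ {sel u} e)

      D⇒path : ∀ {u} → D u ≡ true → BallPath t rem₀ v u
      D⇒path {u} e = tree t rem₀ v u (proj₂ (&&⁻ {act u} (D⇒sel e)))

      cnt-D : cnt D ≡ suc (T t) ⊓ cnt sel
      cnt-D = cnt-first (suc (T t))
        (λ u e → D⇒sel e , s≤s (subst (_≤ T t) (rank≡ sel u) (exceeds-false⇒ t (neg⁻ (proj₂ (&&⁻ {sel u} e))))))
        (λ u e l → &&⁺ e (neg⁺ (⇒exceeds-false t (subst (_≤ T t) (sym (rank≡ sel u)) (s≤s⁻¹ l)))))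

      module _ (big : exceeds (count sel) t ≡ true) where
        new : Packing
        new = (λ y → rem₀ y || exists (λ u → D u && onPath t y (path (F u)))) ,
              (λ u → if D u then F u else S p u) , (λ u → hubs p u || eq u v)

        cnt-D≡ : cnt D ≡ suc (T t)
        cnt-D≡ = trans cnt-D (m≤n⇒m⊓n≡m (subst (T t <_) (count≡ sel) (exceeds⇒ t big)))

        some : ∃ λ u → D u ≡ true
        some = let (f , sat , _) = elements D in
               f (subst Fin (sym cnt-D≡) zero) , sat _

        v-free : rem₀ v ≡ false
        v-free = BallPath.tokenless (D⇒path (proj₂ some))

        marked : ∀ {u y} → D u ≡ true → y ∈ path (F u) → proj₁ new y ≡ true
        marked {u} {y} e m = ||⁺ʳ {rem₀ y} (exists⁺ _ u (&&⁺ e (onPath-complete t bound m)))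
          where
          bound : length (path (F u)) ≤ T t * 3
          bound = begin
            length (path (F u))               ≤⟨ m≤n+m _ (wait (F u)) ⟩
            wait (F u) + length (path (F u))  ≡⟨ BallPath.total (D⇒path e) ⟩
            suc (T t + T t)                   ≤⟨ +-monoˡ-≤ (T t + T t) (s≤s (z≤n {toℕ t})) ⟩
            T t + (T t + T t)                 ≡⟨ eq₃ (T t) ⟩
            T t * 3                           ∎
            where
            open ≤-Reasoning
            eq₃ : ∀ a → a + (a + a) ≡ a * 3
            eq₃ = solve-∀

        grows : ∀ y → rem₀ y ≡ true → proj₁ new y ≡ true
        grows y e = ||⁺ˡ e

        old : ∀ {u} → busy (S p u) ≡ true → D u ≡ false
        old {u} b = refute λ e → let q = D⇒path e in true≢false
          (inside p u (self p u b)) (BallPath.clear q (BallPath.starts q))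

        S′ : Forest
        S′ = proj₁ (proj₂ new)

        by-age : ∀ {ℓ} (Pr : Packet → Set ℓ) u → (D u ≡ true → Pr (F u)) →
                 (D u ≡ false → Pr (S p u)) → Pr (S′ u)
        by-age Pr u = if-elim Pr (D u)

        S′-new : ∀ {u} → D u ≡ true → S′ u ≡ F u
        S′-new {u} e = by-age (_≡ F u) u (λ _ → refl) (λ e′ → true≢false e e′)

        S′-old : ∀ {u} → D u ≡ false → S′ u ≡ S p u
        S′-old {u} e = by-age (_≡ S p u) u (λ e′ → true≢false e′ e) (λ _ → refl)

        D-busy : ∀ {u} → D u ≡ true → busy (F u) ≡ true
        D-busy {u} e = proj₂ (&&⁻ {act u} (D⇒sel e))

        climb : ∀ {u} (e : D u ≡ true) →
          Growth.Up A (free rem₀) (λ w → eq w v && free rem₀ w) F v (path (F u))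
        climb e = BallPath.up (D⇒path e)

        -- New paths avoid the removed nodes, old ones consist of them.
        clash : ∀ {C : Set} {a b y} → D a ≡ true → y ∈ path (F a) → y ∈ path (S p b) → C
        clash e m m′ = true≢false (inside p _ m′) (BallPath.clear (D⇒path e) m)

        share′ : ∀ {a b y k k′} → At y k (path (S′ a)) → At y k′ (path (S′ b)) →
                 root (S′ a) ≡ root (S′ b) × k ≡ k′
        share′ {a} {b} {y} {k} {k′} = by-age
          (λ q → At y k (path q) → At y k′ (path (S′ b)) → root q ≡ root (S′ b) × k ≡ k′) a
          (λ e → by-age (λ q → At y k (path (F a)) → At y k′ (path q) → root (F a) ≡ root q × k ≡ k′) b
            (λ e′ m m′ → trans (BallPath.root≡ (D⇒path e)) (sym (BallPath.root≡ (D⇒path e′))) ,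
              cong pred (trans (sym (proj₁ (proj₂ (Growth.up-at A _ _ (climb e) m))))
                               (proj₁ (proj₂ (Growth.up-at A _ _ (climb e′) m′)))))
            (λ e′ m m′ → clash e (At⇒∈ m) (At⇒∈ m′)))
          (λ e → by-age (λ q → At y k (path (S p a)) → At y k′ (path q) → root (S p a) ≡ root q × k ≡ k′) b
            (λ e′ m m′ → clash e′ (At⇒∈ m′) (At⇒∈ m))
            (λ e′ → share p))

        new-root : ∀ {u} → sameRoot S′ v u ≡ true → D u ≡ true
        new-root {u} = by-age (λ q → busy q && eq (root q) v ≡ true → D u ≡ true) u
          (λ e _ → e)
          (λ e b → let (b₁ , b₂) = &&⁻ {busy (S p u)} b in true≢false
            (inside p u (subst (_∈ path (S p u)) (eq⇒ b₂) (hub p u b₁))) v-free)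

        few′ : ∀ h → cnt (sameRoot S′ h) ≤ suc (T t)
        few′ h with dichotomy (eq h v)
        ... | inj₁ e = subst (λ h → cnt (sameRoot S′ h) ≤ suc (T t)) (sym (eq⇒ {h} {v} e))
          (≤-trans (cnt-mono (λ u → new-root {u})) (≤-reflexive cnt-D≡))
        ... | inj₂ ne = ≤-trans (cnt-mono (λ u → by-age
          (λ q → busy q && eq (root q) h ≡ true → sameRoot (S p) h u ≡ true) u
          (λ e b → true≢false (subst (λ w → eq w v ≡ true)
            (trans (sym (BallPath.root≡ (D⇒path {u} e))) (eq⇒ (proj₂ (&&⁻ {busy (F u)} b)))) (eq-refl v)) ne)
          (λ _ b → b))) (few p h)

        many′ : ∀ h → hubs p h || eq h v ≡ true → suc (T t) ≤ cnt (sameRoot S′ h)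
        many′ h e with ||⁻ {hubs p h} e
        ... | inj₁ o = ≤-trans (many p h o) (cnt-mono λ u b →
          subst (λ q → busy q && eq (root q) h ≡ true)
            (sym (S′-old {u} (old {u} (proj₁ (&&⁻ {busy (S p u)} b))))) b)
        ... | inj₂ i = subst (λ h → suc (T t) ≤ cnt (sameRoot S′ h)) (sym (eq⇒ {h} {v} i))
          (≤-trans (≤-reflexive (sym cnt-D≡)) (cnt-mono λ u e →
            subst (λ q → busy q && eq (root q) v ≡ true) (sym (S′-new {u} e))
              (&&⁺ (D-busy {u} e) (subst (λ w → eq w v ≡ true) (sym (BallPath.root≡ (D⇒path {u} e))) (eq-refl v)))))

        packed : Packed new
        packed = record
          { origin  = grows r (origin p)
          ; inside  = λ u {y} → by-age (λ q → y ∈ path q → proj₁ new y ≡ true) u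
                        (λ e m → marked {u} e m) (λ e m → grows y (inside p u m))
          ; covered = covered′
          ; tokens  = λ u → by-age (λ q → busy q ≡ true → act u ≡ true) u
                        (λ e _ → proj₁ (&&⁻ {act u} (D⇒sel e))) (λ _ → tokens p u)
          ; self    = λ u → by-age (λ q → busy q ≡ true → u ∈ path q) u
                        (λ e b → BallPath.starts (D⇒path {u} e)) (λ _ → self p u)
          ; hub     = λ u → by-age (λ q → busy q ≡ true → root q ∈ path q) u
                        (λ e b → subst (_∈ path (F u)) (sym (BallPath.root≡ (D⇒path {u} e)))
                                   (Growth.up-source A _ _ (climb {u} e))) (λ _ → hub p u)
          ; linked  = λ u → by-age (λ q → Linked _ (path q)) u
                        (λ e → up-linked (climb {u} e)) (λ _ → linked p u)
          ; level   = λ u → by-age (λ q → busy q ≡ true → wait q + length (path q) ≡ suc (T t + T t)) u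
                        (λ e _ → BallPath.total (D⇒path {u} e)) (λ _ → level p u)
          ; share   = share′
          ; last    = λ {u} {y} → by-age (λ q → At y 0 (path q) → proj₂ (proj₂ new) y ≡ true) u
                        (λ e a → ||⁺ʳ {hubs p y} (subst (λ w → eq w v ≡ true) (sym (up-last (climb {u} e) a)) (eq-refl v)))
                        (λ _ a → ||⁺ˡ (last p a))
          ; hub-rem = λ h e → hub-rem′ h (||⁻ {hubs p h} e)
          ; few     = few′
          ; many    = many′
          }
          where
          covered′ : ∀ y → proj₁ new y ≡ true → y ≡ r ⊎ ∃ λ u → y ∈ path (S′ u)
          covered′ y e with ||⁻ {rem₀ y} e
          ... | inj₂ x with exists⁻ _ x
          ... | u , f = inj₂ (u , subst (λ q → y ∈ path q) (sym (S′-new {u} (proj₁ (&&⁻ {D u} f))))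
                                    (onPath-sound t y (path (F u)) (proj₂ (&&⁻ {D u} f))))
          covered′ y e | inj₁ o with covered p y o
          ... | inj₁ y≡r     = inj₁ y≡r
          ... | inj₂ (u , m) = inj₂ (u , subst (λ q → y ∈ path q) (sym (S′-old {u} (old {u} (nonempty u m)))) m)
            where
            nonempty : ∀ u {y} → y ∈ path (S p u) → busy (S p u) ≡ true
            nonempty u m with path (S p u)
            ... | _ ∷ _ = refl
          hub-rem′ : ∀ h → hubs p h ≡ true ⊎ eq h v ≡ true → proj₁ new h ≡ true
          hub-rem′ h (inj₁ o) = grows h (hub-rem p h o)
          hub-rem′ h (inj₂ i) = subst (λ h → proj₁ new h ≡ true) (sym (eq⇒ {h} {v} i))
            (marked (proj₂ some) (Growth.up-source A _ _ (climb (proj₂ some))))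

    pack₁-packed : ∀ s v → Packed s → Packed (pack₁ A t act s v)
    pack₁-packed s v p = if-elim Packed (exceeds (count (Claim.sel s p v)) t)
      (Claim.packed s p v) (λ _ → p)

    pack₁-grows : ∀ s v → Packed s → ∀ y → proj₁ s y ≡ true → proj₁ (pack₁ A t act s v) y ≡ true
    pack₁-grows s v p y e = if-elim (λ (s′ : Packing) → proj₁ s′ y ≡ true) (exceeds (count (Claim.sel s p v)) t)
      (λ big → Claim.grows s p v big y e) (λ _ → e)

    Crowd : Subset → V → ℕ
    Crowd rem v = cnt (λ u → act u && busy (ball A t rem v u))

    -- The outcome of inspecting v: a crowded ball makes v a hub and thereby removes it, and a
    -- sparse ball stays sparse.
    Sparse : V → Packing → Set
    Sparse v s = proj₁ s v ≡ true ⊎ Crowd (proj₁ s) v ≤ T t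

    sparse-new : ∀ s v → Packed s → Sparse v (pack₁ A t act s v)
    sparse-new s v p = if-elim (Sparse v) (exceeds (count (Claim.sel s p v)) t)
      (λ big → inj₁ (Claim.marked s p v big (proj₂ (Claim.some s p v big))
        (Growth.up-source A _ _ (Claim.climb s p v big (proj₂ (Claim.some s p v big))))))
      (λ small → inj₂ (subst (_≤ T t) (count≡ (Claim.sel s p v)) (exceeds-false⇒ t small)))

    sparse-old : ∀ s v u → Packed s → Sparse v s → Sparse v (pack₁ A t act s u)
    sparse-old s v u p (inj₁ e) = inj₁ (pack₁-grows s u p v e)
    sparse-old s v u p (inj₂ l) = inj₂ (≤-trans (cnt-mono λ x b →
      let (a , b′) = &&⁻ {act x} b in
      &&⁺ a (ball-shrinks t v (pack₁-grows s u p) x b′)) l)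

    opaque
      unfolding pack

      pack-packed : Packed (pack A r t act)
      pack-packed = foldV-invariant Packed pack₁-packed initially

      pack-sparse : ∀ v → Sparse v (pack A r t act)
      pack-sparse = foldV-reaches Packed Sparse pack₁-packed sparse-new
        (λ s v u → sparse-old s v u) initially

    open Packed

    pack-routable : Routable t (S pack-packed) (λ y → hubs pack-packed y ≡ true)
    pack-routable = record
      { d = T t + T t ; d≤ = ≤-refl ; linked = linked pack-packed ; level = level pack-packed
      ; share = share pack-packed ; last = last pack-packed ; few = few pack-packed }

    -- Each hub is the root of at least T + 1 tokens, and a token has only one root.
    fewer-hubs : cnt (hubs pack-packed) * suc (T t) ≤ cnt act
    fewer-hubs = cnt-fibres-≥ (suc (T t)) (λ x h → sameRoot (S pack-packed) h x) (many pack-packed)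
      (λ x h _ b → tokens pack-packed x (proj₁ (&&⁻ b)))
      (λ x h h′ b b′ → trans (sym (eq⇒ (proj₂ (&&⁻ {busy (S pack-packed x)} b))))
                             (eq⇒ (proj₂ (&&⁻ {busy (S pack-packed x)} b′))))

-- Leaders, their cells and their spokes

module Leading (G : Graph)
               (A : Fin (order G) → Fin (order G) → Bool) (A-adj : ∀ u v → A u v ≡ true → Adj G u v)
               (A-sym : ∀ u v → A u v ≡ true → A v u ≡ true) where
  private
    n = order G
  open Algorithm n
  open Search n
  open Search-trees n
  open Routing G A A-adj
  open Packs G A A-adj
  open Growth using (Grown)
  open Grown

  module _ (t : V) (act rem : Subset)
           (sparse : ∀ v → rem v ≡ true ⊎ cnt (λ u → act u && busy (ball A t rem v u)) ≤ T t) where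

    private
      F : Subset → Forest
      F L = bfs₂ A (free rem) t L

      F-grown : ∀ L → Grown A (free rem) L (T t + T t) (F L)
      F-grown L = Growth.bfs₂-grown A (free rem) L t

      Path : ℕ → V → V → Set
      Path = Walk A (free rem)

    record Led (L : Subset) : Set where
      field
        tokens    : ∀ x → L x ≡ true → act x ≡ true
        outside   : ∀ x → L x ≡ true → free rem x ≡ true
        separated : ∀ {x y j} → L x ≡ true → L y ≡ true → j ≤ T t + T t → Path j x y → x ≡ y

    open Led

    F-mono : ∀ {L L′} → (∀ x → L x ≡ true → L′ x ≡ true) →
             ∀ u → busy (F L u) ≡ true → busy (F L′ u) ≡ true
    F-mono {L} {L′} sub u b with Growth.grown-walk A _ L (F-grown L) u b
    ... | s , j , j≤ , w = F-grown L′ .complete j j≤ (sub _ s) w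

    lead₁-led : ∀ L u → Led L → Led (lead₁ A t act rem L u)
    lead₁-led L u led = if-elim Led (act u && free rem u && neg (busy (F L u))) new (λ _ → led)
      where
      new : act u && free rem u && neg (busy (F L u)) ≡ true → Led (λ x → L x || eq x u)
      new c = record
        { tokens = λ x e → tokens′ x (||⁻ {L x} e)
        ; outside = λ x e → outside′ x (||⁻ {L x} e)
        ; separated = λ {x} {y} e e′ → separated′ (||⁻ {L x} e) (||⁻ {L y} e′) }
        where
        c₁ = &&⁻ {act u} c
        c₂ = &&⁻ {free rem u} (proj₂ c₁)
        tokens′ : ∀ x → L x ≡ true ⊎ eq x u ≡ true → act x ≡ true
        tokens′ x (inj₁ l) = tokens led x l
        tokens′ x (inj₂ e) = subst (λ y → act y ≡ true) (sym (eq⇒ e)) (proj₁ c₁)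
        outside′ : ∀ x → L x ≡ true ⊎ eq x u ≡ true → free rem x ≡ true
        outside′ x (inj₁ l) = outside led x l
        outside′ x (inj₂ e) = subst (λ y → free rem y ≡ true) (sym (eq⇒ e)) (proj₁ c₂)
        far : ∀ {x j} {C : Set} → L x ≡ true → j ≤ T t + T t → Path j x u → C
        far l j≤ w = true≢false (F-grown L .complete _ j≤ l w) (neg⁻ (proj₂ c₂))
        separated′ : ∀ {x y j} → L x ≡ true ⊎ eq x u ≡ true → L y ≡ true ⊎ eq y u ≡ true →
                     j ≤ T t + T t → Path j x y → x ≡ y
        separated′ (inj₁ l) (inj₁ l′) j≤ w = separated led l l′ j≤ w
        separated′ (inj₁ l) (inj₂ e′) j≤ w with eq⇒ e′
        ... | refl = far l j≤ w
        separated′ (inj₂ e) (inj₁ l′) j≤ w with eq⇒ e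
        ... | refl = far l′ j≤ (reverseʷ A-sym (proj₁ c₂) w)
        separated′ (inj₂ e) (inj₂ e′) j≤ w = trans (eq⇒ e) (sym (eq⇒ e′))

    L : Subset
    L = leaders A t act rem

    opaque
      unfolding leaders

      leaders-led : Led L
      leaders-led = foldV-invariant Led lead₁-led
        (record { tokens = λ _ () ; outside = λ _ () ; separated = λ () })

      -- Maximality: in its own round u is either close to a leader or becomes one, and leaders are
      -- never dropped.
      leaders-reach : ∀ u → act u ≡ true → free rem u ≡ true → busy (F L u) ≡ true
      leaders-reach = foldV-reaches (λ _ → ⊤)
        (λ u L → act u ≡ true → free rem u ≡ true → busy (F L u) ≡ true)
        (λ _ _ _ → tt) (λ L u _ → new L u)
        (λ L u v _ i a f → F-mono (sub L v) u (i a f)) tt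
        where
        sub : ∀ L v x → L x ≡ true → lead₁ A t act rem L v x ≡ true
        sub L v x l = if-elim (λ (M : Subset) → M x ≡ true) (act v && free rem v && neg (busy (F L v)))
          {λ z → L z || eq z v} {L}
          (λ _ → ||⁺ˡ l) (λ _ → l)
        new : ∀ L u → act u ≡ true → free rem u ≡ true → busy (F (lead₁ A t act rem L u) u) ≡ true
        new L u a f = if-elim (λ M → busy (F M u) ≡ true) (act u && free rem u && neg (busy (F L u)))
          (λ _ → F-grown _ .complete 0 z≤n (||⁺ʳ {L u} (eq-refl u)) nil)
          (λ c → neg-false (refute λ e → true≢false (&&⁺ a (&&⁺ f e)) c))

    S₃ : Forest
    S₃ = cells A t act rem L

    S₃-elim : ∀ {ℓ} (Pr : Packet → Set ℓ) u → (act u ≡ true → Pr (F L u)) → Pr (none u) → Pr (S₃ u)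
    S₃-elim Pr u f g = if-elim Pr (act u) f (λ _ → g)

    cells-tokens : ∀ u → act u ≡ true → rem u ≡ true ⊎ u ∈ path (S₃ u)
    cells-tokens u a with dichotomy (rem u)
    ... | inj₁ e = inj₁ e
    ... | inj₂ e = inj₂ (if-elim (λ q → u ∈ path q) (act u) (λ _ → on) (λ a′ → true≢false a a′))
      where
      on : u ∈ path (F L u)
      on with busy⁻ (F L u) (leaders-reach u a (neg⁺ e))
      ... | x , xs , q with F-grown L .up u q
      ... | refl , _ = subst (u ∈_) (sym q) (here refl)

    -- The tokens in the cell of h lie in the ball around h, which is sparse. A removed h has no
    -- cell, since leaders are free.
    cells-few : ∀ h → cnt (sameRoot S₃ h) ≤ suc (T t)
    cells-few h with sparse h
    ... | inj₁ e = ≤-trans (≤-reflexive (cnt-none λ u → refute (S₃-elim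
      (λ q → ¬ (busy q && eq (root q) h ≡ true)) u (λ _ b → true≢false e (neg⁻ (lead-h u b))) λ ()))) z≤n
      where
      lead-h : ∀ u → busy (F L u) && eq (root (F L u)) h ≡ true → free rem h ≡ true
      lead-h u b = let (b₁ , b₂) = &&⁻ {busy (F L u)} b in
        subst (λ x → free rem x ≡ true) (eq⇒ b₂)
          (outside leaders-led _ (proj₁ (Growth.grown-walk A _ L (F-grown L) u b₁)))
    ... | inj₂ l = ≤-trans (cnt-mono λ u → S₃-elim
      (λ q → busy q && eq (root q) h ≡ true → act u && busy (ball A t rem h u) ≡ true) u
      (λ a b → &&⁺ a (in-ball u b)) λ ()) (m≤n⇒m≤1+n l)
      where
      in-ball : ∀ u → busy (F L u) && eq (root (F L u)) h ≡ true → busy (ball A t rem h u) ≡ true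
      in-ball u b with &&⁻ {busy (F L u)} b
      ... | b₁ , b₂ with Growth.grown-walk A _ L (F-grown L) u b₁
      ... | s , j , j≤ , w with eq⇒ b₂
      ... | refl = ball-grown t rem _ .complete j j≤ (&&⁺ (eq-refl _) (outside leaders-led _ s)) w

    cells-routable : Routable t S₃ (λ y → L y ≡ true)
    cells-routable = record
      { d = T t + T t ; d≤ = ≤-refl
      ; linked = λ u → S₃-elim (λ q → Linked (λ x y → A y x ≡ true) (path q)) u (λ _ → linked′ u) []
      ; level = λ u → S₃-elim (λ q → busy q ≡ true → wait q + length (path q) ≡ suc (T t + T t)) u
          (λ _ b → proj₁ (proj₂ (on-path u b))) λ ()
      ; share = λ {u} {v} {y} {k} {k′} → S₃-elim
          (λ q → At y k (path q) → At y k′ (path (S₃ v)) → root q ≡ root (S₃ v) × k ≡ k′) u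
          (λ _ a → S₃-elim (λ q → At y k′ (path q) → root (F L u) ≡ root q × k ≡ k′) v
            (λ _ → Growth.grown-share A _ L (F-grown L) a) λ ()) λ ()
      ; last = λ {u} {y} → S₃-elim (λ q → At y 0 (path q) → L y ≡ true) u (λ _ → last′ u) λ ()
      ; few = cells-few }
      where
      on-path : ∀ u → busy (F L u) ≡ true →
        Growth.Up A (free rem) L (F L) (root (F L u)) (path (F L u)) ×
        wait (F L u) + length (path (F L u)) ≡ suc (T t + T t) × ∃ λ xs → path (F L u) ≡ u ∷ xs
      on-path u b with busy⁻ (F L u) b
      ... | x , xs , q = Growth.path-∈ A _ L (F-grown L) u (subst (x ∈_) (sym q) (here refl))
      linked′ : ∀ u → Linked (λ x y → A y x ≡ true) (path (F L u))
      linked′ u with dichotomy (busy (F L u))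
      ... | inj₁ b = up-linked (proj₁ (on-path u b))
      ... | inj₂ b with path (F L u)
      ... | [] = []
      last′ : ∀ u {y} → At y 0 (path (F L u)) → L y ≡ true
      last′ u a with Growth.path-∈ A _ L (F-grown L) u (At⇒∈ a)
      ... | p , _ = subst (λ x → L x ≡ true) (sym (up-last p a)) (Growth.up-src A _ L p)

    Fw : V → Forest
    Fw = reach A t rem

    cand : Matrix
    cand = candidates Fw rem L

    opaque
      unfolding reach
      reach-grown : ∀ w → Grown A (free rem) (λ u → eq u w) (T t) (Fw w)
      reach-grown w = Growth.bfs₁-grown A (free rem) _ t

    module Spokes (g : Assignment) (valid : ∀ x w → g x ≡ just w → cand x w ≡ true)
                  (light : ∀ w → cnt (λ x → isAt (g x) w) ≤ T t) where

      S₂ : Forest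
      S₂ = spokes Fw g

      record Spoke (x : V) : Set where
        field
          w     : V
          at-w  : g x ≡ just w
          S≡    : S₂ x ≡ Fw w x
          root≡ : root (S₂ x) ≡ w
          lead  : L x ≡ true
          wheel : rem w ≡ true
          up    : Growth.Up A (free rem) (λ u → eq u w) (Fw w) w (path (S₂ x))
          total : wait (S₂ x) + length (path (S₂ x)) ≡ suc (T t)
          tail  : List V
          path≡ : path (S₂ x) ≡ x ∷ tail

      assigned : ∀ x w → g x ≡ just w → Spoke x
      assigned x w e = record
        { w = w ; at-w = e ; S≡ = S≡ ; root≡ = trans (cong root S≡) r≡ ; lead = proj₁ c₁ ; wheel = proj₁ c₂
        ; up = subst₂ (Growth.Up A (free rem) (λ u → eq u w) (Fw w)) r≡ (sym (cong path S≡)) (proj₁ pw)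
        ; total = trans (cong (λ q → wait q + length (path q)) S≡) (proj₁ (proj₂ pw))
        ; tail = proj₁ (proj₂ (proj₂ pw))
        ; path≡ = trans (cong path S≡) (proj₂ (proj₂ (proj₂ pw))) }
        where
        S≡ : S₂ x ≡ Fw w x
        S≡ = cong (λ m → caseM m (none x) (λ w → Fw w x)) e
        c₁ = &&⁻ {L x} (valid x w e)
        c₂ = &&⁻ {rem w} (proj₂ c₁)
        b : ∃₂ λ y ys → path (Fw w x) ≡ y ∷ ys
        b = busy⁻ (Fw w x) (proj₂ c₂)
        pw = Growth.path-∈ A (free rem) (λ u → eq u w) (reach-grown w) x
          (subst (proj₁ b ∈_) (sym (proj₂ (proj₂ b))) (here refl))
        r≡ : root (Fw w x) ≡ w
        r≡ = eq⇒ (Growth.up-src A _ _ (proj₁ pw))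

      spoke : ∀ x {y} → y ∈ path (S₂ x) → Spoke x
      spoke x m = go (g x) refl m
        where
        go : ∀ m → g x ≡ m → ∀ {y} → y ∈ path (caseM m (none x) (λ w → Fw w x)) → Spoke x
        go (just w) e _ = assigned x w e

      spoke-busy : ∀ x → busy (S₂ x) ≡ true → Spoke x
      spoke-busy x b with busy⁻ (S₂ x) b
      ... | y , ys , q = spoke x (subst (y ∈_) (sym q) (here refl))

      open Spoke

      -- Each removed node has a search of its own, so `grown-share` applies only once the two paths
      -- are known to start at the same `w`.
      share : ∀ {x x′ y k k′} → At y k (path (S₂ x)) → At y k′ (path (S₂ x′)) →
              root (S₂ x) ≡ root (S₂ x′) × k ≡ k′
      share {x} {x′} {y} a a′ = go (Growth.up-ok A _ _ (up s) (At⇒∈ a)) (Growth.up-ok A _ _ (up s′) (At⇒∈ a′))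
        where
        s  = spoke x (At⇒∈ a)
        s′ = spoke x′ (At⇒∈ a′)
        same-wheel : w s ≡ w s′ → root (S₂ x) ≡ root (S₂ x′) × _ ≡ _
        same-wheel e = trans (root≡ s) (trans e (sym (root≡ s′))) ,
          proj₂ (Growth.grown-share A _ _ (reach-grown (w s)) {x} {x′}
            (subst (λ q → At y _ (path q)) (S≡ s) a)
            (subst (λ q → At y _ (path q)) (trans (S≡ s′) (cong (λ v → Fw v x′) (sym e))) a′))
        arm : ∀ {z} (s : Spoke z) → y ∈ path (S₂ z) → ∃ λ j → j ≤ T t × Walk A (free rem) j y z
        arm {z} s m with Growth.up-walk-from A _ _ (up s) m (path≡ s)
        ... | j , j≤ , p = j , ≤-trans j≤ (s≤s⁻¹ (≤-trans (m≤n+m _ (wait (S₂ z)))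
          (≤-reflexive (trans (cong (λ q → wait (S₂ z) + length q) (sym (path≡ s))) (total s))))) , p
        go : y ≡ w s ⊎ free rem y ≡ true → y ≡ w s′ ⊎ free rem y ≡ true →
             root (S₂ x) ≡ root (S₂ x′) × _ ≡ _
        go (inj₁ e) (inj₁ e′) = same-wheel (trans (sym e) e′)
        go (inj₁ e) (inj₂ f′) = true≢false (wheel s) (neg⁻ (subst (λ v → free rem v ≡ true) e f′))
        go (inj₂ f) (inj₁ e′) = true≢false (wheel s′) (neg⁻ (subst (λ v → free rem v ≡ true) e′ f))
        -- Balls of radius T around leaders are disjoint, so x = x′.
        go (inj₂ f) (inj₂ f′) with arm s (At⇒∈ a) | arm s′ (At⇒∈ a′)
        ... | j , j≤ , p | j′ , j′≤ , p′ = same-wheel (just-injective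
          (trans (sym (at-w s)) (trans (cong g x≡x′) (at-w s′))))
          where
          x≡x′ : x ≡ x′
          x≡x′ = separated leaders-led (lead s) (lead s′) (+-mono-≤ j′≤ j≤)
            (reverseʷ A-sym f p ++ʷ p′)

      spokes-routable : Routable t S₂ (λ y → rem y ≡ true)
      spokes-routable = record
        { d = T t ; d≤ = m≤m+n (T t) (T t)
        ; linked = λ x → go x (path (S₂ x)) refl
        ; level = λ x b → total (spoke-busy x b)
        ; share = share
        ; last = λ {x} a → let s = spoke x (At⇒∈ a) in
            subst (λ v → rem v ≡ true) (sym (up-last (up s) a)) (wheel s)
        ; few = λ h → ≤-trans (cnt-mono λ x b → at-h h x b) (m≤n⇒m≤1+n (light h)) }
        where
        go : ∀ x p → path (S₂ x) ≡ p → Linked (λ x y → A y x ≡ true) (path (S₂ x))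
        go x []      q = subst (Linked _) (sym q) []
        go x (y ∷ _) q = up-linked (up (spoke x (subst (y ∈_) (sym q) (here refl))))
        at-h : ∀ h x → sameRoot S₂ h x ≡ true → isAt (g x) h ≡ true
        at-h h x b with &&⁻ {busy (S₂ x)} b
        ... | b₁ , b₂ = let s = spoke-busy x b₁ in
          subst (λ m → isAt m h ≡ true) (sym (at-w s))
            (subst (λ v → eq v h ≡ true) (root≡ s) b₂)

-- Matching leaders to removed nodes

module Matching (n : ℕ) (t : Fin n) (L : Fin n → Bool) (cand : Fin n → Fin n → Bool)
                (cand⇒L : ∀ {x w} → cand x w ≡ true → L x ≡ true) where
  open Algorithm n
  open Search n
  open Search-trees n

  isAt⇒ : ∀ m {w} → isAt m w ≡ true → m ≡ just w
  isAt⇒ (just u) e = cong just (eq⇒ e)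

  ⇒isAt : ∀ {m w} → m ≡ just w → isAt m w ≡ true
  ⇒isAt {w = w} refl = eq-refl w

  record Sound (g : Assignment) : Set where
    field
      valid : ∀ x w → g x ≡ just w → cand x w ≡ true
      light : ∀ w → cnt (λ x → isAt (g x) w) ≤ T t

  open Sound

  Room : Assignment → V → Set
  Room g w = suc (cnt (λ x → isAt (g x) w)) ≤ T t

  update-same : ∀ g x w → update g x w x ≡ just w
  update-same g x w = cong (λ b → if b then just w else g x) (eq-refl x)

  update-other : ∀ g x w {y} → y ≢ x → update g x w y ≡ g y
  update-other g x w {y} ne = cong (λ b → if b then just w else g y) (≢⇒eq-false ne)

  update-load : ∀ g x w v → cnt (λ y → isAt (g y) v) + b2n (eq w v) ≡
                cnt (λ y → isAt (update g x w y) v) + b2n (isAt (g x) v)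
  update-load g x w v = trans
    (cong (λ m → cnt (λ y → isAt (g y) v) + b2n (isAt m v)) (sym (update-same g x w)))
    (cnt-update {P = λ y → isAt (g y) v} {λ y → isAt (update g x w y) v} x
      (λ y ne → cong (λ m → isAt m v) (sym (update-other g x w ne))))

  update-sound : ∀ g x w → Sound g → Room g w → cand x w ≡ true → Sound (update g x w)
  update-sound g x w s r c .valid y v e = if-elim (λ m → m ≡ just v → cand y v ≡ true) (eq y x)
    {just w} {g y} (λ { i refl → subst (λ z → cand z w ≡ true) (sym (eq⇒ i)) c }) (λ _ → s .valid y v) e
  update-sound g x w s r c .light v with dichotomy (eq w v)
  ... | inj₁ e = subst (λ v → cnt (λ y → isAt (update g x w y) v) ≤ T t) (eq⇒ e) (begin
    cnt (λ y → isAt (update g x w y) w)                       ≤⟨ m≤m+n _ _ ⟩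
    cnt (λ y → isAt (update g x w y) w) + b2n (isAt (g x) w)  ≡⟨ update-load g x w w ⟨
    cnt (λ y → isAt (g y) w) + b2n (eq w w)                   ≤⟨ +-monoʳ-≤ _ (b2n≤1 (eq w w)) ⟩
    cnt (λ y → isAt (g y) w) + 1                              ≡⟨ +-comm _ 1 ⟩
    suc (cnt (λ y → isAt (g y) w))                            ≤⟨ r ⟩
    T t                                                       ∎)
    where open ≤-Reasoning
  ... | inj₂ e = begin
    cnt (λ y → isAt (update g x w y) v)                       ≤⟨ m≤m+n _ _ ⟩
    cnt (λ y → isAt (update g x w y) v) + b2n (isAt (g x) v)  ≡⟨ update-load g x w v ⟨
    cnt (λ y → isAt (g y) v) + b2n (eq w v)                   ≡⟨ cong (λ b → cnt (λ y → isAt (g y) v) + b2n b) e ⟩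
    cnt (λ y → isAt (g y) v) + 0                              ≡⟨ +-identityʳ _ ⟩
    cnt (λ y → isAt (g y) v)                                  ≤⟨ s .light v ⟩
    T t                                                       ∎
    where open ≤-Reasoning

  update-room : ∀ g x w w′ → Sound g → isAt (g x) w ≡ true → w′ ≢ w → Room (update g x w′) w
  update-room g x w w′ s e ne = begin
    suc (cnt (λ y → isAt (update g x w′ y) w))                      ≡⟨ +-comm 1 _ ⟩
    cnt (λ y → isAt (update g x w′ y) w) + b2n true                 ≡⟨ cong (λ b → cnt (λ y → isAt (update g x w′ y) w) + b2n b) e ⟨
    cnt (λ y → isAt (update g x w′ y) w) + b2n (isAt (g x) w)       ≡⟨ update-load g x w′ w ⟨
    cnt (λ y → isAt (g y) w) + b2n (eq w′ w)                        ≡⟨ cong (λ b → cnt (λ y → isAt (g y) w) + b2n b) (≢⇒eq-false ne) ⟩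
    cnt (λ y → isAt (g y) w) + 0                                    ≡⟨ +-identityʳ _ ⟩
    cnt (λ y → isAt (g y) w)                                        ≤⟨ s .light w ⟩
    T t                                                             ∎
    where open ≤-Reasoning

  Assigned : Assignment → V → Set
  Assigned g x = ∃ λ w → g x ≡ just w

  update-assigned : ∀ g x w {y} → Assigned g y → Assigned (update g x w) y
  update-assigned g x w {y} a = if-elim (λ m → ∃ λ w → m ≡ just w) (eq y x) (λ _ → w , refl) (λ _ → a)

  -- An alternating path in the order in which `shift` consumes it: the room is at the head, a
  -- candidate of `x₀` at the end.
  data Chain (x₀ : V) (g : Assignment) : List V → Set where
    end  : ∀ {w} → cand x₀ w ≡ true → Chain x₀ g (w ∷ [])
    link : ∀ {w′ w ws} x → movable cand g w w′ x ≡ true → Chain x₀ g (w ∷ ws) → Chain x₀ g (w′ ∷ w ∷ ws)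

  -- The leader that moves sat at w. As w does not occur further on, the remaining links use other
  -- leaders.
  chain-update : ∀ {x₀ g x w} w′ {v ws} → isAt (g x) w ≡ true → All (w ≢_) ws →
                 Chain x₀ g (v ∷ ws) → Chain x₀ (update g x w′) (v ∷ ws)
  chain-update w′ e _ (end c) = end c
  chain-update {g = g} {x} {w} w′ e (ne ∷ nes) (link {v} {u} y m c) =
    link y (subst (λ q → isAt q u && cand y v ≡ true) (sym (update-other g x w′ y≢x)) m)
      (chain-update w′ e nes c)
    where
    y≢x : y ≢ x
    y≢x refl = ne (just-injective (trans (sym (isAt⇒ (g x) e)) (isAt⇒ (g x) (proj₁ (&&⁻ {isAt (g x) u} m)))))

  module Shifting (x₀ : V) (g₀ : Assignment) where

    data Shift : List V × Assignment → Set where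
      done : ∀ {g} → Sound g → (∀ x → Assigned g₀ x → Assigned g x) → Assigned g x₀ → Shift ([] , g)
      moving : ∀ {w ws g} → Sound g → (∀ x → Assigned g₀ x → Assigned g x) → Room g w →
             Chain x₀ g (w ∷ ws) → Unique (w ∷ ws) → Shift (w ∷ ws , g)

    shift-shift : ∀ s → Shift s → Shift (shift cand x₀ s)
    shift-shift ([] , g) i = i
    shift-shift (w′ ∷ [] , g) (moving s a r (end c) _) = done (update-sound g x₀ w′ s r c)
      (λ x b → update-assigned g x₀ w′ (a x b)) (w′ , update-same g x₀ w′)
    shift-shift (w′ ∷ w ∷ ws , g) (moving s a r (link x m c) (ne ∷ u)) =
      move (find (movable cand g w w′)) refl
      where
      move : ∀ f → find (movable cand g w w′) ≡ f →
             Shift (w ∷ ws , caseM f g (λ x → update g x w′))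
      move nothing  e = true≢false m (find-complete _ e x)
      move (just y) e with find-sound (movable cand g w w′) e
      ... | m′ with &&⁻ {isAt (g y) w} m′
      ... | here-w , cd = moving (update-sound g y w′ s r cd) (λ x b → update-assigned g y w′ (a x b))
        (update-room g y w w′ s here-w (All.head ne)) (chain-update w′ here-w (AllPairs.head u) c) u

    shift-length : ∀ s → length (proj₁ (shift cand x₀ s)) ≡ pred (length (proj₁ s))
    shift-length ([] , g)          = refl
    shift-length (_ ∷ [] , g)      = refl
    shift-length (_ ∷ _ ∷ _ , g)   = refl

    shifted : ∀ p → length p ≤ n → Shift (p , g₀) →
      let g = proj₂ (foldV (λ q _ → shift cand x₀ q) (p , g₀)) in
      Sound g × (∀ x → Assigned g₀ x → Assigned g x) × Assigned g x₀
    shifted p l i = conclude _ (iteration Progress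
      (λ j s (i , e) → shift-shift s i , trans (shift-length s) (trans (cong pred e) (pred[m∸n]≡m∸[1+n] (length p) j)))
      (tabulate {n = n} id) {0} {p , g₀} (i , refl))
      where
      Progress : ℕ → List V × Assignment → Set
      Progress j s = Shift s × length (proj₁ s) ≡ length p ∸ j
      conclude : ∀ s → Progress (length (tabulate {n = n} id) + 0) s →
        Sound (proj₂ s) × (∀ x → Assigned g₀ x → Assigned (proj₂ s) x) × Assigned (proj₂ s) x₀
      conclude ([] , g)    (done s a b , _) = s , a , b
      conclude (w ∷ _ , g) (_ , e) = contradiction
        (trans e (m≤n⇒m∸n≡0 (≤-trans l (≤-reflexive (sym (trans (+-identityʳ _) (length-tabulate {n = n} id)))))))
        λ ()

  module Augmenting (g : Assignment) (s : Sound g) (x₀ : V) (lead : L x₀ ≡ true) (idle : g x₀ ≡ nothing) where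

    E : Matrix
    E = exchange cand g

    G : Forest
    G = augmenting cand g x₀

    open Growth E (λ _ → true) (cand x₀)

    G-grown : Grown n G
    G-grown = closure-grown E (cand x₀)

    -- The path stored at a repeated node would have two lengths.
    up-unique : ∀ {ρ xs} → Up G ρ xs → Unique xs
    up-unique (source _ _ _) = [] ∷ []
    up-unique (link {v} {u} {xs} e o r q p) = All.tabulate fresh ∷ up-unique p
      where
      fresh : ∀ {y} → y ∈ u ∷ xs → v ≢ y
      fresh m refl with ∈⇒At m
      ... | k , a = <-irrefl (cong pred (trans (sym (proj₁ (proj₂ (up-at p a)))) (cong length q))) (At-< a)

    up-chain : ∀ {ρ xs} → Up G ρ xs → Chain x₀ g xs
    up-chain (source c _ _)   = end c
    up-chain (link {v} {u} e _ _ _ p) = let (x , m) = exists⁻ (movable cand g u v) e in link x m (up-chain p)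

    target : Subset
    target w = busy (G w) && room t g w

    success : ∀ w → target w ≡ true →
      let g′ = proj₂ (foldV (λ q _ → shift cand x₀ q) (path (G w) , g)) in
      Sound g′ × (∀ x → Assigned g x → Assigned g′ x) × Assigned g′ x₀
    success w e with &&⁻ {busy (G w)} e
    ... | b , r with busy⁻ (G w) b
    ... | y , ys , q with path-∈ G-grown w (subst (y ∈_) (sym q) (here refl))
    ... | p , _ , xs , q′ = Shifting.shifted x₀ g (path (G w)) (unique-length (up-unique p))
      (subst (λ p → Shifting.Shift x₀ g (p , g)) (sym q′)
        (Shifting.moving s (λ _ a → a)
          (subst (λ k → suc k ≤ T t) (count≡ _) (exceeds-false⇒ t (neg⁻ r)))
          (subst (Chain x₀ g) q′ (up-chain p)) (subst Unique q′ (up-unique p))))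

    module _ (f : V → V) (fits : ∀ x → L x ≡ true → cand x (f x) ≡ true)
             (loads : ∀ w → cnt (λ x → L x && eq (f x) w) ≤ T t) where

      reached : Subset
      reached w = busy (G w)

      -- A count as in Hall's theorem. If no reachable node had room, all of them would carry T
      -- leaders. These leaders together with `x₀` are sent by `f` to reachable nodes again, at most
      -- T to each: one leader too many.
      stuck : find target ≢ nothing
      stuck none = <-irrefl refl (begin-strict
        cnt P               <⟨ n<1+n _ ⟩
        suc (cnt P)         ≡⟨ one-more ⟩
        cnt P′              ≤⟨ cnt-fibres-≤ (T t) (λ x w → L x && eq (f x) w) into (λ w _ → loads w) ⟩
        cnt reached * T t   ≤⟨ cnt-fibres-≥ (T t) (λ x w → isAt (g x) w) full
          (λ x w r e → subst (λ m → caseM m false reached ≡ true) (sym (isAt⇒ (g x) e)) r)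
          (λ x w w′ e e′ → just-injective (trans (sym (isAt⇒ (g x) e)) (isAt⇒ (g x) e′))) ⟩
        cnt P               ∎)
        where
        open ≤-Reasoning
        P P′ : Subset
        P x = caseM (g x) false reached
        P′ x = P x || eq x x₀
        one-more : suc (cnt P) ≡ cnt P′
        one-more = trans (+-comm 1 (cnt P)) (trans
          (cong (λ b → cnt P + b2n b) (sym (||⁺ʳ {P x₀} (eq-refl x₀))))
          (trans (cnt-update {P = P} {P′} x₀ λ x ne →
                   trans (sym (or-false (P x))) (cong (P x ||_) (sym (≢⇒eq-false ne))))
            (trans (cong (λ m → cnt P′ + b2n (caseM m false reached)) idle) (+-identityʳ _))))
          where
          or-false : ∀ b → b || false ≡ b
          or-false true  = refl
          or-false false = refl
        full : ∀ w → reached w ≡ true → T t ≤ cnt (λ x → isAt (g x) w)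
        full w r = s≤s⁻¹ (subst (λ k → T t < suc k) (count≡ _) (exceeds⇒ t
          (neg-false (refute λ e → true≢false (&&⁺ r e) (find-complete target none w)))))
        -- `closure` took n steps, so the walk is shortened first.
        arrive : ∀ {j y v} → cand x₀ y ≡ true → Walk E (λ _ → true) j y v → reached v ≡ true
        arrive c p with shorten p
        ... | j , j< , p′ = Grown.complete G-grown j (<⇒≤ j<) c p′
        into : ∀ x → P′ x ≡ true → ∃ λ w → reached w ≡ true × L x && eq (f x) w ≡ true
        into x e = f x , proj₂ (go (||⁻ {P x} e)) , &&⁺ (proj₁ (go (||⁻ {P x} e))) (eq-refl (f x))
          where
          from : ∀ m → g x ≡ m → caseM m false reached ≡ true → L x ≡ true × reached (f x) ≡ true
          from (just w) i r with cand⇒L (s .valid x w i) | grown-walk G-grown w r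
          ... | l | c , j , _ , p = l ,
            arrive c (snoc p (exists⁺ (movable cand g w (f x)) x (&&⁺ (⇒isAt i) (fits x l))) refl)
          go : P x ≡ true ⊎ eq x x₀ ≡ true → L x ≡ true × reached (f x) ≡ true
          go (inj₁ r) = from (g x) refl r
          go (inj₂ i) = subst (λ x → L x ≡ true × reached (f x) ≡ true) (sym (eq⇒ i))
            (lead , arrive (fits x₀ lead) nil)

  Idle : Bool × Assignment → V → Bool
  Idle s x = L x && caseM (proj₂ s x) true (λ _ → false)

  Idle⇒ : ∀ {s x} → Idle s x ≡ true → L x ≡ true × proj₂ s x ≡ nothing
  Idle⇒ {s} {x} e with &&⁻ {L x} e
  ... | l , i = l , go (proj₂ s x) i
    where
    go : ∀ (m : Maybe V) → caseM m true (λ _ → false) ≡ true → m ≡ nothing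
    go nothing _ = refl

  augment-elim : ∀ {ℓ} (Pr : Bool × Assignment → Set ℓ) s x (so : Sound (proj₂ s)) (i : Idle s x ≡ true) →
    (find (Augmenting.target (proj₂ s) so x (proj₁ (Idle⇒ {s} {x} i)) (proj₂ (Idle⇒ {s} {x} i))) ≡ nothing →
      Pr (false , proj₂ s)) →
    (∀ g → Sound g → (∀ y → Assigned (proj₂ s) y → Assigned g y) → Assigned g x → Pr (proj₁ s , g)) →
    Pr (augment cand t x s)
  augment-elim Pr s x so i f h = go (find target) refl
    where
    open Augmenting (proj₂ s) so x (proj₁ (Idle⇒ {s} {x} i)) (proj₂ (Idle⇒ {s} {x} i))
    go : ∀ m → find target ≡ m → Pr (caseM m (false , proj₂ s) (λ w → proj₁ s ,
      proj₂ (foldV (λ q _ → shift cand x q) (path (augmenting cand (proj₂ s) x w) , proj₂ s))))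
    go nothing  e = f e
    go (just w) e = let (a , b , c) = success w (find-sound target e) in h _ a b c

  match₁-sound : ∀ s x → Sound (proj₂ s) → Sound (proj₂ (match₁ cand t L s x))
  match₁-sound s x so = if-elim (λ (s′ : Bool × Assignment) → Sound (proj₂ s′)) (Idle s x)
    (λ i → augment-elim (λ s′ → Sound (proj₂ s′)) s x so i (λ _ → so) (λ _ a _ _ → a)) (λ _ → so)

  initially-sound : Sound (λ _ → nothing)
  initially-sound = record
    { valid = λ _ _ () ; light = λ w → ≤-trans (≤-reflexive (cnt-none {n} λ _ → refl)) z≤n }

  opaque
    unfolding matching

    matching-sound : Sound (proj₂ (matching cand t L))
    matching-sound = foldV-invariant (λ s → Sound (proj₂ s)) match₁-sound initially-sound

    matching-assigns : proj₁ (matching cand t L) ≡ true →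
                       ∀ x → L x ≡ true → Assigned (proj₂ (matching cand t L)) x
    matching-assigns ok x l = foldV-reaches (λ s → Sound (proj₂ s))
      (λ x s → proj₁ s ≡ true → L x ≡ true → Assigned (proj₂ s) x)
      match₁-sound new old initially-sound x ok l
      where
      new : ∀ s x → Sound (proj₂ s) → proj₁ (match₁ cand t L s x) ≡ true → L x ≡ true →
            Assigned (proj₂ (match₁ cand t L s x)) x
      new s x so = if-elim (λ s′ → proj₁ s′ ≡ true → L x ≡ true → Assigned (proj₂ s′) x) (Idle s x)
        (λ i → augment-elim (λ s′ → proj₁ s′ ≡ true → L x ≡ true → Assigned (proj₂ s′) x) s x so i
          (λ _ ()) (λ _ _ _ a _ _ → a))
        (λ e _ l → go (proj₂ s x) refl (refute λ i → true≢false (&&⁺ l i) e))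
        where
        go : ∀ m → proj₂ s x ≡ m → caseM m true (λ _ → false) ≡ false → Assigned (proj₂ s) x
        go (just w) e _ = w , e
      old : ∀ s x y → Sound (proj₂ s) → (proj₁ s ≡ true → L x ≡ true → Assigned (proj₂ s) x) →
            proj₁ (match₁ cand t L s y) ≡ true → L x ≡ true → Assigned (proj₂ (match₁ cand t L s y)) x
      old s x y so q = if-elim (λ s′ → proj₁ s′ ≡ true → L x ≡ true → Assigned (proj₂ s′) x) (Idle s y)
        (λ i → augment-elim (λ s′ → proj₁ s′ ≡ true → L x ≡ true → Assigned (proj₂ s′) x) s y so i
          (λ _ ()) (λ _ _ b _ ok l → b x (q ok l)))
        (λ _ → q)

    matching-succeeds : (f : V → V) → (∀ x → L x ≡ true → cand x (f x) ≡ true) →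
      (∀ w → cnt (λ x → L x && eq (f x) w) ≤ T t) → proj₁ (matching cand t L) ≡ true
    matching-succeeds f fits loads = proj₂ (foldV-invariant
      (λ s → Sound (proj₂ s) × proj₁ s ≡ true)
      (λ s x (so , ok) → match₁-sound s x so , if-elim (λ (s′ : Bool × Assignment) → proj₁ s′ ≡ true) (Idle s x)
        (λ i → augment-elim (λ s′ → proj₁ s′ ≡ true) s x so i
          (λ e → contradiction e (Augmenting.stuck (proj₂ s) so x (proj₁ (Idle⇒ {s} {x} i)) (proj₂ (Idle⇒ {s} {x} i)) f fits loads))
          (λ _ _ _ _ → ok)) (λ _ → ok)) (initially-sound , refl))

-- One phase

module Running (G : Graph)
               (A : Fin (order G) → Fin (order G) → Bool) (A-adj : ∀ u v → A u v ≡ true → Adj G u v)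
               (A-sym : ∀ u v → A u v ≡ true → A v u ≡ true) (r : Node G) where
  private
    n = order G
  open Algorithm n
  open Search n
  open Search-trees n
  open Routing G A A-adj
  open Packs G A A-adj
  open Leading G A A-adj A-sym using
    (module Led; Led; leaders-led; cells-routable; cells-tokens; reach-grown; module Spokes)

  -- The number of hops is recorded, but no order among their rounds; this permits `sequential` to
  -- take nodes as rounds.
  data Chained {D : ℕ} (Label : Fin D → V → V → Set) (I : V → Set) : ℕ → V → Set where
    done : ∀ {v} → I v → Chained Label I 0 v
    hop  : ∀ {τ w u k} → Label τ w u → Chained Label I k w → Chained Label I (suc k) u

  -- What a broadcast within D rounds provides: `Label τ w u` if w calls u
  -- in round τ.

  record Feasible (D : ℕ) : Set₁ where
    field
      Label    : Fin D → V → V → Set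
      one-call : ∀ {τ w u u′} → Label τ w u → Label τ w u′ → u ≡ u′
      edge     : ∀ {τ w u} → Label τ w u → A w u ≡ true

      chained  : ∀ v → ∃ λ k → k ≤ D × Chained Label (_≡ r) k v

  routable-mono : ∀ {t S} {X Y : V → Set} → (∀ {y} → X y → Y y) → Routable t S X → Routable t S Y
  routable-mono f R = record
    { d = d ; d≤ = d≤ ; linked = linked ; level = level ; share = share
    ; last = λ a → f (last a) ; few = few }
    where open Routable R

  module One-phase (t : V) (act : Subset) where
    open Packing-invariant r t act

    rem hubs : Subset
    rem  = proj₁ (pack A r t act)
    hubs = proj₂ (proj₂ (pack A r t act))

    S₁ : Forest
    S₁ = proj₁ (proj₂ (pack A r t act))

    open Packed pack-packed using (origin; covered)

    L : Subset
    L = leaders A t act rem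

    cand : Matrix
    cand = candidates (reach A t rem) rem L

    cand⇒L : ∀ {x w} → cand x w ≡ true → L x ≡ true
    cand⇒L {x} e = proj₁ (&&⁻ {L x} e)

    open Matching n t L cand cand⇒L

    M : Bool × Assignment
    M = matching cand t L

    S₂ S₃ : Forest
    S₂ = spokes (reach A t rem) (proj₂ M)
    S₃ = cells A t act rem L

    -- `route` puts its rounds in front, so the innermost call, which serves the cells, is the last
    -- in time.
    plan : ∀ {out} → Plan out (λ y → y ≡ r ⊎ act y ≡ true) → proj₁ M ≡ true →
      let out′ = route t S₁ (route t S₂ (route t S₃ out)) in
      Plan out′ (λ y → y ≡ r ⊎ hubs y ≡ true) × proj₁ out′ ≡ T t * 5 * 3 + proj₁ out
    plan {out} p ok = proj₁ p₁ ,
      trans (proj₂ p₁) (trans (cong (T t * 5 +_) (trans (proj₂ p₂) (cong (T t * 5 +_) (proj₂ p₃))))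
        (eq₃ (T t * 5) (proj₁ out)))
      where
      eq₃ : ∀ a b → a + (a + (a + b)) ≡ a * 3 + b
      eq₃ = solve-∀
      place : ∀ {z} → rem z ≡ true ⊎ z ∈ path (S₃ z) →
              (L z ≡ true ⊎ rem z ≡ true) ⊎ ∃ λ v → z ∈ path (S₃ v)
      place (inj₁ e) = inj₁ (inj₂ e)
      place (inj₂ m) = inj₂ (_ , m)
      p₃ : Plan (route t S₃ out) (λ y → L y ≡ true ⊎ rem y ≡ true) × _
      p₃ = route-plan (routable-mono inj₁ (cells-routable t act rem pack-sparse)) p λ where
        z (inj₁ refl) → inj₁ (inj₂ origin)
        z (inj₂ a)    → place (cells-tokens t act rem pack-sparse z a)
      open Spokes t act rem pack-sparse (proj₂ M) (Sound.valid matching-sound) (Sound.light matching-sound)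
        using (spokes-routable; assigned; Spoke)
      p₂ : Plan (route t S₂ (route t S₃ out)) (λ y → rem y ≡ true) × _
      p₂ = route-plan spokes-routable (proj₁ p₃) λ where
        z (inj₂ e) → inj₁ e
        z (inj₁ l) → let (w , e) = matching-assigns ok z l in
          inj₂ (z , subst (z ∈_) (sym (Spoke.path≡ (assigned z w e))) (here refl))
      split : ∀ {z} → z ≡ r ⊎ (∃ λ v → z ∈ path (S₁ v)) →
              (z ≡ r ⊎ hubs z ≡ true) ⊎ ∃ λ v → z ∈ path (S₁ v)
      split (inj₁ e) = inj₁ (inj₁ e)
      split (inj₂ m) = inj₂ m
      p₁ : Plan (route t S₁ (route t S₂ (route t S₃ out))) (λ y → y ≡ r ⊎ hubs y ≡ true) × _
      p₁ = route-plan (routable-mono inj₂ pack-routable) (proj₁ p₂) λ z e → split (covered z e)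

    module _ (Fe : Feasible (T t)) where
      open Feasible Fe

      -- The hop by which the chain from the root to x leaves the removed
      -- nodes for the last time.
      record Exit (x : V) : Set where
        field
          {w u}  : V
          {τ}    : Fin (T t)
          {j}    : ℕ
          called : Label τ w u
          wheel  : rem w ≡ true
          u-free : free rem u ≡ true
          arm    : Walk A (free rem) j u x
          short  : suc j ≤ T t

      exit : ∀ {k x} → Chained Label (_≡ r) k x → k ≤ T t → rem x ≡ false → Exit x
      exit c k≤ f = let (w , u , τ , j , l , e , uf , a , s) = go c f in
        record { called = l ; wheel = e ; u-free = uf ; arm = a ; short = ≤-trans s k≤ }
        where
        go : ∀ {k x} → Chained Label (_≡ r) k x → rem x ≡ false → ∃₂ λ w u → ∃₂ λ τ j →
          Label τ w u × rem w ≡ true × free rem u ≡ true × Walk A (free rem) j u x × suc j ≤ k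
        go (done refl) f = true≢false origin f
        go (hop {τ} {w} {u} l c) f with dichotomy (rem w)
        ... | inj₁ e = w , u , τ , 0 , l , e , neg⁺ f , nil , s≤s z≤n
        ... | inj₂ e with go c e
        ... | w′ , u′ , τ′ , j , l′ , e′ , uf , a , s =
          w′ , u′ , τ′ , suc j , l′ , e′ , uf , snoc a (edge l) (neg⁺ f) , s≤s s

      led : Led t act rem pack-sparse L
      led = leaders-led t act rem pack-sparse

      exit-of : ∀ x → L x ≡ true → Exit x
      exit-of x l = let (k , k≤ , c) = chained x in exit c k≤ (neg⁻ (Led.outside led x l))

      -- The assignment that shows the existence of a matching: a leader goes to the removed node
      -- from which its chain departs for the last time. Outside `L` the value is arbitrary.
      f : V → V
      f x = go (dichotomy (L x))
        where
        go : L x ≡ true ⊎ L x ≡ false → V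
        go (inj₁ l) = Exit.w (exit-of x l)
        go (inj₂ _) = x

      f≡ : ∀ x l → f x ≡ Exit.w (exit-of x l)
      f≡ x l with dichotomy (L x)
      -- The exit is computed from a proof of `L x ≡ true`, and any two such proofs agree.
      ... | inj₁ l′ = cong (λ l → Exit.w (exit-of x l)) (≡-irrelevant l′ l)
      ... | inj₂ e  = true≢false l e

      fits : ∀ x → L x ≡ true → cand x (f x) ≡ true
      fits x l = subst (λ w → cand x w ≡ true) (sym (f≡ x l)) (&&⁺ l (&&⁺ wheel
        (Growth.Grown.complete (reach-grown t act rem pack-sparse w) (suc j) short (eq-refl w)
          (subst (λ i → Walk A (free rem) i w x) (+-comm j 1) (snoc nil (edge called) u-free ++ʷ arm)))))
        where open Exit (exit-of x l)

      -- Leaders sent to the same `w` leave it in different rounds. In the same round `w` makes a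
      -- single call, to some u, and two leaders less than T away from u coincide.
      loads : ∀ w → cnt (λ x → L x && eq (f x) w) ≤ T t
      loads w = cnt-injection (λ x e → Exit.τ (exit-of x (proj₁ (&&⁻ {L x} e)))) λ x y p q τ≡ →
        same x y (proj₁ (&&⁻ {L x} p)) (proj₁ (&&⁻ {L y} q))
          (trans (sym (f≡ x _)) (trans (eq⇒ (proj₂ (&&⁻ {L x} p)))
            (trans (sym (eq⇒ (proj₂ (&&⁻ {L y} q)))) (f≡ y _)))) τ≡
        where
        same : ∀ x y (l : L x ≡ true) (l′ : L y ≡ true) → Exit.w (exit-of x l) ≡ Exit.w (exit-of y l′) →
               Exit.τ (exit-of x l) ≡ Exit.τ (exit-of y l′) → x ≡ y
        same x y l l′ w≡ τ≡ = Led.separated led l l′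
          (+-mono-≤ (<⇒≤ (Exit.short (exit-of y l′))) (<⇒≤ (Exit.short (exit-of x l))))
          (subst (Walk A (free rem) _ x) u≡ (reverseʷ A-sym (Exit.u-free (exit-of x l)) (Exit.arm (exit-of x l)))
            ++ʷ Exit.arm (exit-of y l′))
          where
          u≡ : Exit.u (exit-of x l) ≡ Exit.u (exit-of y l′)
          u≡ = one-call (Exit.called (exit-of x l))
            (subst₂ (λ τ w → Label τ w _) (sym τ≡) (sym w≡) (Exit.called (exit-of y l′)))

      matched : proj₁ M ≡ true
      matched = matching-succeeds f fits loads

-- All phases, and the search for T

module Attempting (G : Graph)
                  (A : Fin (order G) → Fin (order G) → Bool) (A-adj : ∀ u v → A u v ≡ true → Adj G u v)
                  (A-sym : ∀ u v → A u v ≡ true → A v u ≡ true) (r : Node G) where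
  private
    n = order G
  open Algorithm n
  open Search n
  open Routing G A A-adj
  open Packs G A A-adj
  open Running G A A-adj A-sym r

  act : State → Subset
  act s = proj₁ (proj₂ s)

  out : State → Output
  out s = proj₂ (proj₂ s)

  record Phases (t : V) (k m : ℕ) : Set where
    field
      time  : k ≡ m * (T t * 15)
      -- There are n - 1 tokens at first, each phase divides their number by at least T + 1, and the
      -- last phase still found one.
      limit : m ≡ 0 ⊎ suc (T t) ^ pred m ≤ pred n

  record Progress (t : V) (i : ℕ) (s : State) : Set₁ where
    field
      plan     : Plan (out s) (λ y → y ≡ r ⊎ act s y ≡ true)
      m        : ℕ
      phases   : Phases t (proj₁ (out s)) m
      active   : cnt (act s) * suc (T t) ^ m ≤ pred n
      -- Since T + 1 ≥ 2, a phase loses at least one token; hence none is left after the n rounds of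
      -- `run`.
      shrinks  : cnt (act s) ≡ 0 ⊎ cnt (act s) + i ≤ n

  continues : State → Bool
  continues s = proj₁ s && exists (act s)

  run₁ : V → State → State
  run₁ t s = if continues s then phase A r t s else s

  phase-progress : ∀ t i s → (proj₁ s ≡ true → Progress t i s) → continues s ≡ true →
    proj₁ (phase A r t s) ≡ true → Progress t (suc i) (phase A r t s)
  phase-progress t i s p c ok′ = record
    { plan    = proj₁ planned
    ; m       = suc m
    ; phases  = record
      { time  = trans (proj₂ planned) (cong₂ _+_ (*-assoc (T t) 5 3) (Phases.time phases))
      ; limit = inj₂ (≤-trans (≤-trans (≤-reflexive (sym (*-identityˡ _)))
          (*-monoˡ-≤ (suc (T t) ^ m) some)) active) }
    ; active  = ≤-trans (≤-trans (≤-reflexive (sym (*-assoc (cnt hubs) (suc (T t)) (suc (T t) ^ m))))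
        (*-monoˡ-≤ (suc (T t) ^ m) fewer-hubs)) active
    ; shrinks = inj₂ (fewer shrinks) }
    where
    open One-phase t (act s) using (M; hubs)
    open Packing-invariant r t (act s) using (fewer-hubs)
    both : proj₁ M ≡ true × proj₁ s ≡ true
    both = &&⁻ {proj₁ M} ok′
    open Progress (p (proj₂ both))
    planned = One-phase.plan t (act s) plan (proj₁ both)
    some : 1 ≤ cnt (act s)
    some = let (v , a) = exists⁻ (act s) (proj₂ (&&⁻ {proj₁ s} c)) in cnt-positive v a
    hubs< : cnt hubs < cnt (act s)
    hubs< with cnt hubs in e
    ... | zero  = some
    ... | suc h = begin
      2 + h               ≤⟨ m≤m+n (2 + h) h ⟩
      2 + h + h           ≡⟨ eq₂ h ⟩
      suc h * 2           ≤⟨ *-monoʳ-≤ (suc h) (s≤s (s≤s (z≤n {toℕ t}))) ⟩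
      suc h * suc (T t)   ≡⟨ cong (_* suc (T t)) e ⟨
      cnt hubs * suc (T t) ≤⟨ fewer-hubs ⟩
      cnt (act s)         ∎
      where
      open ≤-Reasoning
      eq₂ : ∀ a → 2 + a + a ≡ suc a * 2
      eq₂ = solve-∀
    fewer : cnt (act s) ≡ 0 ⊎ cnt (act s) + i ≤ n → cnt hubs + suc i ≤ n
    fewer (inj₁ e) = contradiction (subst (1 ≤_) e some) λ ()
    fewer (inj₂ l) = ≤-trans (≤-reflexive (+-suc (cnt hubs) i)) (≤-trans (+-monoˡ-≤ i hubs<) l)

  run₁-progress : ∀ t i s → (proj₁ s ≡ true → Progress t i s) →
                  proj₁ (run₁ t s) ≡ true → Progress t (suc i) (run₁ t s)
  run₁-progress t i s p = if-elim (λ s′ → proj₁ s′ ≡ true → Progress t (suc i) s′) (continues s)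
    (phase-progress t i s p) λ c ok → let open Progress (p ok) in record
      { plan = plan ; m = m ; phases = phases ; active = active
      ; shrinks = inj₁ (cnt-none (exists-false (act s) (refute λ e → true≢false (&&⁺ ok e) c))) }

  others : Subset
  others v = neg (eq v r)

  cnt-others : cnt others ≡ pred n
  cnt-others = cong pred (trans (+-comm 1 (cnt others)) (trans
    (cnt-update {P = others} {λ _ → true} r (λ v ne → neg⁺ (≢⇒eq-false ne)))
    (trans (cong (λ b → cnt {n} (λ _ → true) + b2n (neg b)) (eq-refl r))
      (trans (+-identityʳ _) (cnt-all n)))))

  initial : ∀ t → Progress t 0 (true , others , zero , [])
  initial t = record
    { plan    = record { covers = covering λ I f v → f v (place v (dichotomy (eq v r))) ; rounds = [] ; length≡ = refl }
    ; m       = 0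
    ; phases  = record { time = refl ; limit = inj₁ refl }
    ; active  = ≤-reflexive (trans (*-identityʳ _) cnt-others)
    ; shrinks = inj₂ (≤-trans (≤-reflexive (trans (+-identityʳ _) cnt-others)) pred[n]≤n) }
    where
    place : ∀ v → eq v r ≡ true ⊎ eq v r ≡ false → v ≡ r ⊎ others v ≡ true
    place v (inj₁ e) = inj₁ (eq⇒ e)
    place v (inj₂ e) = inj₂ (neg⁺ e)

  record Achieves (t : V) (o : Output) : Set₁ where
    field
      plan   : Plan o (_≡ r)
      m      : ℕ
      phases : Phases t (proj₁ o) m

  run-achieves : ∀ t → proj₁ (run A r t) ≡ true → Achieves t (out (run A r t))
  run-achieves t ok = record
    { plan = record { Plan plan hiding (covers)
                    ; covers = covering λ I f v → Covers.inform (Plan.covers plan) I (λ z e → f z (at-root z e)) v }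
    ; m = m ; phases = phases }
    where
    progress : Progress t (length (tabulate {n = n} id) + 0) (run A r t)
    progress = iteration (λ i s → proj₁ s ≡ true → Progress t i s) (run₁-progress t)
      (tabulate {n = n} id) (λ _ → initial t) ok
    open Progress progress
    none-left : cnt (act (run A r t)) ≡ 0
    none-left = none-left′ shrinks
      where
      none-left′ : ∀ {c} → c ≡ 0 ⊎ c + (length (tabulate {n = n} id) + 0) ≤ n → c ≡ 0
      none-left′ (inj₁ e) = e
      none-left′ {c} (inj₂ l) = n≤0⇒n≡0 (+-cancelʳ-≤ n c 0
        (subst (λ k → c + k ≤ n) (trans (+-identityʳ _) (length-tabulate {n = n} id)) l))
    at-root : ∀ z → z ≡ r ⊎ act (run A r t) z ≡ true → z ≡ r
    at-root z (inj₁ e) = e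
    at-root z (inj₂ a) = contradiction (subst (1 ≤_) none-left (cnt-positive z a)) λ ()

  -- Feasibility speaks of the graph, the root and T alone, so it serves all phases, whichever
  -- tokens remain.
  run-succeeds : ∀ t → Feasible (T t) → proj₁ (run A r t) ≡ true
  run-succeeds t fe = foldV-invariant (λ s → proj₁ s ≡ true)
    (λ s _ ok → if-elim (λ (s′ : State) → proj₁ s′ ≡ true) (continues s)
      (λ _ → &&⁺ (One-phase.matched t (act s) fe) ok) (λ _ → ok)) refl

  attempts-keep : ∀ ts o → foldl (attempt A r) (just o) ts ≡ just o
  attempts-keep []       o = refl
  attempts-keep (t ∷ ts) o = attempts-keep ts o

  -- The guesses are tried in increasing order, and the first success is kept.
  attempts-first : ∀ ts → AllPairs Fin._<_ ts → ∀ {t} → t ∈ ts → proj₁ (run A r t) ≡ true →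
    ∃₂ λ t′ o → toℕ t′ ≤ toℕ t × Achieves t′ o × foldl (attempt A r) nothing ts ≡ just o
  attempts-first (s ∷ ts) (ls ∷ ap) {t} m ok = go (dichotomy (proj₁ (run A r s)))
    where
    start-with : ∀ b → proj₁ (run A r s) ≡ b → foldl (attempt A r) nothing (s ∷ ts) ≡
      foldl (attempt A r) (if b then just (out (run A r s)) else nothing) ts
    start-with b e = cong (λ b → foldl (attempt A r) (if b then just (out (run A r s)) else nothing) ts) e
    first-≤ : t ∈ s ∷ ts → toℕ s ≤ toℕ t
    first-≤ (here e)  = ≤-reflexive (cong toℕ (sym e))
    first-≤ (there m) = <⇒≤ (All.lookup ls m)
    go : proj₁ (run A r s) ≡ true ⊎ proj₁ (run A r s) ≡ false → _
    go (inj₁ e) = s , out (run A r s) , first-≤ m , run-achieves s e ,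
      trans (start-with true e) (attempts-keep ts _)
    go (inj₂ e) = let (t′ , o , l , a , eq) = attempts-first ts ap (later m) ok in
      t′ , o , l , a , trans (start-with false e) eq
      where
      later : t ∈ s ∷ ts → t ∈ ts
      later (here refl) = true≢false ok e
      later (there m)   = m

  broadcast-achieves : ∀ t → Feasible (T t) → ∃ λ t′ → toℕ t′ ≤ toℕ t × Achieves t′ (broadcast A r)
  broadcast-achieves t fe with attempts-first (tabulate id) (tabulate⁺-< id) (∈-tabulate⁺ t) (run-succeeds t fe)
  ... | t′ , o , l , a , e = t′ , l , subst (Achieves t′) (cong (λ m → caseM m (zero , []) id) (sym e)) a

-- Lower bounds

module Lower-bounds (G : Graph)
                    (A : Fin (order G) → Fin (order G) → Bool) (A-adj : ∀ u v → A u v ≡ true → Adj G u v)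
                    (adj-A : ∀ u v → Adj G u v → A u v ≡ true)
                    (A-sym : ∀ u v → A u v ≡ true → A v u ≡ true) (r : Node G) where
  private
    n = order G
  open Algorithm n
  open Search-trees n
  open Routing G A A-adj using (ends)
  open Running G A A-adj A-sym r

  sender-∈ : ∀ {u w cs} → (u , w) ∈ cs → u ∈ ends cs
  sender-∈ (here refl) = here refl
  sender-∈ (there m)   = there (there (sender-∈ m))

  one-callee : ∀ {cs} → Unique (ends cs) → ∀ {u w w′} → (u , w) ∈ cs → (u , w′) ∈ cs → w ≡ w′
  one-callee (_ ∷ _ ∷ uq)  (here refl) (here refl) = refl
  one-callee ((_ ∷ ne) ∷ _) (here refl) (there m)  = contradiction refl (All.lookup ne (sender-∈ m))
  one-callee ((_ ∷ ne) ∷ _) (there m) (here refl)  = contradiction refl (All.lookup ne (sender-∈ m))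
  one-callee (_ ∷ _ ∷ uq)  (there m) (there m′)    = one-callee uq m m′

  In : (rs : List (Round G)) → Fin (length rs) → V → V → Set
  In rs τ w u = (w , u) ∈ List.lookup rs τ

  Next : (V → Set) → Round G → V → Set
  Next I c w = I w ⊎ ∃ λ u → I u × (u , w) ∈ c

  -- The later rounds start from `Next I c`; if a chain through them begins at a node informed only
  -- by `c`, that call becomes one more hop.
  chain : ∀ rs I v → InformedAfter G I rs v → ∃ λ k → k ≤ length rs × Chained (In rs) I k v
  chain []       I v i = 0 , z≤n , done i
  chain (c ∷ rs) I v i = let (k , k≤ , p) = chain rs _ v i ; (k′ , k′≤ , p′) = earlier p in
    k′ , ≤-trans k′≤ (s≤s k≤) , p′
    where
    earlier : ∀ {k v} → Chained (In rs) (Next I c) k v →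
              ∃ λ k′ → k′ ≤ suc k × Chained (In (c ∷ rs)) I k′ v
    earlier (done (inj₁ i))           = 0 , z≤n , done i
    earlier (done (inj₂ (u , i , m))) = 1 , ≤-refl , hop {τ = zero} m (done i)
    earlier (hop {τ = τ} l p) = let (k , k≤ , q) = earlier p in suc k , s≤s k≤ , hop {τ = suc τ} l q

  scheme-feasible : (s : Scheme G r) → Feasible (Scheme.time s)
  scheme-feasible s = record
    { Label    = In rounds
    ; one-call = λ {τ} l l′ → one-callee (proj₂ (All.lookup telephone (∈-lookup τ))) l l′
    ; edge     = λ {τ} l → adj-A _ _ (All.lookup (proj₁ (All.lookup telephone (∈-lookup τ))) l)
    ; chained  = λ v → chain rounds (_≡ r) v (complete v) }
    where open Scheme s

  -- An informed node is determined by the rounds in which the message moves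
  -- on its way from the root.
  doubling : ∀ rs → All (IsRound G) rs → ∀ (I : V → Set) c (code : ∀ v → I v → Fin c) →
    (∀ v v′ i i′ → code v i ≡ code v′ i′ → v ≡ v′) →
    (∀ v → InformedAfter G I rs v) → n ≤ c * 2 ^ length rs
  doubling [] _ I c code inj all = subst (n ≤_) (sym (*-identityʳ c))
    (injective⇒≤ {f = λ v → code v (all v)} (λ {v} {v′} → inj v v′ _ _))
  doubling (cs ∷ rs) ((_ , uq) ∷ tel) I c code inj all =
    subst (n ≤_) (doubled c (2 ^ length rs)) (doubling rs tel (Next I cs) (c + c) code′ inj′ all)
    where
    doubled : ∀ a b → (a + a) * b ≡ a * (b + (b + 0))
    doubled = solve-∀
    code′ : ∀ v → Next I cs v → Fin (c + c)
    code′ v (inj₁ i)           = code v i ↑ˡ c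
    code′ v (inj₂ (u , i , _)) = c ↑ʳ code u i
    apart : ∀ {i j : Fin c} {X : Set} → i ↑ˡ c ≡ c ↑ʳ j → X
    apart {i} {j} e with trans (sym (splitAt-↑ˡ c i c)) (trans (cong (splitAt c) e) (splitAt-↑ʳ c c j))
    ... | ()
    inj′ : ∀ v v′ i i′ → code′ v i ≡ code′ v′ i′ → v ≡ v′
    inj′ v v′ (inj₁ i) (inj₁ i′) e = inj v v′ i i′ (↑ˡ-injective c _ _ e)
    inj′ v v′ (inj₁ i) (inj₂ _)  e = apart e
    inj′ v v′ (inj₂ _) (inj₁ _)  e = apart (sym e)
    inj′ v v′ (inj₂ (u , i , m)) (inj₂ (u′ , i′ , m′)) e with inj u u′ i i′ (↑ʳ-injective c _ _ e)
    ... | refl = one-callee uq m m′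

  scheme-doubling : (s : Scheme G r) → n ≤ 2 ^ Scheme.time s
  scheme-doubling s = subst (n ≤_) (*-identityˡ _) (doubling rounds telephone (_≡ r) 1 (λ _ _ → zero)
    (λ v v′ i i′ _ → trans i (sym i′)) complete)
    where open Scheme s

  -- The nodes are taken as rounds: in round u only u is called, and a simple path from the root is
  -- a chain. This guarantees a success at T = n at the latest.
  sequential : Connected G → Feasible n
  sequential linked = record
    { Label    = λ τ w u → τ ≡ u × A w u ≡ true
    ; one-call = λ (e , _) (e′ , _) → trans (sym e) e′
    ; edge     = proj₂
    ; chained  = λ v → let (k , w) = walk nil (linked r v) ; (j , j< , w′) = shorten w in
        j , <⇒≤ j< , chain-of w′ }
    where
    walk : ∀ {k u v} → Walk A (λ _ → true) k r u → Star (Adj G) u v → ∃ λ j → Walk A (λ _ → true) j r v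
    walk w ε        = _ , w
    walk w (e ◅ es) = walk (snoc w (adj-A _ _ e) refl) es
    chain-of : ∀ {k v} → Walk A (λ _ → true) k r v →
               Chained (λ τ w u → τ ≡ u × A w u ≡ true) (_≡ r) k v
    chain-of nil          = done refl
    chain-of (snoc w e _) = hop (refl , e) (chain-of w)

  bound-of : ∀ {D} → 1 ≤ D → D ≤ n → ∃ λ t → T t ≡ D
  bound-of {suc d} _ d< = fromℕ< d< , cong suc (toℕ-fromℕ< d<)

-- The adjacency matrix

module Adjacency (G : Graph) where
  open Algorithm (order G)
  open Search (order G)

  private
    Present : V → V → Set
    Present u v = (u , v) ∈ edges G ⊎ (v , u) ∈ edges G

    test : V → V → V × V → Bool
    test u v e = neg (eq u v) &&
      (eq (proj₁ e) u && eq (proj₂ e) v || eq (proj₁ e) v && eq (proj₂ e) u)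

  adjacency-sound : ∀ u v → adjacency (edges G) u v ≡ true → Adj G u v
  adjacency-sound u v = go (edges G) id (λ ())
    where
    go : ∀ es → (∀ {e} → e ∈ es → e ∈ edges G) → ∀ {b} → (b ≡ true → Adj G u v) →
         foldl (λ b e → b || test u v e) b es ≡ true → Adj G u v
    go []       sub f q = f q
    go (e ∷ es) sub {b} f q = go es (sub ∘ there) (λ q′ → new (||⁻ {b} q′)) q
      where
      same : ∀ {x y} → eq (proj₁ e) x && eq (proj₂ e) y ≡ true → e ≡ (x , y)
      same p = let (p₁ , p₂) = &&⁻ {eq (proj₁ e) _} p in cong₂ _,_ (eq⇒ p₁) (eq⇒ p₂)
      new : b ≡ true ⊎ test u v e ≡ true → Adj G u v
      new (inj₁ b) = f b
      new (inj₂ t) with &&⁻ {neg (eq u v)} t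
      ... | ne , o = (λ { refl → true≢false (eq-refl u) (neg⁻ ne) }) , either (||⁻ o)
        where
        either : _ ⊎ _ → Present u v
        either (inj₁ p) = inj₁ (subst (_∈ edges G) (same p) (sub (here refl)))
        either (inj₂ p) = inj₂ (subst (_∈ edges G) (same p) (sub (here refl)))

  adjacency-complete : ∀ u v → Adj G u v → adjacency (edges G) u v ≡ true
  adjacency-complete u v (u≢v , p) = find-edge p
    where
    hit : ∀ e → (e ≡ (u , v) ⊎ e ≡ (v , u)) → test u v e ≡ true
    hit _ (inj₁ refl) = &&⁺ (neg⁺ (≢⇒eq-false u≢v)) (||⁺ˡ (&&⁺ (eq-refl u) (eq-refl v)))
    hit _ (inj₂ refl) = &&⁺ (neg⁺ (≢⇒eq-false u≢v)) (||⁺ʳ {eq v u && eq u v} (&&⁺ (eq-refl v) (eq-refl u)))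
    reach-true : ∀ {x} → test u v x ≡ true → x ∈ edges G → adjacency (edges G) u v ≡ true
    reach-true t m = foldl-reaches (λ _ → ⊤) (λ x b → test u v x ≡ true → b ≡ true)
      (λ _ _ _ → tt) (λ b x _ t → ||⁺ʳ {b} t) (λ b x y _ f t → ||⁺ˡ (f t)) (edges G) tt m t
    find-edge : Present u v → adjacency (edges G) u v ≡ true
    find-edge (inj₁ m) = reach-true (hit _ (inj₁ refl)) m
    find-edge (inj₂ m) = reach-true (hit _ (inj₂ refl)) m

  adjacency-symmetric : ∀ u v → adjacency (edges G) u v ≡ true → adjacency (edges G) v u ≡ true
  adjacency-symmetric u v e = let (ne , p) = adjacency-sound u v e in
    adjacency-complete v u (ne ∘ sym , swap p)
    where
    swap : Present u v → Present v u
    swap (inj₁ m) = inj₂ m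
    swap (inj₂ m) = inj₁ m

-- Logarithms

n<2^k⇒⌊log₂n⌋<k : ∀ k n → 1 ≤ n → n < 2 ^ k → ⌊log₂ n ⌋ < k
n<2^k⇒⌊log₂n⌋<k zero    (suc n)       _ (s≤s ())
n<2^k⇒⌊log₂n⌋<k (suc k) 1             _ _  = s≤s z≤n
n<2^k⇒⌊log₂n⌋<k (suc k) n@(suc (suc n′)) _ l = s≤s (≤-trans (m≤n+m∸n ⌊log₂ n ⌋ 1)
  (subst (λ j → suc j ≤ k) (⌊log₂⌊n/2⌋⌋≡⌊log₂n⌋∸1 n)
    (n<2^k⇒⌊log₂n⌋<k k ⌊ n /2⌋ (s≤s z≤n) (*-cancelˡ-< 2 _ _ (≤-trans (s≤s doubled) l)))))
  where
  doubled : 2 * ⌊ n /2⌋ ≤ n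
  doubled = subst (2 * ⌊ n /2⌋ ≤_) (⌊n/2⌋+⌈n/2⌉≡n n)
    (+-monoʳ-≤ ⌊ n /2⌋ (≤-trans (≤-reflexive (+-identityʳ _)) (⌊n/2⌋≤⌈n/2⌉ n)))

2^⌊log₂n⌋≤n : ∀ n → 1 ≤ n → 2 ^ ⌊log₂ n ⌋ ≤ n
2^⌊log₂n⌋≤n n 1≤n = ≮⇒≥ λ l → <-irrefl refl (n<2^k⇒⌊log₂n⌋<k ⌊log₂ n ⌋ n 1≤n l)

2^k≤n⇒k≤⌊log₂n⌋ : ∀ {k n} → 2 ^ k ≤ n → k ≤ ⌊log₂ n ⌋
2^k≤n⇒k≤⌊log₂n⌋ {k} l = subst (_≤ _) (⌊log₂[2^n]⌋≡n k) (⌊log₂⌋-mono-≤ l)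

k<2^k : ∀ k → k < 2 ^ k
k<2^k zero    = s≤s z≤n
k<2^k (suc k) = ≤-trans (s≤s (k<2^k k)) (+-mono-≤ (m^n>0 2 k) (≤-reflexive (sym (+-identityʳ (2 ^ k)))))

halfLog : ℕ → ℕ
halfLog n = ⌊ ⌊log₂ ⌊log₂ n ⌋ ⌋ /2⌋

-- The value at h = 0 is that at h = 1: in `quotient-bound` the base T + 1 is at least 2 anyway.
quotient : ℕ → ℕ → ℕ
quotient L zero    = L
quotient L (suc h) = L / suc h

-- Schedules with T ≥ √log n pay for the first summand, the others for the
-- second.
ratio : ℕ → ℕ
ratio n = suc (quotient ⌊log₂ n ⌋ (halfLog n)) * 15 + 2 ^ halfLog n * 30

quotient-bound : ∀ {T L} h k n → ⌊log₂ n ⌋ ≡ L → 1 ≤ T → 2 ^ h ≤ suc T → suc T ^ k ≤ n → k ≤ quotient L h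
quotient-bound {T} zero k n refl 1≤T _ p = 2^k≤n⇒k≤⌊log₂n⌋ (≤-trans (^-monoˡ-≤ k (s≤s 1≤T)) p)
quotient-bound {T} h@(suc _) k n refl 1≤T l p = subst (_≤ ⌊log₂ n ⌋ / h) (m*n/n≡m k h)
  (/-monoˡ-≤ h (≤-trans (≤-reflexive (*-comm k h))
    (2^k≤n⇒k≤⌊log₂n⌋ (≤-trans (≤-reflexive (sym (^-*-assoc 2 h k))) (≤-trans (^-monoˡ-≤ k l) p)))))

time-bound : ∀ {T m n opt} → 1 ≤ T → T ≤ opt → 1 ≤ opt → n ≤ 2 ^ opt →
  m ≡ 0 ⊎ suc T ^ pred m ≤ n → m * (T * 15) ≤ ratio n * opt
time-bound _ _ _ _ (inj₁ refl) = z≤n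
time-bound {T} {zero} _ _ _ _ _ = z≤n
time-bound {T} {suc k} {n} {opt} 1≤T T≤ 1≤opt n≤ (inj₂ p) with ≤-total (2 ^ halfLog n) (suc T)
... | inj₁ l = begin
  suc k * (T * 15)                                   ≤⟨ *-mono-≤ (s≤s (quotient-bound (halfLog n) k n refl 1≤T l p)) (*-monoˡ-≤ 15 T≤) ⟩
  suc q * (opt * 15)                                 ≡⟨ eq₁ (suc q) opt ⟩
  suc q * 15 * opt                                   ≤⟨ *-monoˡ-≤ opt (m≤m+n (suc q * 15) (2 ^ halfLog n * 30)) ⟩
  ratio n * opt                                      ∎
  where
  open ≤-Reasoning
  q = quotient ⌊log₂ n ⌋ (halfLog n)
  eq₁ : ∀ a b → a * (b * 15) ≡ a * 15 * b
  eq₁ = solve-∀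
-- Now T is below 2^h, and the number k + 1 of phases is at most 2 opt because k ≤ log n ≤ opt;
-- hence the factor 30 = 2 · 15.
... | inj₂ l = begin
  suc k * (T * 15)                                   ≤⟨ *-mono-≤ (+-mono-≤ 1≤opt k≤) (*-monoˡ-≤ 15 (≤-trans (n≤1+n T) l)) ⟩
  (opt + opt) * (2 ^ halfLog n * 15)                 ≡⟨ eq₂ (2 ^ halfLog n) opt ⟩
  2 ^ halfLog n * 30 * opt                           ≤⟨ *-monoˡ-≤ opt (m≤n+m (2 ^ halfLog n * 30) (suc q * 15)) ⟩
  ratio n * opt                                      ∎
  where
  open ≤-Reasoning
  q = quotient ⌊log₂ n ⌋ (halfLog n)
  k≤ : k ≤ opt
  k≤ = ≤-trans (quotient-bound 0 k n refl 1≤T (s≤s z≤n) p)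
    (≤-trans (⌊log₂⌋-mono-≤ n≤) (≤-reflexive (⌊log₂[2^n]⌋≡n opt)))
  eq₂ : ∀ a b → (b + b) * (a * 15) ≡ a * 30 * b
  eq₂ = solve-∀

-- From n = 16 on, log log n is at least 2 and its half h at least 1, so ℓ ≤ 3 h. The terms then
-- contribute 15 L, 45 L and 90 L, in total 150 L.
ratio-O : IsO[log/loglog] ratio
ratio-O = 150 , 16 , λ n 16≤n → bound n ⌊log₂ n ⌋ ⌊log₂ ⌊log₂ n ⌋ ⌋ ⌊ ⌊log₂ ⌊log₂ n ⌋ ⌋ /2⌋ refl refl refl
  (⌊log₂⌋-mono-≤ 16≤n)
  where
  open ≤-Reasoning
  bound : ∀ n L ℓ h → ⌊log₂ n ⌋ ≡ L → ⌊log₂ L ⌋ ≡ ℓ → ⌊ ℓ /2⌋ ≡ h → 4 ≤ L →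
          (suc (quotient L h) * 15 + 2 ^ h * 30) * ℓ ≤ 150 * L
  bound n L ℓ h refl refl refl 4≤L = go h refl
    where
    1≤h : 1 ≤ h
    1≤h = ⌊n/2⌋-mono (⌊log₂⌋-mono-≤ 4≤L)
    2^ℓ≤L : 2 ^ ℓ ≤ L
    2^ℓ≤L = 2^⌊log₂n⌋≤n L (≤-trans (s≤s z≤n) 4≤L)
    ℓ≤L : ℓ ≤ L
    ℓ≤L = ≤-trans (<⇒≤ (k<2^k ℓ)) 2^ℓ≤L
    h+h≤ℓ : h + h ≤ ℓ
    h+h≤ℓ = subst (h + h ≤_) (⌊n/2⌋+⌈n/2⌉≡n ℓ) (+-monoʳ-≤ h (⌊n/2⌋≤⌈n/2⌉ ℓ))
    ⌈n/2⌉≤1+⌊n/2⌋ : ∀ n → ⌈ n /2⌉ ≤ suc ⌊ n /2⌋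
    ⌈n/2⌉≤1+⌊n/2⌋ zero          = z≤n
    ⌈n/2⌉≤1+⌊n/2⌋ (suc zero)    = s≤s z≤n
    ⌈n/2⌉≤1+⌊n/2⌋ (suc (suc n)) = s≤s (⌈n/2⌉≤1+⌊n/2⌋ n)
    ℓ≤3h : ℓ ≤ h * 3
    ℓ≤3h = begin
      ℓ                ≡⟨ ⌊n/2⌋+⌈n/2⌉≡n ℓ ⟨
      h + ⌈ ℓ /2⌉      ≤⟨ +-monoʳ-≤ h (⌈n/2⌉≤1+⌊n/2⌋ ℓ) ⟩
      h + (1 + h)      ≤⟨ +-monoʳ-≤ h (+-monoˡ-≤ h 1≤h) ⟩
      h + (h + h)      ≡⟨ eq₃ h ⟩
      h * 3            ∎
      where
      eq₃ : ∀ a → a + (a + a) ≡ a * 3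
      eq₃ = solve-∀
    go : ∀ h′ → h ≡ h′ → (suc (quotient L h′) * 15 + 2 ^ h′ * 30) * ℓ ≤ 150 * L
    go zero    e = contradiction (subst (1 ≤_) e 1≤h) λ ()
    go (suc h₀) e = begin
      (suc q * 15 + 2 ^ suc h₀ * 30) * ℓ                    ≡⟨ eq₄ q (2 ^ suc h₀) ℓ ⟩
      ℓ * 15 + (q * ℓ) * 15 + (2 ^ suc h₀ * ℓ) * 30         ≤⟨ +-mono-≤ (+-mono-≤ (*-monoˡ-≤ 15 ℓ≤L) (*-monoˡ-≤ 15 qℓ≤)) (*-monoˡ-≤ 30 pℓ≤) ⟩
      L * 15 + (L * 3) * 15 + (L * 3) * 30                  ≡⟨ eq₅ L ⟩
      150 * L                                               ∎
      where
      q = L / suc h₀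
      qℓ≤ : q * ℓ ≤ L * 3
      qℓ≤ = begin
        q * ℓ              ≤⟨ *-monoʳ-≤ q ℓ≤3h ⟩
        q * (h * 3)        ≡⟨ cong (λ h → q * (h * 3)) e ⟩
        q * (suc h₀ * 3)   ≡⟨ *-assoc q (suc h₀) 3 ⟨
        q * suc h₀ * 3     ≤⟨ *-monoˡ-≤ 3 (m/n*n≤m L (suc h₀)) ⟩
        L * 3              ∎
      pℓ≤ : 2 ^ suc h₀ * ℓ ≤ L * 3
      pℓ≤ = begin
        2 ^ suc h₀ * ℓ         ≡⟨ cong (λ h → 2 ^ h * ℓ) e ⟨
        -- Since 2^h is about √L, one factor 2^h is left to absorb ℓ ≤ 3 h ≤ 3 · 2^h.
        2 ^ h * ℓ              ≤⟨ *-monoʳ-≤ (2 ^ h) (≤-trans ℓ≤3h (*-monoˡ-≤ 3 (<⇒≤ (k<2^k h)))) ⟩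
        2 ^ h * (2 ^ h * 3)    ≡⟨ *-assoc (2 ^ h) (2 ^ h) 3 ⟨
        2 ^ h * 2 ^ h * 3      ≡⟨ cong (_* 3) (^-distribˡ-+-* 2 h h) ⟨
        2 ^ (h + h) * 3        ≤⟨ *-monoˡ-≤ 3 (≤-trans (^-monoʳ-≤ 2 h+h≤ℓ) 2^ℓ≤L) ⟩
        L * 3                  ∎
      eq₄ : ∀ q p ℓ → (suc q * 15 + p * 30) * ℓ ≡ ℓ * 15 + (q * ℓ) * 15 + (p * ℓ) * 30
      eq₄ = solve-∀
      eq₅ : ∀ L → L * 15 + (L * 3) * 15 + (L * 3) * 30 ≡ 150 * L
      eq₅ = solve-∀

-- The algorithm as a program

module Terms where

  private variable
    a b c : Ty
    a₀ a₁ a₂ a₃ a₄ a₅ a₆ a₇ : Ty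
    Γ : Ctx

  x₀ : Tm (a₀ ∷ Γ) a₀
  x₀ = get zero
  x₁ : Tm (a₀ ∷ a₁ ∷ Γ) a₁
  x₁ = get (suc zero)
  x₂ : Tm (a₀ ∷ a₁ ∷ a₂ ∷ Γ) a₂
  x₂ = get (suc (suc zero))
  x₃ : Tm (a₀ ∷ a₁ ∷ a₂ ∷ a₃ ∷ Γ) a₃
  x₃ = get (suc (suc (suc zero)))
  x₄ : Tm (a₀ ∷ a₁ ∷ a₂ ∷ a₃ ∷ a₄ ∷ Γ) a₄
  x₄ = get (suc (suc (suc (suc zero))))
  x₅ : Tm (a₀ ∷ a₁ ∷ a₂ ∷ a₃ ∷ a₄ ∷ a₅ ∷ Γ) a₅
  x₅ = get (suc (suc (suc (suc (suc zero)))))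
  x₆ : Tm (a₀ ∷ a₁ ∷ a₂ ∷ a₃ ∷ a₄ ∷ a₅ ∷ a₆ ∷ Γ) a₆
  x₆ = get (suc (suc (suc (suc (suc (suc zero))))))
  x₇ : Tm (a₀ ∷ a₁ ∷ a₂ ∷ a₃ ∷ a₄ ∷ a₅ ∷ a₆ ∷ a₇ ∷ Γ) a₇
  x₇ = get (suc (suc (suc (suc (suc (suc (suc zero)))))))
  x₈ : Tm (a₀ ∷ a₁ ∷ a₂ ∷ a₃ ∷ a₄ ∷ a₅ ∷ a₆ ∷ a₇ ∷ a ∷ Γ) a
  x₈ = get (suc (suc (suc (suc (suc (suc (suc (suc zero))))))))

  packet output state subset matrix assignment : Ty
  packet     = node ⊗ nat ⊗ list node
  output     = nat ⊗ list (list (node ⊗ node))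
  subset     = arr bool
  matrix     = arr subset
  assignment = arr (maybe node)
  state      = bool ⊗ subset ⊗ output

  forest packing : Ty
  forest  = arr packet
  packing = subset ⊗ forest ⊗ subset

  infixr 6 _&&ₜ_
  infixr 5 _||ₜ_

  _&&ₜ_ _||ₜ_ : Tm Γ bool → Tm Γ bool → Tm Γ bool
  d &&ₜ e = ite d e (bit false)
  d ||ₜ e = ite d (bit true) e

  negₜ : Tm Γ bool → Tm Γ bool
  negₜ e = ite e (bit false) (bit true)

  foldVₜ : Tm Γ b → Tm (node ∷ b ∷ Γ) b → Tm Γ b
  foldVₜ = fold arrS (tab x₀)

  timesₜ : Tm Γ node → Tm Γ b → Tm (unit ∷ b ∷ Γ) b → Tm Γ b
  timesₜ = fold nodeS

  zeroₜ : Tm Γ nat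
  zeroₜ = null natV

  sucₜ predₜ : Tm Γ nat → Tm Γ nat
  sucₜ e  = con natV unit e
  predₜ e = elim natV e zeroₜ x₁

  nothingₜ : Tm Γ (maybe a)
  nothingₜ = null maybeV

  justₜ : Tm Γ a → Tm Γ (maybe a)
  justₜ e = con maybeV e unit

  exceedsₜ : Tm (nat ∷ node ∷ []) bool
  exceedsₜ = elim natV (timesₜ x₁ x₀ (predₜ x₁)) (bit false) (bit true)

  ltₜ eqₜ : Tm (node ∷ node ∷ []) bool
  ltₜ = app exceedsₜ (timesₜ x₁ zeroₜ (sucₜ x₁) ∷ x₀ ∷ [])
  eqₜ = negₜ (app ltₜ (x₀ ∷ x₁ ∷ [])) &&ₜ negₜ (app ltₜ (x₁ ∷ x₀ ∷ []))

  findₜ : Tm (subset ∷ []) (maybe node)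
  findₜ = foldVₜ nothingₜ (elim maybeV x₁ (ite (at x₂ x₀) (justₜ x₀) nothingₜ) (justₜ x₀))

  existsₜ : Tm (subset ∷ []) bool
  existsₜ = elim maybeV (app findₜ (x₀ ∷ [])) (bit false) (bit true)

  countₜ : Tm (subset ∷ []) nat
  countₜ = foldVₜ zeroₜ (ite (at x₂ x₀) (sucₜ x₁) x₁)

  rankₜ : Tm (subset ∷ node ∷ []) nat
  rankₜ = app countₜ (tab (app ltₜ (x₀ ∷ x₂ ∷ []) &&ₜ at x₁ x₀) ∷ [])

  rootₜ : Tm Γ packet → Tm Γ node
  rootₜ e = fst e

  waitₜ : Tm Γ packet → Tm Γ nat
  waitₜ e = fst (snd e)

  pathₜ : Tm Γ packet → Tm Γ (list node)
  pathₜ e = snd (snd e)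

  packetₜ : Tm Γ node → Tm Γ nat → Tm Γ (list node) → Tm Γ packet
  packetₜ r w p = pair r (pair w p)

  busyₜ : Tm Γ packet → Tm Γ bool
  busyₜ e = elim listV (pathₜ e) (bit false) (bit true)

  startₜ : Tm (subset ∷ []) forest
  startₜ = tab (packetₜ x₀ zeroₜ (ite (at x₁ x₀) (con listV x₀ (null listV)) (null listV)))

  growₜ : Tm (matrix ∷ subset ∷ forest ∷ []) forest
  growₜ = tab (ite (busyₜ (at x₃ x₀))
    (packetₜ (rootₜ (at x₃ x₀)) (sucₜ (waitₜ (at x₃ x₀))) (pathₜ (at x₃ x₀)))
    (ite (at x₂ x₀)
      (elim maybeV (app findₜ (tab (at (at x₂ x₀) x₁ &&ₜ busyₜ (at x₄ x₀)) ∷ []))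
        (at x₃ x₀)
        (packetₜ (rootₜ (at x₅ x₀)) zeroₜ (con listV x₂ (pathₜ (at x₅ x₀)))))
      (at x₃ x₀)))

  bfsₜ : Tm (matrix ∷ subset ∷ node ∷ forest ∷ []) forest
  bfsₜ = timesₜ x₂ x₃ (app growₜ (x₂ ∷ x₃ ∷ x₁ ∷ []))

  bfs₁ₜ bfs₂ₜ : Tm (matrix ∷ subset ∷ node ∷ subset ∷ []) forest
  bfs₁ₜ = app bfsₜ (x₀ ∷ x₁ ∷ x₂ ∷ app startₜ (x₃ ∷ []) ∷ [])
  bfs₂ₜ = app bfsₜ (x₀ ∷ x₁ ∷ x₂ ∷ app bfs₁ₜ (x₀ ∷ x₁ ∷ x₂ ∷ x₃ ∷ []) ∷ [])

  closureₜ : Tm (matrix ∷ subset ∷ []) forest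
  closureₜ = foldVₜ (app startₜ (x₁ ∷ [])) (app growₜ (x₂ ∷ tab (bit true) ∷ x₁ ∷ []))

  popEqₜ : Tm (node ∷ bool ⊗ list node ∷ []) (bool ⊗ list node)
  popEqₜ = elim listV (snd x₁) x₁ (pair (fst x₃ ||ₜ app eqₜ (x₀ ∷ x₂ ∷ [])) x₁)

  onPathₜ : Tm (node ∷ node ∷ list node ∷ []) bool
  onPathₜ = fst (timesₜ x₀ (pair (bit false) x₂)
    (app popEqₜ (x₃ ∷ app popEqₜ (x₃ ∷ app popEqₜ (x₃ ∷ x₁ ∷ []) ∷ []) ∷ [])))

  chosenₜ : Tm (node ∷ subset ∷ []) subset
  chosenₜ = tab (at x₂ x₀ &&ₜ negₜ (app exceedsₜ (app rankₜ (x₂ ∷ x₀ ∷ []) ∷ x₁ ∷ [])))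

  freeₜ : Tm (subset ∷ []) subset
  freeₜ = tab (negₜ (at x₁ x₀))

  ballₜ : Tm (matrix ∷ node ∷ subset ∷ node ∷ []) forest
  ballₜ = app bfs₂ₜ (x₀ ∷ app freeₜ (x₂ ∷ []) ∷ x₁ ∷
    tab (app eqₜ (x₀ ∷ x₄ ∷ []) &&ₜ negₜ (at x₃ x₀)) ∷ [])

  claimₜ : Tm (node ∷ subset ∷ forest ∷ node ∷ packing ∷ []) packing
  claimₜ = ite (app exceedsₜ (app countₜ (x₁ ∷ []) ∷ x₀ ∷ []))
    (pair (tab (at (fst x₅) x₀ ||ₜ app existsₜ
            (tab (at (app chosenₜ (x₂ ∷ x₃ ∷ [])) x₀ &&ₜ
                  app onPathₜ (x₂ ∷ x₁ ∷ pathₜ (at x₄ x₀) ∷ [])) ∷ [])))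
    (pair (tab (ite (at (app chosenₜ (x₁ ∷ x₂ ∷ [])) x₀) (at x₃ x₀) (at (fst (snd x₅)) x₀)))
          (tab (at (snd (snd x₅)) x₀ ||ₜ app eqₜ (x₀ ∷ x₄ ∷ [])))))
    x₄

  noneₜ : Tm (node ∷ Γ) packet
  noneₜ = packetₜ x₀ zeroₜ (null listV)

  opaque
    packₜ : Tm (matrix ∷ node ∷ node ∷ subset ∷ []) packing
    packₜ = foldVₜ
      (pair (tab (app eqₜ (x₀ ∷ x₂ ∷ []))) (pair (tab noneₜ) (tab (bit false))))
      (bind (app ballₜ (x₂ ∷ x₄ ∷ fst x₁ ∷ x₀ ∷ []))
        (app claimₜ (x₅ ∷ tab (at x₇ x₀ &&ₜ busyₜ (at x₁ x₀)) ∷ x₀ ∷ x₁ ∷ x₂ ∷ [])))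

  opaque
    leadersₜ : Tm (matrix ∷ node ∷ subset ∷ subset ∷ []) subset
    leadersₜ = foldVₜ (tab (bit false))
      (ite (at x₄ x₀ &&ₜ negₜ (at x₅ x₀) &&ₜ
            negₜ (busyₜ (at (app bfs₂ₜ (x₂ ∷ app freeₜ (x₅ ∷ []) ∷ x₃ ∷ x₁ ∷ [])) x₀)))
        (tab (at x₂ x₀ ||ₜ app eqₜ (x₀ ∷ x₁ ∷ []))) x₁)

  opaque
    cellsₜ : Tm (matrix ∷ node ∷ subset ∷ subset ∷ subset ∷ []) forest
    cellsₜ = bind (app bfs₂ₜ (x₀ ∷ app freeₜ (x₃ ∷ []) ∷ x₁ ∷ x₄ ∷ []))
      (tab (ite (at x₄ x₀) (at x₁ x₀) noneₜ))

  reachₜ : Tm (matrix ∷ node ∷ subset ∷ node ∷ []) forest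
  reachₜ = app bfs₁ₜ (x₀ ∷ app freeₜ (x₂ ∷ []) ∷ x₁ ∷ tab (app eqₜ (x₀ ∷ x₄ ∷ [])) ∷ [])

  opaque
    reachesₜ : Tm (matrix ∷ node ∷ subset ∷ []) (arr forest)
    reachesₜ = tab (app reachₜ (x₁ ∷ x₂ ∷ x₃ ∷ x₀ ∷ []))

  isAtₜ : Tm (maybe node ∷ node ∷ []) bool
  isAtₜ = elim maybeV x₀ (bit false) (app eqₜ (x₀ ∷ x₃ ∷ []))

  loadₜ : Tm (assignment ∷ node ∷ []) nat
  loadₜ = app countₜ (tab (app isAtₜ (at x₁ x₀ ∷ x₂ ∷ [])) ∷ [])

  roomₜ : Tm (node ∷ assignment ∷ node ∷ []) bool
  roomₜ = negₜ (app exceedsₜ (sucₜ (app loadₜ (x₁ ∷ x₂ ∷ [])) ∷ x₀ ∷ []))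

  movableₜ : Tm (matrix ∷ assignment ∷ node ∷ node ∷ []) subset
  movableₜ = tab (app isAtₜ (at x₂ x₀ ∷ x₃ ∷ []) &&ₜ at (at x₁ x₀) x₄)

  exchangeₜ : Tm (matrix ∷ assignment ∷ []) matrix
  exchangeₜ = tab (tab (app existsₜ (app movableₜ (x₂ ∷ x₃ ∷ x₁ ∷ x₀ ∷ []) ∷ [])))

  updateₜ : Tm (assignment ∷ node ∷ node ∷ []) assignment
  updateₜ = tab (ite (app eqₜ (x₀ ∷ x₂ ∷ [])) (justₜ x₃) (at x₁ x₀))

  shiftₜ : Tm (matrix ∷ node ∷ list node ⊗ assignment ∷ []) (list node ⊗ assignment)
  shiftₜ = elim listV (fst x₂) x₂
    (elim listV x₁ (pair (null listV) (app updateₜ (snd x₄ ∷ x₃ ∷ x₀ ∷ [])))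
      (pair (con listV x₀ x₁)
        (elim maybeV (app findₜ (app movableₜ (x₄ ∷ snd x₆ ∷ x₀ ∷ x₂ ∷ []) ∷ []))
          (snd x₆) (app updateₜ (snd x₈ ∷ x₀ ∷ x₄ ∷ [])))))

  augmentingₜ : Tm (matrix ∷ assignment ∷ node ∷ []) forest
  augmentingₜ = app closureₜ (app exchangeₜ (x₀ ∷ x₁ ∷ []) ∷ at x₀ x₂ ∷ [])

  augmentₜ : Tm (matrix ∷ node ∷ node ∷ bool ⊗ assignment ∷ []) (bool ⊗ assignment)
  augmentₜ = bind (app augmentingₜ (x₀ ∷ snd x₃ ∷ x₂ ∷ []))
    (elim maybeV (app findₜ (tab (busyₜ (at x₁ x₀) &&ₜ app roomₜ (x₃ ∷ snd x₅ ∷ x₀ ∷ [])) ∷ []))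
      (pair (bit false) (snd x₄))
      (pair (fst x₆) (snd (foldVₜ (pair (pathₜ (at x₂ x₀)) (snd x₆))
        (app shiftₜ (x₅ ∷ x₇ ∷ x₁ ∷ []))))))

  opaque
    matchingₜ : Tm (matrix ∷ node ∷ subset ∷ []) (bool ⊗ assignment)
    matchingₜ = foldVₜ (pair (bit true) (tab nothingₜ))
      (ite (at x₄ x₀ &&ₜ elim maybeV (at (snd x₁) x₀) (bit true) (bit false))
        (app augmentₜ (x₂ ∷ x₃ ∷ x₀ ∷ x₁ ∷ [])) x₁)

  candidatesₜ : Tm (arr forest ∷ subset ∷ subset ∷ []) matrix
  candidatesₜ = tab (tab (at x₄ x₁ &&ₜ at x₃ x₀ &&ₜ busyₜ (at (at x₂ x₀) x₁)))

  spokesₜ : Tm (arr forest ∷ assignment ∷ []) forest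
  spokesₜ = tab (elim maybeV (at x₂ x₀) noneₜ (at (at x₃ x₀) x₂))

  delayₜ : Tm (forest ∷ []) forest
  delayₜ = tab (packetₜ (rootₜ (at x₁ x₀))
    (foldVₜ (waitₜ (at x₁ x₀))
      (ite (app ltₜ (x₀ ∷ x₂ ∷ []) &&ₜ busyₜ (at x₃ x₀) &&ₜ
            app eqₜ (rootₜ (at x₃ x₀) ∷ rootₜ (at x₃ x₂) ∷ []))
        (sucₜ (sucₜ x₁)) x₁))
    (pathₜ (at x₁ x₀)))

  advanceₜ : Tm (packet ∷ []) packet
  advanceₜ = packetₜ (rootₜ x₀) (predₜ (waitₜ x₀))
    (elim natV (waitₜ x₀) (elim listV (pathₜ x₀) (null listV) x₁) (pathₜ x₂))

  callsₜ : Tm (forest ∷ []) (list (node ⊗ node))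
  callsₜ = foldVₜ (null listV)
    (elim natV (waitₜ (at x₂ x₀))
      (elim listV (pathₜ (at x₂ x₀)) x₁
        (elim listV x₁ x₃ (con listV (pair x₀ x₂) x₅)))
      x₃)

  stepₜ : Tm (forest ⊗ output ∷ []) (forest ⊗ output)
  stepₜ = pair (tab (app advanceₜ (at (fst x₁) x₀ ∷ [])))
    (pair (sucₜ (fst (snd x₀))) (con listV (app callsₜ (fst x₀ ∷ [])) (snd (snd x₀))))

  opaque
    routeₜ : Tm (node ∷ forest ∷ output ∷ []) output
    routeₜ = snd (timesₜ x₀ (pair (app delayₜ (x₁ ∷ [])) x₂)
      (app stepₜ (app stepₜ (app stepₜ (app stepₜ (app stepₜ (x₁ ∷ []) ∷ []) ∷ []) ∷ []) ∷ [])))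

  opaque
    phaseₜ : Tm (matrix ∷ node ∷ node ∷ state ∷ []) state
    phaseₜ =
      bind (app packₜ (x₀ ∷ x₁ ∷ x₂ ∷ fst (snd x₃) ∷ []))
      (bind (app leadersₜ (x₁ ∷ x₃ ∷ fst (snd x₄) ∷ fst x₀ ∷ []))
      (bind (app reachesₜ (x₂ ∷ x₄ ∷ fst x₁ ∷ []))
      (bind (app matchingₜ (app candidatesₜ (x₀ ∷ fst x₂ ∷ x₁ ∷ []) ∷ x₅ ∷ x₁ ∷ []))
      (pair (ite (fst x₀) (fst x₇) (bit false))
      (pair (snd (snd x₃))
        (app routeₜ (x₆ ∷ fst (snd x₃) ∷
          app routeₜ (x₆ ∷ app spokesₜ (x₁ ∷ snd x₀ ∷ []) ∷
            app routeₜ (x₆ ∷ app cellsₜ (x₄ ∷ x₆ ∷ fst (snd x₇) ∷ fst x₃ ∷ x₂ ∷ []) ∷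
              snd (snd x₇) ∷ []) ∷ []) ∷ [])))))))

  opaque
    runₜ : Tm (matrix ∷ node ∷ node ∷ []) state
    runₜ = foldVₜ
      (pair (bit true) (pair (tab (negₜ (app eqₜ (x₀ ∷ x₂ ∷ [])))) (pair zeroₜ (null listV))))
      (ite (fst x₁ &&ₜ app existsₜ (fst (snd x₁) ∷ []))
        (app phaseₜ (x₂ ∷ x₃ ∷ x₄ ∷ x₁ ∷ [])) x₁)

  opaque
    broadcastₜ : Tm (matrix ∷ node ∷ []) output
    broadcastₜ = elim maybeV
      (foldVₜ nothingₜ (elim maybeV x₁
        (bind (app runₜ (x₂ ∷ x₃ ∷ x₀ ∷ [])) (ite (fst x₀) (justₜ (snd (snd x₀))) nothingₜ))
        (justₜ x₀)))
      (pair zeroₜ (null listV)) x₀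

  opaque
    adjacencyₜ : Tm [] matrix
    adjacencyₜ = tab (tab (fold edgeS allEdges (bit false)
      (x₁ ||ₜ negₜ (app eqₜ (x₃ ∷ x₂ ∷ [])) &&ₜ
        (app eqₜ (fst x₀ ∷ x₃ ∷ []) &&ₜ app eqₜ (snd x₀ ∷ x₂ ∷ []) ||ₜ
         app eqₜ (fst x₀ ∷ x₂ ∷ []) &&ₜ app eqₜ (snd x₀ ∷ x₃ ∷ [])))))

  peelₜ : Tm (nat ⊗ nat ⊗ nat ∷ []) (nat ⊗ nat ⊗ nat)
  peelₜ = pair (elim natV (fst (snd x₀)) (elim natV (snd (snd x₀)) (fst x₀) (sucₜ (fst x₂))) (sucₜ (fst x₂)))
    (pair (predₜ (fst (snd x₀))) (predₜ (snd (snd x₀))))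

  peelsₜ : ℕ → Tm Γ (nat ⊗ nat ⊗ nat) → Tm Γ (nat ⊗ nat ⊗ nat)
  peelsₜ ℕ.zero    e = e
  peelsₜ (ℕ.suc k) e = app peelₜ (peelsₜ k e ∷ [])

  opaque
    maximumₜ : ℕ → Tm (nat ∷ nat ∷ []) nat
    maximumₜ c = fst (foldVₜ (pair zeroₜ (pair x₀ x₁)) (foldVₜ x₁ (peelsₜ c x₁)))

  rootedₜ : Tm (node ∷ []) output
  rootedₜ = app broadcastₜ (app adjacencyₜ [] ∷ x₀ ∷ [])

  unrootedₜ : Tm [] (nat ⊗ arr (list (list (node ⊗ node))))
  unrootedₜ = bind (tab (app rootedₜ (x₀ ∷ [])))
    (pair (foldVₜ zeroₜ (app (maximumₜ 15) (x₁ ∷ fst (at x₂ x₀) ∷ []))) (tab (snd (at x₁ x₀))))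

  -- Values of the terms

  module Interpretation (n : ℕ) (E : List (Fin n × Fin n)) where
    open Semantics n E
    open Algorithm n

    foldl-pointwise : ∀ {A B : Set} {f g : B → A → B} → (∀ y x → f y x ≡ g y x) →
                      ∀ xs {z} → foldl f z xs ≡ foldl g z xs
    foldl-pointwise e []       = refl
    foldl-pointwise {g = g} e (x ∷ xs) {z} =
      trans (cong (λ y → foldl _ y xs) (e z x)) (foldl-pointwise e xs)

    opaque
      unfolding exceeds bfs₁ onPath ball pack packₜ

      -- The term was written in step with the function, so both have the same normal form. Opaque
      -- definitions are unfolded for one stage at a time, which keeps these comparisons small.
      eval-pack : ∀ A r t act → eval packₜ (A , r , t , act , tt) ≡ pack A r t act
      eval-pack _ _ _ _ = refl

    opaque
      unfolding exceeds bfs₁ leaders leadersₜ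

      eval-leaders : ∀ A t act rem → eval leadersₜ (A , t , act , rem , tt) ≡ leaders A t act rem
      eval-leaders _ _ _ _ = refl

    opaque
      unfolding exceeds bfs₁ cellsₜ

      eval-cells : ∀ A t act rem L → eval cellsₜ (A , t , act , rem , L , tt) ≡ cells A t act rem L
      eval-cells _ _ _ _ _ = refl

    opaque
      unfolding exceeds bfs₁ reach reachesₜ

      eval-reaches : ∀ A t rem → eval reachesₜ (A , t , rem , tt) ≡ reach A t rem
      eval-reaches _ _ _ = refl

    opaque
      unfolding exceeds bfs₁ matching matchingₜ

      eval-matching : ∀ C t L → eval matchingₜ (C , t , L , tt) ≡ matching C t L
      eval-matching _ _ _ = refl

    opaque
      unfolding exceeds route routeₜ

      eval-route : ∀ t S out → eval routeₜ (t , S , out , tt) ≡ route t S out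
      eval-route _ _ _ = refl

    module _ (A : Matrix) (r t : V) (s : State) where
      private
        ok  = proj₁ s
        act : Subset
        act = proj₁ (proj₂ s)
        out = proj₂ (proj₂ s)

      -- `phase` as a function of the results of its stages. These can then be replaced one by one,
      -- although each stage depends on the earlier ones.
      assemble : Packing → (V → Forest) → Bool × Assignment → Forest → (Forest → Output → Output) → State
      assemble P C M S₃ R = (if proj₁ M then ok else false) , proj₂ (proj₂ P) ,
        R (proj₁ (proj₂ P)) (R (spokes C (proj₂ M)) (R S₃ out))

      assemble-route : ∀ P C M S₃ {R R′} → (∀ S out → R S out ≡ R′ S out) →
                       assemble P C M S₃ R ≡ assemble P C M S₃ R′
      assemble-route P C M S₃ {R} {R′} e = cong (λ o → (if proj₁ M then ok else false) , proj₂ (proj₂ P) , o)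
        (trans (e _ _) (cong (R′ _) (trans (e _ _) (cong (R′ _) (e _ _)))))

      assemble-phase : ∀ P L C M S₃ → P ≡ pack A r t act →
        L ≡ eval leadersₜ (A , t , act , proj₁ P , tt) →
        C ≡ eval reachesₜ (A , t , proj₁ P , tt) →
        M ≡ eval matchingₜ (candidates C (proj₁ P) L , t , L , tt) →
        S₃ ≡ eval cellsₜ (A , t , act , proj₁ P , L , tt) →
        assemble P C M S₃ (route t) ≡ phase A r t s
      assemble-phase P L C M S₃ refl l c m d
        with trans l (eval-leaders A t act (proj₁ P)) | trans c (eval-reaches A t (proj₁ P))
      ... | refl | refl with trans m (eval-matching (candidates C (proj₁ P) L) t L)
                           | trans d (eval-cells A t act (proj₁ P) L)
      ... | refl | refl = refl

    opaque
      unfolding phaseₜ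

      eval-phase : ∀ A r t s → eval phaseₜ (A , r , t , s , tt) ≡ phase A r t s
      eval-phase A r t s = trans
        (assemble-route A r t s P C M S₃ (eval-route t))
        (assemble-phase A r t s P L C M S₃ (eval-pack A r t act) refl refl refl refl)
        where
        act : Subset
        act = proj₁ (proj₂ s)
        P : Packing
        P = eval packₜ (A , r , t , act , tt)
        L : Subset
        L = eval leadersₜ (A , t , act , proj₁ P , tt)
        C : V → Forest
        C = eval reachesₜ (A , t , proj₁ P , tt)
        M : Bool × Assignment
        M = eval matchingₜ (candidates C (proj₁ P) L , t , L , tt)
        S₃ : Forest
        S₃ = eval cellsₜ (A , t , act , proj₁ P , L , tt)

    opaque
      unfolding exceeds runₜ

      eval-run : ∀ A r t → eval runₜ (A , r , t , tt) ≡ run A r t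
      eval-run A r t = foldl-pointwise
        (λ s _ → cong (λ s′ → if proj₁ s && exists (proj₁ (proj₂ s)) then s′ else s) (eval-phase A r t s))
        (tabulate {n = n} (λ v → v))

    opaque
      unfolding broadcastₜ

      eval-broadcast : ∀ A r → eval broadcastₜ (A , r , tt) ≡ broadcast A r
      eval-broadcast A r = cong (λ m → caseM m (0 , []) (λ o → o)) (foldl-pointwise
        (λ best t → cong (λ s → caseM best (if proj₁ s then just (proj₂ (proj₂ s)) else nothing) just)
          (eval-run A r t))
        (tabulate {n = n} (λ v → v)))

    opaque
      unfolding exceeds adjacencyₜ

      eval-adjacency : eval adjacencyₜ tt ≡ adjacency E
      eval-adjacency = refl

    eval-rooted : ∀ r → eval rootedₜ (r , tt) ≡ broadcast (adjacency E) r
    eval-rooted r = trans (cong (λ A → eval broadcastₜ (A , r , tt)) eval-adjacency)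
      (eval-broadcast (adjacency E) r)

    eval-peels : ∀ c (e : Tm Γ (nat ⊗ nat ⊗ nat)) ρ → eval (peelsₜ c e) ρ ≡ repeat c peel (eval e ρ)
    eval-peels ℕ.zero    e ρ = refl
    eval-peels (ℕ.suc c) e ρ = cong peel (eval-peels c e ρ)

    opaque
      unfolding maximum maximumₜ

      eval-maximum : ∀ c j k → eval (maximumₜ c) (j , k , tt) ≡ maximum c j k
      eval-maximum c j k = cong proj₁ (foldl-pointwise
        (λ s u → foldl-pointwise (λ s′ w → eval-peels c x₁ (w , s′ , u , s , j , k , tt)) (tabulate {n = n} (λ v → v)))
        (tabulate {n = n} (λ v → v)))

    eval-unrooted-value : proj₁ (eval unrootedₜ tt) ≡
      foldV (λ k r → maximum 15 k (proj₁ (broadcast (adjacency E) r))) 0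
    eval-unrooted-value = foldl-pointwise (λ k r → trans (eval-maximum 15 k (proj₁ (eval rootedₜ (r , tt))))
        (cong (λ o → maximum 15 k (proj₁ o)) (eval-rooted r)))
      (tabulate {n = n} (λ v → v))

    eval-unrooted-rounds : ∀ r → proj₂ (eval unrootedₜ tt) r ≡ proj₂ (broadcast (adjacency E) r)
    eval-unrooted-rounds r = cong proj₂ (eval-rooted r)

open Terms

-- Correctness of the result

module Maximum (n : ℕ) where
  open Algorithm n
  open Search n

  private
    record Peeled (m i : ℕ) (s : ℕ × ℕ × ℕ) : Set where
      constructor _,_
      o = proj₁ s
      j = proj₁ (proj₂ s)
      k = proj₂ (proj₂ s)
      field
        total : o + (j ⊔ k) ≡ m
        left  : j ⊔ k ≡ m ∸ i

    peel-shrink : ∀ m i s → Peeled m i s → Peeled m (suc i) (peel s)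
    peel-shrink m i (o , j , k) (e , l) = shrink j k e l
      where
      fewer : ∀ {x} → suc x ≡ m ∸ i → x ≡ m ∸ suc i
      fewer l = trans (cong pred l) (pred[m∸n]≡m∸[1+n] m i)
      shrink : ∀ j k → o + (j ⊔ k) ≡ m → j ⊔ k ≡ m ∸ i → Peeled m (suc i) (peel (o , j , k))
      shrink zero    zero    e l = e , trans (cong pred l) (pred[m∸n]≡m∸[1+n] m i)
      shrink zero    (suc k) e l = trans (sym (+-suc o k)) e , fewer l
      shrink (suc j) zero    e l = trans (cong (λ x → suc (o + x)) (⊔-identityʳ j)) (trans (sym (+-suc o j)) e) ,
                                 trans (⊔-identityʳ j) (fewer l)
      shrink (suc j) (suc k) e l = trans (sym (+-suc o (j ⊔ k))) e , fewer l

    peels : ∀ c m i s → Peeled m i s → Peeled m (c + i) (repeat c peel s)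
    peels zero    m i s p = p
    peels (suc c) m i s p = peel-shrink m (c + i) _ (peels c m i s p)

    rounds : length (tabulate {n = n} id) + 0 ≡ n
    rounds = trans (+-identityʳ _) (length-tabulate {n = n} id)

    sweep : ∀ c m i s → Peeled m i s → Peeled m (n * c + i) (foldV (λ s′ _ → repeat c peel s′) s)
    sweep c m i s p = subst (λ r → Peeled m (r * c + i) (foldV (λ s′ _ → repeat c peel s′) s)) rounds
      (iteration (λ r s → Peeled m (r * c + i) s)
        (λ r s p → subst (λ k → Peeled m k (repeat c peel s)) (sym (+-assoc c (r * c) i)) (peels c m _ s p))
        (tabulate {n = n} id) {0} p)

    sweeps : ∀ c m s → Peeled m 0 s →
      Peeled m (n * (n * c)) (foldV (λ s _ → foldV (λ s′ _ → repeat c peel s′) s) s)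
    sweeps c m s p = subst (λ r → Peeled m (r * (n * c)) (foldV (λ s _ → foldV (λ s′ _ → repeat c peel s′) s) s)) rounds
      (iteration (λ r s → Peeled m (r * (n * c)) s) (λ r s p → sweep c m _ s p)
        (tabulate {n = n} id) {0} p)

  opaque
    unfolding maximum

    maximum≡ : ∀ c j k → j ⊔ k ≤ n * (n * c) → maximum c j k ≡ j ⊔ k
    maximum≡ c j k l = conclude _ (sweeps c (j ⊔ k) (zero , j , k) (refl , refl))
      where
      conclude : ∀ s → Peeled (j ⊔ k) (n * (n * c)) s → proj₁ s ≡ j ⊔ k
      conclude (o , _) (e , l′) = trans (sym (+-identityʳ o))
        (trans (cong (o +_) (sym (trans l′ (m≤n⇒m∸n≡0 l)))) e)

  maximum-of : ∀ c (f : V → ℕ) → (∀ v → f v ≤ n * (n * c)) →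
    foldV (λ k v → maximum c k (f v)) 0 ≡ foldr _⊔_ 0 (tabulate f)
  maximum-of c f f≤ = trans (go (tabulate id) 0 z≤n) (cong (foldr _⊔_ 0) (map-tabulate {n = n} id f))
    where
    go : ∀ vs k → k ≤ n * (n * c) →
         foldl (λ k v → maximum c k (f v)) k vs ≡ k ⊔ foldr _⊔_ 0 (map f vs)
    go []       k k≤ = sym (⊔-identityʳ k)
    go (v ∷ vs) k k≤ = trans (cong (λ m → foldl (λ k v → maximum c k (f v)) m vs) (maximum≡ c k (f v) both))
      (trans (go vs (k ⊔ f v) both) (⊔-assoc k (f v) _))
      where
      both : k ⊔ f v ≤ n * (n * c)
      both = ⊔-lub k≤ (f≤ v)

module Broadcasting (G : Graph) (connected : Connected G) (r : Node G) where
  open Algorithm (order G)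
  private
    n = order G
    A = adjacency (edges G)
  open Adjacency G
  open Routing G A adjacency-sound
  open Running G A adjacency-sound adjacency-symmetric r
  open Attempting G A adjacency-sound adjacency-symmetric r
  open Lower-bounds G A adjacency-sound adjacency-complete adjacency-symmetric r

  result : Output
  result = broadcast A r

  achieved : ∀ {D} → 1 ≤ D → D ≤ n → Feasible D → ∃ λ t → T t ≤ D × Achieves t result
  achieved 1≤D D≤n fe with bound-of 1≤D D≤n
  ... | t , refl = let (t′ , l , a) = broadcast-achieves t fe in t′ , s≤s l , a

  1≤n : 1 ≤ n
  1≤n = ≤-trans (s≤s z≤n) (Fin.toℕ<n r)

  always : ∃ λ t → T t ≤ n × Achieves t result
  always = achieved 1≤n ≤-refl (sequential connected)

  plan : Plan result (_≡ r)
  plan = Achieves.plan (proj₂ (proj₂ always))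

  scheme : Scheme G r
  scheme = record
    { rounds    = proj₂ result
    ; telephone = Plan.rounds plan
    ; complete  = Covers.inform (Plan.covers plan) (_≡ r) (λ _ e → e) }

  value : proj₁ result ≡ Scheme.time scheme
  value = Plan.length≡ plan

  -- This is the range in which `maximum 15` is correct. T is at most n, and so is m, since 2^(m -
  -- 1) < n.
  value-≤ : proj₁ result ≤ n * (n * 15)
  value-≤ = let (t , T≤ , a) = always in go t T≤ (Achieves.m a) (Achieves.phases a)
    where
    go : ∀ t → T t ≤ n → ∀ m → Phases t (proj₁ result) m → proj₁ result ≤ n * (n * 15)
    go t T≤ m p = ≤-trans (≤-reflexive (Phases.time p)) (*-mono-≤ (m≤n m (Phases.limit p)) (*-monoˡ-≤ 15 T≤))
      where
      m≤n : ∀ m → m ≡ 0 ⊎ suc (T t) ^ pred m ≤ pred n → m ≤ n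
      m≤n zero    _        = z≤n
      m≤n (suc k) (inj₂ l) = ≤-trans (k<2^k k)
        (≤-trans (^-monoˡ-≤ k (s≤s (s≤s z≤n))) (≤-trans l pred[n]≤n))

  approximates : ∀ opt → IsOPTᵣ G r opt → proj₁ result ≤ ratio n * opt
  approximates opt ((s , refl) , _) with ≤-<-connex n 1
  -- On a single node opt may be 0, so the value has to vanish exactly; here `limit` rules out any
  -- phase because n - 1 = 0.
  ... | inj₁ n≤1 = subst (_≤ ratio n * opt) (sym nothing-to-do) z≤n
    where
    nothing-to-do : proj₁ result ≡ 0
    nothing-to-do = let (t , _ , a) = always in go t (Achieves.m a) (Achieves.phases a)
      where
      go : ∀ t m → Phases t (proj₁ result) m → proj₁ result ≡ 0
      go t zero    p = Phases.time p
      go t (suc k) p with Phases.limit p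
      ... | inj₂ l = contradiction (≤-trans (m^n>0 (suc (T t)) k) (≤-trans l (pred-mono-≤ n≤1))) λ ()
  ... | inj₂ 2≤n with in-time (≤-total opt n)
    where
    1≤opt : 1 ≤ opt
    1≤opt with opt | scheme-doubling s
    ... | zero  | n≤1 = contradiction (≤-trans 2≤n n≤1) λ { (s≤s ()) }
    ... | suc _ | _   = s≤s z≤n
    in-time : opt ≤ n ⊎ n ≤ opt → ∃ λ t → T t ≤ opt × Achieves t result
    in-time (inj₁ l) = achieved 1≤opt l (scheme-feasible s)
    -- Guesses end at n; for opt beyond that, the unconditional success is early enough.
    in-time (inj₂ l) = let (t , T≤ , a) = always in t , ≤-trans T≤ l , a
  ... | t , T≤ , a = subst (_≤ ratio n * opt) (sym (Phases.time (Achieves.phases a)))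
    (time-bound {T t} {Achieves.m a} (s≤s z≤n) T≤ (≤-trans (s≤s z≤n) T≤) (scheme-doubling s)
      (weaken (Phases.limit (Achieves.phases a))))
    where
    weaken : ∀ {m} → m ≡ 0 ⊎ suc (T t) ^ pred m ≤ pred n → m ≡ 0 ⊎ suc (T t) ^ pred m ≤ n
    weaken (inj₁ e) = inj₁ e
    weaken (inj₂ l) = inj₂ (≤-trans l pred[n]≤n)

-- The approximation algorithms

length-≤-∣encList∣ : ∀ {A : Set} (h : A → Tree) xs → length xs ≤ ∣ encList h xs ∣
length-≤-∣encList∣ h []       = z≤n
length-≤-∣encList∣ h (x ∷ xs) = s≤s (≤-trans (length-≤-∣encList∣ h xs) (m≤n+m _ ∣ h x ∣))

≤-∣encℕ∣ : ∀ k → k ≤ ∣ encℕ k ∣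
≤-∣encℕ∣ zero    = z≤n
≤-∣encℕ∣ (suc k) = s≤s (≤-trans (≤-∣encℕ∣ k) (m≤n+m _ 1))

1≤∣_∣ : ∀ x → 1 ≤ ∣ x ∣
1≤∣ nil ∣   = s≤s z≤n
1≤∣ x ∙ y ∣ = s≤s z≤n

∣x∣≤∣x∙y∣ : ∀ x y → ∣ x ∣ ≤ ∣ x ∙ y ∣
∣x∣≤∣x∙y∣ x y = m≤n⇒m≤1+n (m≤m+n ∣ x ∣ ∣ y ∣)

order-≤ : ∀ G → order G ≤ ∣ encGraph G ∣
order-≤ G = ≤-trans (≤-∣encℕ∣ (order G)) (∣x∣≤∣x∙y∣ (encℕ (order G)) _)

edges-≤ : ∀ G → length (edges G) ≤ ∣ encGraph G ∣
edges-≤ G = ≤-trans (length-≤-∣encList∣ encPair (edges G))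
  (m≤n⇒m≤1+n (m≤n+m ∣ encList encPair (edges G) ∣ ∣ encℕ (order G) ∣))

module Setup {Γ a} (e : Tm Γ a) where
  open Compilation {suc (size e)} hiding (drop)

  -- The encoded graph contains its order in unary; function 0 expands it into the list of nodes
  -- that `tab` loops over.
  globals : Exp (suc (size e)) 1 → Exp (suc (size e)) 1
  globals g = cons (call zero (cons (left g) nil)) (right g)

  module _ (setup : Exp (suc (size e)) 1) (G : Graph) (N : ℕ)
           (n≤N : order G ≤ N) (E≤N : length (edges G) ≤ N) where
    open Correctness (program e setup) (order G) (edges G) N n≤N E≤N
    open Semantics (order G) (edges G) using (encEnv)

    globals-computes : ∀ {x g j} → x Vec.∷ Vec.[] ⊢ g ⇓ encGraph G ≲ j →
      x Vec.∷ Vec.[] ⊢ globals g ⇓ encEnv [] tt ≲ 17 + j + j + N * 12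
    globals-computes {x} {g} {j} p = ⇓weaken bound
      (subst (λ y → x Vec.∷ Vec.[] ⊢ globals g ⇓ y ∙ encList encPair (edges G) ≲
        suc (suc (suc (2 + j + 1) + (9 + order G * 12)) + (2 + j))) (prepend-nodes (order G))
        (⇓cons (⇓call refl (⇓cons (⇓left p) ⇓nil) (nodesLoop refl (order G) nil)) (⇓right p)))
      where
      eq′ : ∀ j l → suc (suc (suc (2 + j + 1) + (9 + l)) + (2 + j)) ≡ 17 + j + j + l
      eq′ = solve-∀
      bound : suc (suc (suc (2 + j + 1) + (9 + order G * 12)) + (2 + j)) ≤ 17 + j + j + N * 12
      bound = ≤-trans (≤-reflexive (eq′ j (order G * 12)))
        (+-monoʳ-≤ (17 + j + j) (*-monoˡ-≤ 12 n≤N))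

module Rooted (Γ : TreewidthBoundedClass) (c : ℕ) where
  open MinProblem (MinimumRootedBroadcastTime Γ c)
  open Compilation {suc (size rootedₜ)} hiding (drop)
  open Setup rootedₜ
  open Network

  setup : Exp (suc (size rootedₜ)) 1
  setup = cons (right v₀) (globals (left (left v₀)))

  time-poly : Poly
  time-poly = κ 32 ⊕ 𝐗 ⊛ κ 12 ⊕ cost rootedₜ

  algorithm : PolyTimeApproximation (MinimumRootedBroadcastTime Γ c) ratio
  algorithm = program rootedₜ setup , proj₁ (monomial-bound time-poly) ,
    proj₁ (proj₂ (monomial-bound time-poly)) , solve
    where
    solve : (I : Instance) → Σ (Solution I) λ s → ∃ λ t →
      Computes (program rootedₜ setup) (encI I) (encℕ (value {I} s) ∙ encS {I} s) t ×
      t ≤ proj₁ (monomial-bound time-poly) * ∣ encI I ∣ ^ proj₁ (proj₂ (monomial-bound time-poly)) ×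
      (∀ opt → IsOptimum I opt → value {I} s ≤ ratio (nodes I) * opt)
    solve I@(W , r) = B.scheme , proj₁ computed ,
      subst (λ y → Computes (program rootedₜ setup) (encI I) y (proj₁ computed)) output≡ (proj₁ (proj₂ computed)) ,
      ≤-trans (proj₂ (proj₂ computed)) (≤-trans (≤-reflexive (eq′ (N * 12) (⟦ cost rootedₜ ⟧ₚ N)))
        (proj₂ (proj₂ (monomial-bound time-poly)) N (1≤∣ encI I ∣))) ,
      λ opt o → subst (_≤ ratio (order G) * opt) B.value (B.approximates opt o)
      where
      G = network W
      module B = Broadcasting G (connected W) r
      N = ∣ encI I ∣
      rest = encParse (parse W) ∙ encList encFin (tabulate (Inverse.to (_≅_.bijection (names W))))
      graph≤N : ∣ encGraph G ∣ ≤ N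
      graph≤N = ≤-trans (∣x∣≤∣x∙y∣ (encGraph G) rest) (∣x∣≤∣x∙y∣ (encNetwork W) (encFin r))
      n≤N = ≤-trans (order-≤ G) graph≤N
      E≤N = ≤-trans (edges-≤ G) graph≤N
      open Semantics (order G) (edges G)
      open Interpretation (order G) (edges G) using (eval-rooted)
      open Correctness (program rootedₜ setup) (order G) (edges G) N n≤N E≤N
      computed : ∃ λ t → Computes (program rootedₜ setup) (encI I) (enc output (eval rootedₜ (r , tt))) t ×
                 t ≤ suc (31 + N * 12 + ⟦ cost rootedₜ ⟧ₚ N)
      computed = program-computes rootedₜ setup (order G) (edges G) N n≤N E≤N (r , tt) (encI I) _
        (⇓exact refl (⇓cons (⇓right (⇓var zero)) (globals-computes setup G N n≤N E≤N (⇓left (⇓left (⇓var zero))))))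
      eq′ : ∀ a b → suc (31 + a + b) ≡ 32 + a + b
      eq′ = solve-∀
      output≡ : enc output (eval rootedₜ (r , tt)) ≡ encℕ (Scheme.time B.scheme) ∙ encScheme B.scheme
      output≡ = trans (cong (enc output) (eval-rooted r)) (cong (λ k → encℕ k ∙ encScheme B.scheme) B.value)

module Unrooted (Γ : TreewidthBoundedClass) (c : ℕ) where
  open MinProblem (MinimumBroadcastTime Γ c)
  open Compilation {suc (size unrootedₜ)} hiding (drop)
  open Setup unrootedₜ
  open Network

  setup : Exp (suc (size unrootedₜ)) 1
  setup = globals (left v₀)

  time-poly : Poly
  time-poly = κ 24 ⊕ 𝐗 ⊛ κ 12 ⊕ cost unrootedₜ

  algorithm : PolyTimeApproximation (MinimumBroadcastTime Γ c) ratio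
  algorithm = program unrootedₜ setup , proj₁ (monomial-bound time-poly) ,
    proj₁ (proj₂ (monomial-bound time-poly)) , solve
    where
    solve : (W : Instance) → Σ (Solution W) λ s → ∃ λ t →
      Computes (program unrootedₜ setup) (encI W) (encℕ (value {W} s) ∙ encS {W} s) t ×
      t ≤ proj₁ (monomial-bound time-poly) * ∣ encI W ∣ ^ proj₁ (proj₂ (monomial-bound time-poly)) ×
      (∀ opt → IsOptimum W opt → value {W} s ≤ ratio (nodes W) * opt)
    solve W = B.scheme , proj₁ computed ,
      subst (λ y → Computes (program unrootedₜ setup) (encI W) y (proj₁ computed)) output≡ (proj₁ (proj₂ computed)) ,
      ≤-trans (proj₂ (proj₂ computed)) (≤-trans (≤-reflexive (eq′ (N * 12) (⟦ cost unrootedₜ ⟧ₚ N)))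
        (proj₂ (proj₂ (monomial-bound time-poly)) N (1≤∣ encI W ∣))) ,
      -- Every rooted scheme is compared with the optimum of its own root, which is at most opt.
      λ opt (each , _) → longest-≤ _ _ λ r → let (opt′ , o , opt′≤) = each r in
        ≤-trans (subst (_≤ ratio (order G) * opt′) (B.value r) (B.approximates r opt′ o))
                (*-monoʳ-≤ (ratio (order G)) opt′≤)
      where
      G = network W
      module B = Broadcasting G (connected W)
      N = ∣ encI W ∣
      graph≤N : ∣ encGraph G ∣ ≤ N
      graph≤N = ∣x∣≤∣x∙y∣ (encGraph G)
        (encParse (parse W) ∙ encList encFin (tabulate (Inverse.to (_≅_.bijection (names W)))))
      n≤N = ≤-trans (order-≤ G) graph≤N
      E≤N = ≤-trans (edges-≤ G) graph≤N
      open Semantics (order G) (edges G)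
      open Interpretation (order G) (edges G) using (eval-unrooted-value; eval-unrooted-rounds)
      open Correctness (program unrootedₜ setup) (order G) (edges G) N n≤N E≤N
      longest-≤ : ∀ {k} (f : Fin k → ℕ) b → (∀ r → f r ≤ b) → foldr _⊔_ 0 (tabulate f) ≤ b
      longest-≤ {zero}  f b l = z≤n
      longest-≤ {suc k} f b l = ⊔-lub (l zero) (longest-≤ (f ∘ suc) b (l ∘ suc))
      computed : ∃ λ t → Computes (program unrootedₜ setup) (encI W)
                   (enc (nat ⊗ arr (list (list (node ⊗ node)))) (eval unrootedₜ tt)) t ×
                 t ≤ suc (23 + N * 12 + ⟦ cost unrootedₜ ⟧ₚ N)
      computed = program-computes unrootedₜ setup (order G) (edges G) N n≤N E≤N tt (encI W) _
        (globals-computes setup G N n≤N E≤N (⇓left (⇓var zero)))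
      eq′ : ∀ a b → suc (23 + a + b) ≡ 24 + a + b
      eq′ = solve-∀
      value≡ : proj₁ (eval unrootedₜ tt) ≡ foldr _⊔_ 0 (tabulate (λ r → Scheme.time (B.scheme r)))
      value≡ = trans eval-unrooted-value (trans
        (Maximum.maximum-of (order G) 15 (λ r → proj₁ (B.result r)) B.value-≤)
        (cong (foldr _⊔_ 0) (tabulate-cong B.value)))
      rounds≡ : encList (enc (list (list (node ⊗ node)))) (tabulate (proj₂ (eval unrootedₜ tt))) ≡
                encList (λ x → x) (tabulate (λ r → encScheme (B.scheme r)))
      rounds≡ = trans (cong (encList (enc (list (list (node ⊗ node))))) (tabulate-cong eval-unrooted-rounds))
        (trans (sym (foldr-map _∙_ (enc (list (list (node ⊗ node)))) nil (tabulate (λ r → proj₂ (B.result r)))))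
          (cong (foldr _∙_ nil) (map-tabulate (λ r → proj₂ (B.result r)) (enc (list (list (node ⊗ node)))))))
      output≡ : enc (nat ⊗ arr (list (list (node ⊗ node)))) (eval unrootedₜ tt) ≡
                encℕ (foldr _⊔_ 0 (tabulate (λ r → Scheme.time (B.scheme r)))) ∙
                encList (λ x → x) (tabulate (λ r → encScheme (B.scheme r)))
      output≡ = cong₂ (λ k x → encℕ k ∙ x) value≡ rounds≡

theorem8p8 : (Γ : TreewidthBoundedClass) (c : ℕ) →
    (∃ λ ρ → IsO[log/loglog] ρ × PolyTimeApproximation (MinimumRootedBroadcastTime Γ c) ρ) ×
    (∃ λ ρ → IsO[log/loglog] ρ × PolyTimeApproximation (MinimumBroadcastTime Γ c) ρ)
theorem8p8 Γ c = (ratio , ratio-O , Rooted.algorithm Γ c) , (ratio , ratio-O , Unrooted.algorithm Γ c)
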